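{- Let $M$ be a matroid with dual matroid $M^*$. Suppose that there exists an integer $\ell\geqslant 4$ such that every circuit of $M$ and every circuit of $M^*$ has length (cardinality) at least $\ell$ and at most $(\ell-2)^2(\ell^2-4\ell+2)$. Then $$T_M(2,0)\,T_M(0,2)\geqslant T_M(1,1)^2 .$$
   Context: Matroids are on finite ground sets. For a matroid $M$ with ground set $E$ and rank function $r$, the Tutte polynomial is $T_M(x,y)=\sum_{S\subseteq E}(x-1)^{r(E)-r(S)}(y-1)^{|S|-r(S)}$ (with the convention $0^0=1$). A circuit is a minimal dependent set, and the dual $M^*$ is the matroid on $E$ whose bases are the complements of the bases of $M$. -}

module Defs where

open import Data.Empty using (⊥-elim)
open import Data.Fin.Base using (Fin)
open import Data.Fin.Properties using (any?) renaming (_≟_ to _≟ᶠ_)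
open import Data.Fin.Subset
  using (Subset; inside; outside; ⊤; ⁅_⁆; _∈_; _∉_; _⊆_; _⊂_; ∁; _∪_; _─_; _-_; ∣_∣)
open import Data.Fin.Subset.Properties
open import Data.Integer.Base as ℤ using (ℤ; 0ℤ; 1ℤ)
open import Data.List.Base as List using (List; []; _∷_; _++_; map; filter; foldr)
open import Data.List.Extrema.Nat using (max)
open import Data.Nat.Base as ℕ using (ℕ; zero; suc; _∸_)
open import Data.Nat.Induction using (Acc; acc; <-wellFounded)
open import Data.Product.Base using (∃; ∃-syntax; _×_; _,_; proj₁; proj₂)
open import Data.Sum.Base using (_⊎_; inj₁; inj₂)
open import Data.Vec.Base as Vec using ()
open import Level using (0ℓ)
open import Relation.Binary.PropositionalEquality
  using (_≡_; _≢_; refl; sym; subst)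
open import Relation.Nullary using (¬_; Dec; yes; no)
open import Relation.Nullary.Decidable using (_×-dec_; ¬?; decidable-stable)
open import Relation.Unary using (Pred; Decidable)

private
  variable
    n : ℕ

-- The ground set is Fin n.  Being a basis is assumed decidable, which is no
-- restriction classically; it lets the rank be computed.
record Matroid (n : ℕ) : Set₁ where
  field
    IsBasis  : Pred (Subset n) 0ℓ
    isBasis? : Decidable IsBasis
    nonempty : ∃[ B ] IsBasis B
    exchange : ∀ {A B} → IsBasis A → IsBasis B →
               ∀ {x} → x ∈ A → x ∉ B →
               ∃[ y ] y ∈ B × y ∉ A × IsBasis ((A - x) ∪ ⁅ y ⁆)

  Independent : Pred (Subset n) 0ℓ
  Independent I = ∃[ B ] IsBasis B × I ⊆ B

  Dependent : Pred (Subset n) 0ℓ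
  Dependent D = ¬ Independent D

  IsCircuit : Pred (Subset n) 0ℓ
  IsCircuit C = Dependent C × (∀ {D} → D ⊂ C → Independent D)

  independent? : Decidable Independent
  independent? I = anySubset? λ B → isBasis? B ×-dec (I ⊆? B)

allSubsets : ∀ n → List (Subset n)
allSubsets zero    = Vec.[] ∷ []
allSubsets (suc n) = map (outside Vec.∷_) (allSubsets n)
                  ++ map (inside  Vec.∷_) (allSubsets n)

rank : Matroid n → Subset n → ℕ
rank {n} M S =
  max 0 (map ∣_∣ (filter (λ I → (I ⊆? S) ×-dec independent? I) (allSubsets n)))
  where open Matroid M

-- The value of the Tutte polynomial at an integer point.  Neither truncated
-- subtraction truncates, since r(S) ≤ r(E) and r(S) ≤ |S|; and i ^ 0 is 1ℤ
-- for every i, including 0ℤ.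
tutte : Matroid n → ℤ → ℤ → ℤ
tutte {n} M x y = foldr ℤ._+_ 0ℤ (map term (allSubsets n))
  where
  term : Subset n → ℤ
  term S = (x ℤ.- 1ℤ) ℤ.^ (rank M ⊤ ∸ rank M S)
     ℤ.* (y ℤ.- 1ℤ) ℤ.^ (∣ S ∣ ∸ rank M S)

private
  x∈p-y⁻ : ∀ {p : Subset n} {x y} → x ∈ p - y → x ∈ p × x ≢ y
  x∈p-y⁻ {p = p} {x} {y} x∈ = p─q⊆p p ⁅ y ⁆ x∈ , λ { refl → go p x x∈ }
    where
    go : ∀ {n} (p : Subset n) x → x ∉ p - x
    go (_ Vec.∷ p) Fin.zero    ()
    go (_ Vec.∷ p) (Fin.suc x) (Vec.there h) = go p x h

  swap⁻ : ∀ {p : Subset n} {x y z} → z ∈ (p - x) ∪ ⁅ y ⁆ → (z ∈ p × z ≢ x) ⊎ z ≡ y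
  swap⁻ {p = p} {x} {y} z∈ with x∈p∪q⁻ (p - x) ⁅ y ⁆ z∈
  ... | inj₁ h = inj₁ (x∈p-y⁻ h)
  ... | inj₂ h = inj₂ (x∈⁅y⁆⇒x≡y y h)

  swap⁺ˡ : ∀ {p : Subset n} {x y z} → z ∈ p → z ≢ x → z ∈ (p - x) ∪ ⁅ y ⁆
  swap⁺ˡ z∈p z≢x = x∈p∪q⁺ (inj₁ (x∈p∧x≢y⇒x∈p-y z∈p z≢x))

  swap⁺ʳ : ∀ {p : Subset n} {x y} → y ∈ (p - x) ∪ ⁅ y ⁆
  swap⁺ʳ {y = y} = x∈p∪q⁺ (inj₂ (x∈⁅x⁆ y))

  ∁-involutive : (p : Subset n) → ∁ (∁ p) ≡ p
  ∁-involutive p = ⊆-antisym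
    (λ h → x∉∁p⇒x∈p (x∈∁p⇒x∉p h))
    (λ h → x∉p⇒x∈∁p (x∈p⇒x∉∁p h))

  p─q⁻ : ∀ (p q : Subset n) {x} → x ∈ p ─ q → x ∉ q
  p─q⁻ (_ Vec.∷ p) (outside Vec.∷ q) Vec.here      ()
  p─q⁻ (_ Vec.∷ p) (_ Vec.∷ q) (Vec.there h) (Vec.there k) = p─q⁻ p q h k

module _ (M : Matroid n) where
  open Matroid M

  private
    antichain : ∀ {A B} → IsBasis A → IsBasis B → A ⊆ B → B ⊆ A
    antichain {A} a b A⊆B {x} x∈B with x ∈? A
    ... | yes x∈A = x∈A
    ... | no  x∉A with exchange b a x∈B x∉A
    ...   | y , y∈A , y∉B , _ = ⊥-elim (y∉B (A⊆B y∈A))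

    -- Exchange elements of C ─ A other than x out of C until C ⊆ A ∪ ⁅ x ⁆.
    shrink : ∀ {A B x} → IsBasis A → x ∈ B → x ∉ A →
             ∀ C → Acc ℕ._<_ ∣ C ─ A ∣ → IsBasis C → x ∈ C →
             (∀ {z} → z ∈ A → z ∈ B → z ∈ C) →
             ∃[ y ] y ∈ A × y ∉ B × IsBasis ((A - y) ∪ ⁅ x ⁆)
    shrink {A} {B} {x} a x∈B x∉A C (acc rs) c x∈C A∩B⊆C
      with any? (λ z → (z ∈? C) ×-dec (¬? (z ∈? A) ×-dec ¬? (z ≟ᶠ x)))
    ... | yes (z , z∈C , z∉A , z≢x) with exchange c a z∈C z∉A
    ...   | w , w∈A , w∉C , c′ =
      shrink a x∈B x∉A C′ (rs (p⊂q⇒∣p∣<∣q∣ smaller)) c′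
        (swap⁺ˡ x∈C (λ x≡z → z≢x (sym x≡z)))
        (λ v∈A v∈B → swap⁺ˡ (A∩B⊆C v∈A v∈B) (λ { refl → z∉A v∈A }))
      where
      C′ : Subset n
      C′ = (C - z) ∪ ⁅ w ⁆

      smaller : C′ ─ A ⊂ C ─ A
      smaller = sub , z , x∈p∧x∉q⇒x∈p─q z∈C z∉A , out
        where
        sub : C′ ─ A ⊆ C ─ A
        sub v∈ with swap⁻ (p─q⊆p C′ A v∈)
        ... | inj₁ (v∈C , _) = x∈p∧x∉q⇒x∈p─q v∈C (p─q⁻ C′ A v∈)
        ... | inj₂ refl      = ⊥-elim (p─q⁻ C′ A v∈ w∈A)

        out : z ∉ C′ ─ A
        out z∈ with swap⁻ (p─q⊆p C′ A z∈)
        ... | inj₁ (_ , z≢z) = z≢z refl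
        ... | inj₂ refl      = z∉A w∈A
    shrink {A} {B} {x} a x∈B x∉A C (acc rs) c x∈C A∩B⊆C | no none
      with exchange c a x∈C x∉A
    ...   | w , w∈A , w∉C , d =
      w , w∈A , (λ w∈B → w∉C (A∩B⊆C w∈A w∈B)) , subst IsBasis (⊆-antisym C⊆ ⊆C) c
      where
      C∖x⊆A : ∀ {v} → v ∈ C → v ≢ x → v ∈ A
      C∖x⊆A {v} v∈C v≢x =
        decidable-stable (v ∈? A) (λ v∉A → none (v , v∈C , v∉A , v≢x))

      D⊆A : (C - x) ∪ ⁅ w ⁆ ⊆ A
      D⊆A v∈ with swap⁻ v∈
      ... | inj₁ (v∈C , v≢x) = C∖x⊆A v∈C v≢x
      ... | inj₂ refl        = w∈A

      C⊆ : C ⊆ (A - w) ∪ ⁅ x ⁆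
      C⊆ {v} v∈C with v ≟ᶠ x
      ... | yes refl = swap⁺ʳ {p = A} {x = w}
      ... | no  v≢x  = swap⁺ˡ (C∖x⊆A v∈C v≢x) (λ { refl → w∉C v∈C })

      ⊆C : (A - w) ∪ ⁅ x ⁆ ⊆ C
      ⊆C v∈ with swap⁻ v∈
      ... | inj₂ refl = x∈C
      ... | inj₁ (v∈A , v≢w) with swap⁻ (antichain d a D⊆A v∈A)
      ...   | inj₁ (v∈C , _) = v∈C
      ...   | inj₂ v≡w       = ⊥-elim (v≢w v≡w)

  coexchange : ∀ {A B} → IsBasis A → IsBasis B →
               ∀ {x} → x ∈ B → x ∉ A →
               ∃[ y ] y ∈ A × y ∉ B × IsBasis ((A - y) ∪ ⁅ x ⁆)
  coexchange {A} {B} a b x∈B x∉A =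
    shrink a x∈B x∉A B (<-wellFounded _) b x∈B (λ _ z∈B → z∈B)

private
  ∁-swap : ∀ (A : Subset n) {x y} → x ∈ A → y ∉ A →
           (∁ A - y) ∪ ⁅ x ⁆ ≡ ∁ ((A - x) ∪ ⁅ y ⁆)
  ∁-swap A {x} {y} x∈A y∉A = ⊆-antisym to from
    where
    to : (∁ A - y) ∪ ⁅ x ⁆ ⊆ ∁ ((A - x) ∪ ⁅ y ⁆)
    to v∈ = x∉p⇒x∈∁p (λ v∈′ → clash (swap⁻ v∈) (swap⁻ v∈′))
      where
      clash : ∀ {v} → (v ∈ ∁ A × v ≢ y) ⊎ v ≡ x → ¬ ((v ∈ A × v ≢ x) ⊎ v ≡ y)
      clash (inj₁ (v∈∁A , _)) (inj₁ (v∈A , _)) = x∈∁p⇒x∉p v∈∁A v∈A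
      clash (inj₁ (_ , v≢y))  (inj₂ v≡y)       = v≢y v≡y
      clash (inj₂ v≡x)        (inj₁ (_ , v≢x)) = v≢x v≡x
      clash (inj₂ refl)       (inj₂ refl)      = y∉A x∈A

    from : ∁ ((A - x) ∪ ⁅ y ⁆) ⊆ (∁ A - y) ∪ ⁅ x ⁆
    from {v} v∈ with v ≟ᶠ x
    ... | yes refl = swap⁺ʳ {p = ∁ A} {x = y}
    ... | no  v≢x  = swap⁺ˡ
      (x∉p⇒x∈∁p (λ v∈A → x∈∁p⇒x∉p v∈ (swap⁺ˡ v∈A v≢x)))
      (λ { refl → x∈∁p⇒x∉p v∈ (swap⁺ʳ {p = A} {x = x}) })

dual : Matroid n → Matroid n
dual M = record
  { IsBasis  = λ B → IsBasis (∁ B)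
  ; isBasis? = λ B → isBasis? (∁ B)
  ; nonempty = let B , b = nonempty in ∁ B , subst IsBasis (sym (∁-involutive B)) b
  ; exchange = λ {A} {B} a b x∈A x∉B →
      let y , y∈∁A , y∉∁B , c = coexchange M a b (x∉p⇒x∈∁p x∉B) (x∈p⇒x∉∁p x∈A)
          y∉A = x∈∁p⇒x∉p y∈∁A
      in y , x∉∁p⇒x∈p y∉∁B , y∉A , subst IsBasis (∁-swap A x∈A y∉A) c
  }
  where open Matroid M

{-# OPTIONS --safe #-}

-- For x ∈ {0,…,L-1}ⁿ, order the ground set by x.  Expanding the Tutte polynomial
-- by activities, Lⁿ T(2,0) is the sum over the bases B of X_B = Σₓ 2^ia 0^ea, and
-- Lⁿ T(0,2) the sum of the analogous Y_B, so by Cauchy–Schwarz it suffices that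
-- X_B Y_B ≥ L²ⁿ for each basis B.  Join v ∈ B and u ∉ B when B - v + u is a basis:
-- the degrees in this bipartite exchange graph are one less than the lengths of
-- the fundamental circuits and cocircuits, and an element is active if its
-- coordinate exceeds those of its neighbours.  For fixed coordinates outside B,
-- Harris' inequality bounds the sum over the coordinates in B by a product, in
-- which u ∉ B of degree d contributes 1 - (x_u/L)^d; that factor, cut off near
-- x_u = L, is used as a density for a second application of Harris' inequality.
-- As L → ∞, X_B Y_B / L²ⁿ is at least a product over the elements; with the cut-off
-- at a proportion 1/(ℓ-2)² from the top and a = d + 1 the factor of an element is at
-- least (1 + ε + (1-ε)/a)(1 - ε - (1-ε)^a/a) with ε = 1/(ℓ-2)², which exceeds 1 for
-- ℓ ≤ a ≤ (ℓ-2)²((ℓ-2)²-2) if ℓ ≥ 5.  For ℓ = 4 the degrees are 3,…,7, and explicit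
-- cut-offs depending on the degree, with L = 100, are checked by computation.

module Submission where

-- With uniform coordinates in both applications of Harris' inequality, an element with a = d + 1
-- would receive (1 + 1/a)(1 - 1/a), just short of 1. The density 1 - (x_u/L)^d repairs this: it
-- favours small coordinates outside B, so that elements of B exceed their neighbours more often.
-- The gain must not depend on the degrees of those neighbours, which are unrelated to d, and the
-- cut-off provides this: any decreasing density on [0, 1-ε] has a distribution function at least
-- that of the uniform one. It costs little, because 1 - t^d is small near t = 1.
--
-- Apart from the term (1-ε)^a/a, the factor of an element is 1 - ε² + (1-ε)²/a, which exceeds 1
-- exactly when a < (1/ε - 1)². For ε = 1/(ℓ-2)² the upper bound on the circuit lengths is (1/ε -
-- 1)² - 1, so it is the last integer value of a allowed by this main part; the lower bound ℓ makes
-- the neglected term harmless. For ℓ = a = 4 and ε = 1/4 that term brings the factor below 1,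
-- whence the separate treatment of ℓ = 4.

open import Defs

-- Exchanging elements of finite subsets

module Subsets where
  open import Data.Fin.Base using (Fin; zero; suc)
  open import Data.Fin.Properties using (_≟_)
  open import Data.Fin.Subset
  open import Data.Fin.Subset.Properties
  open import Data.Nat.Base using (ℕ; suc; _+_; _≤_)
  open import Data.Nat.Properties hiding (_≟_)
  open import Data.Product.Base using (_×_; _,_; proj₁; proj₂)
  open import Data.Sum.Base using (_⊎_; inj₁; inj₂; [_,_]′)
  open import Data.Vec.Base using ([]; _∷_; here; there)
  open import Function.Base using (_∘_)
  open import Relation.Binary.PropositionalEquality
  open import Relation.Nullary using (contradiction; yes; no)

  private
    variable
      n : ℕ
      x y z : Fin n
      p q : Subset n

  x∈p─q⇒x∉q : ∀ (p q : Subset n) → x ∈ p ─ q → x ∉ q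
  x∈p─q⇒x∉q (_ ∷ p) (outside ∷ q) here      ()
  x∈p─q⇒x∉q (_ ∷ p) (_ ∷ q)       (there h) (there k) = x∈p─q⇒x∉q p q h k

  x∈p-y⁻ : ∀ (p : Subset n) → x ∈ p - y → x ∈ p × x ≢ y
  x∈p-y⁻ {y = y} p h =
    p─q⊆p p ⁅ y ⁆ h , λ { refl → x∈p─q⇒x∉q p ⁅ y ⁆ h (x∈⁅x⁆ y) }

  insert⁻ : z ∈ p ∪ ⁅ y ⁆ → z ∈ p ⊎ z ≡ y
  insert⁻ {p = p} {y} h with x∈p∪q⁻ p ⁅ y ⁆ h
  ... | inj₁ k = inj₁ k
  ... | inj₂ k = inj₂ (x∈⁅y⁆⇒x≡y y k)

  insert⁺ˡ : z ∈ p → z ∈ p ∪ ⁅ y ⁆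
  insert⁺ˡ = x∈p∪q⁺ ∘ inj₁

  insert⁺ʳ : ∀ (p : Subset n) y → y ∈ p ∪ ⁅ y ⁆
  insert⁺ʳ p y = x∈p∪q⁺ (inj₂ (x∈⁅x⁆ y))

  swap : Subset n → Fin n → Fin n → Subset n
  swap p x y = (p - x) ∪ ⁅ y ⁆

  swap⁻ : z ∈ swap p x y → (z ∈ p × z ≢ x) ⊎ z ≡ y
  swap⁻ {p = p} h with insert⁻ h
  ... | inj₁ k = inj₁ (x∈p-y⁻ p k)
  ... | inj₂ k = inj₂ k

  swap⁺ˡ : z ∈ p → z ≢ x → z ∈ swap p x y
  swap⁺ˡ z∈p z≢x = insert⁺ˡ (x∈p∧x≢y⇒x∈p-y z∈p z≢x)

  swap⁺ʳ : ∀ (p : Subset n) x y → y ∈ swap p x y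
  swap⁺ʳ p x y = insert⁺ʳ (p - x) y

  ∣insert∣ : ∀ (p : Subset n) y → y ∉ p → ∣ p ∪ ⁅ y ⁆ ∣ ≡ suc ∣ p ∣
  ∣insert∣ (outside ∷ p) zero    y∉p = cong (suc ∘ ∣_∣) (∪-identityʳ p)
  ∣insert∣ (inside  ∷ p) zero    y∉p = contradiction here y∉p
  ∣insert∣ (outside ∷ p) (suc y) y∉p = ∣insert∣ p y (y∉p ∘ there)
  ∣insert∣ (inside  ∷ p) (suc y) y∉p = cong suc (∣insert∣ p y (y∉p ∘ there))

  ∣swap∣ : x ∈ p → y ∉ p → ∣ swap p x y ∣ ≡ ∣ p ∣
  ∣swap∣ {x = x} {p} {y} x∈p y∉p = begin
    ∣ swap p x y ∣      ≡⟨ ∣insert∣ (p - x) y (y∉p ∘ proj₁ ∘ x∈p-y⁻ p) ⟩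
    -- `swap p x x` removes `x` and puts it back, so the size of `p - x` also follows from
    -- `∣insert∣`.
    suc ∣ p - x ∣       ≡⟨ ∣insert∣ (p - x) x (λ h → proj₂ (x∈p-y⁻ p h) refl) ⟨
    ∣ swap p x x ∣      ≡⟨ cong ∣_∣ (⊆-antisym
                             (λ h → [ proj₁ , (λ { refl → x∈p }) ]′ (swap⁻ h)) back) ⟩
    ∣ p ∣               ∎
    where
    open ≡-Reasoning
    back : p ⊆ swap p x x
    back {z} z∈p with z ≟ x
    ... | yes refl = swap⁺ʳ p x x
    ... | no z≢x   = swap⁺ˡ z∈p z≢x

  ∣∩∣+∣─∣ : ∀ (p q : Subset n) → ∣ p ∩ q ∣ + ∣ p ─ q ∣ ≡ ∣ p ∣
  ∣∩∣+∣─∣ []            []            = refl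
  ∣∩∣+∣─∣ (outside ∷ p) (outside ∷ q) = ∣∩∣+∣─∣ p q
  ∣∩∣+∣─∣ (outside ∷ p) (inside  ∷ q) = ∣∩∣+∣─∣ p q
  ∣∩∣+∣─∣ (inside  ∷ p) (outside ∷ q) =
    trans (+-suc ∣ p ∩ q ∣ ∣ p ─ q ∣) (cong suc (∣∩∣+∣─∣ p q))
  ∣∩∣+∣─∣ (inside  ∷ p) (inside  ∷ q) = cong suc (∣∩∣+∣─∣ p q)

  ⊆∧∣≤∣⇒⊇ : p ⊆ q → ∣ q ∣ ≤ ∣ p ∣ → q ⊆ p
  ⊆∧∣≤∣⇒⊇ {p = p} p⊆q ∣q∣≤∣p∣ {x} x∈q with x ∈? p
  ... | yes x∈p = x∈p
  ... | no  x∉p = contradiction (p⊂q⇒∣p∣<∣q∣ (p⊆q , x , x∈q , x∉p)) (≤⇒≯ ∣q∣≤∣p∣)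

-- Bases, augmentation and rank

module Bases where
  open import Data.Fin.Properties using (any?)
  open import Data.Fin.Subset
  open import Data.Fin.Subset.Properties
  open import Data.List.Base using (filter)
  open import Data.List.Extrema.Nat using (max≤v⁺; xs≤max)
  open import Data.List.Membership.Propositional as List using ()
  open import Data.List.Membership.Propositional.Properties
    using (∈-map⁺; ∈-++⁺ˡ; ∈-++⁺ʳ; ∈-filter⁺; ∈-filter⁻)
  open import Data.List.Relation.Unary.Any using (here)
  import Data.List.Relation.Unary.All as All
  import Data.List.Relation.Unary.All.Properties as All
  open import Data.Nat.Base using (ℕ; suc; _+_; _∸_; _≤_; _<_; z≤n; s≤s)
  open import Data.Nat.Induction using (Acc; acc; <-wellFounded)
  open import Data.Nat.Properties hiding (_≟_)
  open import Data.Product.Base using (∃-syntax; _×_; _,_; proj₂)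
  open import Data.Sum.Base using (_⊎_; inj₁; inj₂)
  open import Data.Vec.Base using ([]; _∷_)
  open import Function.Base using (_∘_)
  open import Relation.Binary.PropositionalEquality
  open import Relation.Nullary using (¬_; contradiction; yes; no)
  open import Relation.Nullary.Decidable using (_×-dec_; ¬?; decidable-stable)
  open Subsets

  private
    variable
      n : ℕ

  ∈-allSubsets : ∀ (S : Subset n) → S List.∈ allSubsets n
  ∈-allSubsets []            = here refl
  ∈-allSubsets (outside ∷ S) = ∈-++⁺ˡ (∈-map⁺ (outside ∷_) (∈-allSubsets S))
  ∈-allSubsets (inside  ∷ S) = ∈-++⁺ʳ _ (∈-map⁺ (inside ∷_) (∈-allSubsets S))

  module _ (M : Matroid n) where
    open Matroid M

    -- Elements of `A` outside `S` are exchanged one at a time for elements of `B`, which lie in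
    -- `S`; so `∣ A ─ S ∣` falls and nothing of `A ∩ S` is ever removed. The choice `S = B` gives
    -- the equal size of bases, and `S = I ∪ B` gives `augment`.
    extendWithin : ∀ {A B S} → IsBasis A → IsBasis B → B ⊆ S →
                   ∃[ D ] IsBasis D × ∣ D ∣ ≡ ∣ A ∣ × A ∩ S ⊆ D × D ⊆ S
    extendWithin {A} {B} {S} a b B⊆S = go A (<-wellFounded _) a
      where
      go : ∀ A → Acc _<_ ∣ A ─ S ∣ → IsBasis A →
           ∃[ D ] IsBasis D × ∣ D ∣ ≡ ∣ A ∣ × A ∩ S ⊆ D × D ⊆ S
      go A (acc rs) a with any? (λ z → (z ∈? A) ×-dec ¬? (z ∈? S))
      ... | no none = A , a , refl , p∩q⊆p A S ,
            λ {z} z∈A → decidable-stable (z ∈? S) (λ z∉S → none (z , z∈A , z∉S))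
      ... | yes (z , z∈A , z∉S) with exchange a b z∈A (z∉S ∘ B⊆S)
      ...   | w , w∈B , w∉A , a′ with go (swap A z w) (rs smaller) a′
        where
        smaller : ∣ swap A z w ─ S ∣ < ∣ A ─ S ∣
        smaller = p⊂q⇒∣p∣<∣q∣ (sub , z , x∈p∧x∉q⇒x∈p─q z∈A z∉S , out)
          where
          sub : swap A z w ─ S ⊆ A ─ S
          sub v∈ with swap⁻ (p─q⊆p (swap A z w) S v∈)
          ... | inj₁ (v∈A , _) =
                x∈p∧x∉q⇒x∈p─q v∈A (x∈p─q⇒x∉q (swap A z w) S v∈)
          ... | inj₂ refl =
                contradiction (B⊆S w∈B) (x∈p─q⇒x∉q (swap A z w) S v∈)
          out : z ∉ swap A z w ─ S
          out z∈ with swap⁻ (p─q⊆p (swap A z w) S z∈)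
          ... | inj₁ (_ , z≢z) = z≢z refl
          ... | inj₂ refl      = w∉A z∈A
      ...     | D , d , ∣D∣ , sub , D⊆S =
            D , d , trans ∣D∣ (∣swap∣ z∈A w∉A) , A∩S⊆D , D⊆S
        where
        A∩S⊆D : A ∩ S ⊆ D
        A∩S⊆D v∈ = let v∈A , v∈S = x∈p∩q⁻ A S v∈ in
          sub (x∈p∩q⁺ (swap⁺ˡ v∈A (λ { refl → z∉S v∈S }) , v∈S))

    basis-⊆⇒⊇ : ∀ {A B} → IsBasis A → IsBasis B → A ⊆ B → B ⊆ A
    basis-⊆⇒⊇ {A} a b A⊆B {x} x∈B with x ∈? A
    ... | yes x∈A = x∈A
    ... | no  x∉A with exchange b a x∈B x∉A
    ...   | _ , y∈A , y∉B , _ = contradiction (A⊆B y∈A) y∉B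

    ∣basis∣ : ∀ {A B} → IsBasis A → IsBasis B → ∣ A ∣ ≡ ∣ B ∣
    ∣basis∣ a b with extendWithin a b ⊆-refl
    ... | D , d , ∣D∣ , _ , D⊆B =
      trans (sym ∣D∣) (cong ∣_∣ (⊆-antisym D⊆B (basis-⊆⇒⊇ d b D⊆B)))

    augment : ∀ {I B} → Independent I → IsBasis B →
              ∃[ D ] IsBasis D × I ⊆ D × D ⊆ I ∪ B
    augment {I} {B} (A , a , I⊆A) b with extendWithin a b (q⊆p∪q I B)
    ... | D , d , _ , sub , D⊆ =
      D , d , (λ z∈I → sub (x∈p∩q⁺ (I⊆A z∈I , p⊆p∪q B z∈I))) , D⊆

    -- With `∣∩∣≤rank` and `rank-attained` this characterises the rank as the maximum of `∣ B ∩ S ∣`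
    -- over the bases `B`, in which form it is used from here on.
    rank-≤ : ∀ {S k} → (∀ {B} → IsBasis B → ∣ B ∩ S ∣ ≤ k) → rank M S ≤ k
    rank-≤ {S} bound = max≤v⁺ z≤n (All.map⁺ (All.tabulate small))
      where
      small : ∀ {I} → I List.∈ filter (λ I → (I ⊆? S) ×-dec independent? I) (allSubsets n) →
              ∣ I ∣ ≤ _
      small I∈ with ∈-filter⁻ (λ I → (I ⊆? S) ×-dec independent? I) {xs = allSubsets n} I∈
      ... | _ , I⊆S , B , b , I⊆B =
        ≤-trans (p⊆q⇒∣p∣≤∣q∣ (λ h → x∈p∩q⁺ (I⊆B h , I⊆S h))) (bound b)

    ∣∩∣≤rank : ∀ {B} S → IsBasis B → ∣ B ∩ S ∣ ≤ rank M S
    ∣∩∣≤rank {B} S b = All.lookup (xs≤max 0 _)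
      (∈-map⁺ ∣_∣ (∈-filter⁺ (λ I → (I ⊆? S) ×-dec independent? I) (∈-allSubsets (B ∩ S))
        (p∩q⊆q B S , B , b , p∩q⊆p B S)))

    rank-attained : ∀ S → ∃[ B ] IsBasis B × rank M S ≤ ∣ B ∩ S ∣
    rank-attained S
      with anySubset? (λ B → isBasis? B ×-dec (rank M S ≤? ∣ B ∩ S ∣))
    ... | yes found = found
    -- If every basis stayed below the rank, the rank would be at most its own predecessor. That
    -- `below` holds for some basis shows the rank to be positive, so that the truncated predecessor
    -- is really smaller.
    ... | no  none  = contradiction (rank-≤ (λ b → <⇒≤pred (below b)))
                        (<⇒≱ (pred-< (below (proj₂ nonempty))))
      where
      below : ∀ {B} → IsBasis B → ∣ B ∩ S ∣ < rank M S
      below b = ≰⇒> (λ h → none (_ , b , h))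
      pred-< : ∀ {k r} → k < r → r ∸ 1 < r
      pred-< {r = suc r} _ = ≤-refl

    rank-mono : ∀ {S S′} → S ⊆ S′ → rank M S ≤ rank M S′
    rank-mono {S} {S′} S⊆S′ = rank-≤ λ {B} b → ≤-trans
      (p⊆q⇒∣p∣≤∣q∣ (λ h → let z∈B , z∈S = x∈p∩q⁻ B S h in x∈p∩q⁺ (z∈B , S⊆S′ z∈S)))
      (∣∩∣≤rank S′ b)

    rank≤∣∣ : ∀ S → rank M S ≤ ∣ S ∣
    rank≤∣∣ S = rank-≤ (λ {B} _ → ∣p∩q∣≤∣q∣ B S)

    rank-insert≤ : ∀ S e → rank M (S ∪ ⁅ e ⁆) ≤ suc (rank M S)
    rank-insert≤ S e = rank-≤ λ {B} b → bound b
      where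
      bound : ∀ {B} → IsBasis B → ∣ B ∩ (S ∪ ⁅ e ⁆) ∣ ≤ suc (rank M S)
      bound {B} b with e ∈? B ∩ S
      ... | yes e∈ = m≤n⇒m≤1+n (≤-trans (p⊆q⇒∣p∣≤∣q∣ sub) (∣∩∣≤rank S b))
        where
        sub : B ∩ (S ∪ ⁅ e ⁆) ⊆ B ∩ S
        sub z∈ with x∈p∩q⁻ B (S ∪ ⁅ e ⁆) z∈
        ... | z∈B , z∈S+ with insert⁻ z∈S+
        ...   | inj₁ z∈S = x∈p∩q⁺ (z∈B , z∈S)
        ...   | inj₂ refl = e∈
      ... | no e∉ = ≤-trans (p⊆q⇒∣p∣≤∣q∣ sub)
                      (≤-trans (≤-reflexive (∣insert∣ (B ∩ S) e e∉)) (s≤s (∣∩∣≤rank S b)))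
        where
        sub : B ∩ (S ∪ ⁅ e ⁆) ⊆ (B ∩ S) ∪ ⁅ e ⁆
        sub z∈ with x∈p∩q⁻ B (S ∪ ⁅ e ⁆) z∈
        ... | z∈B , z∈S+ with insert⁻ z∈S+
        ...   | inj₁ z∈S = insert⁺ˡ (x∈p∩q⁺ (z∈B , z∈S))
        ...   | inj₂ refl = insert⁺ʳ (B ∩ S) e

    rank-basis : ∀ {B} → IsBasis B → rank M B ≡ ∣ B ∣
    rank-basis {B} b = ≤-antisym (rank≤∣∣ B)
      (≤-trans (p⊆q⇒∣p∣≤∣q∣ {p = B} (λ h → x∈p∩q⁺ (h , h))) (∣∩∣≤rank B b))

    rank-⊤ : ∀ {B} → IsBasis B → rank M ⊤ ≡ ∣ B ∣
    rank-⊤ {B} b = ≤-antisym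
      (rank-≤ (λ {A} a → ≤-trans (∣p∩q∣≤∣p∣ A ⊤) (≤-reflexive (∣basis∣ a b))))
      (≤-trans (≤-reflexive (sym (rank-basis b))) (rank-mono {B} (⊆-max B)))

    -- e is a loop of the contraction of the independent set C.
    rank-insert-loop : ∀ {C S e} → Independent C → Dependent (C ∪ ⁅ e ⁆) →
                       C ⊆ S → rank M (S ∪ ⁅ e ⁆) ≡ rank M S
    rank-insert-loop {C} {S} {e} C-ind Ce-dep C⊆S = ≤-antisym ≤-dir
      (rank-mono {S} {S ∪ ⁅ e ⁆} (p⊆p∪q _))
      where
      ≤-dir : rank M (S ∪ ⁅ e ⁆) ≤ rank M S
      ≤-dir with rank-attained (S ∪ ⁅ e ⁆)
      ... | B , b , r≤ with augment C-ind b
      ...   | D , d , C⊆D , D⊆C∪B = ≤-trans r≤ (≤-trans count (∣∩∣≤rank S d))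
        where
        e∉D : e ∉ D
        e∉D e∈D = Ce-dep (D , d , λ h → from (insert⁻ h))
          where
          from : ∀ {z} → z ∈ C ⊎ z ≡ e → z ∈ D
          from (inj₁ z∈C)  = C⊆D z∈C
          from (inj₂ refl) = e∈D
        outer : D ─ S ⊆ B ─ (S ∪ ⁅ e ⁆)
        outer {z} h with x∈p∪q⁻ C B (D⊆C∪B (p─q⊆p D S h))
        ... | inj₁ z∈C = contradiction (C⊆S z∈C) (x∈p─q⇒x∉q D S h)
        ... | inj₂ z∈B = x∈p∧x∉q⇒x∈p─q z∈B λ k → notIn (insert⁻ k)
          where
          notIn : ¬ (z ∈ S ⊎ z ≡ e)
          notIn (inj₁ z∈S)  = x∈p─q⇒x∉q D S h z∈S
          notIn (inj₂ refl) = e∉D (p─q⊆p D S h)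
        -- `D` and `B` have the same size, and by `outer` there are no more elements of `D` outside
        -- `S` than of `B` outside `S ∪ ⁅ e ⁆`.
        count : ∣ B ∩ (S ∪ ⁅ e ⁆) ∣ ≤ ∣ D ∩ S ∣
        count = +-cancelʳ-≤ ∣ B ─ (S ∪ ⁅ e ⁆) ∣ _ _ (begin
          ∣ B ∩ (S ∪ ⁅ e ⁆) ∣ + ∣ B ─ (S ∪ ⁅ e ⁆) ∣  ≡⟨ ∣∩∣+∣─∣ B (S ∪ ⁅ e ⁆) ⟩
          ∣ B ∣                                      ≡⟨ ∣basis∣ b d ⟩
          ∣ D ∣                                      ≡⟨ ∣∩∣+∣─∣ D S ⟨
          ∣ D ∩ S ∣ + ∣ D ─ S ∣                      ≤⟨ +-monoʳ-≤ ∣ D ∩ S ∣ (p⊆q⇒∣p∣≤∣q∣ outer) ⟩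
          ∣ D ∩ S ∣ + ∣ B ─ (S ∪ ⁅ e ⁆) ∣            ∎)
          where open ≤-Reasoning

    -- e is a coloop of the restriction to F ∪ ⁅ e ⁆.
    rank-insert-coloop : ∀ {A F S e} → IsBasis A → A ⊆ F ∪ ⁅ e ⁆ →
                         (∀ {D} → IsBasis D → D ⊆ F ∪ ⁅ e ⁆ → e ∈ D) →
                         S ⊆ F → e ∉ S → rank M (S ∪ ⁅ e ⁆) ≡ suc (rank M S)
    rank-insert-coloop {A} {F} {S} {e} a A⊆ e∈bases S⊆F e∉S =
      ≤-antisym (rank-insert≤ S e) ≥-dir
      where
      ≥-dir : suc (rank M S) ≤ rank M (S ∪ ⁅ e ⁆)
      ≥-dir with rank-attained S
      ... | B , b , r≤ with augment (B , b , p∩q⊆p B S) a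
      -- Completing `B ∩ S` from `A` does not leave `F ∪ ⁅ e ⁆`, so the resulting basis contains `e`
      -- in addition to `B ∩ S`.
      ...   | D , d , B∩S⊆D , D⊆ = begin
        suc (rank M S)               ≤⟨ s≤s r≤ ⟩
        suc ∣ B ∩ S ∣                ≡⟨ ∣insert∣ (B ∩ S) e (e∉S ∘ p∩q⊆q B S) ⟨
        ∣ (B ∩ S) ∪ ⁅ e ⁆ ∣          ≤⟨ p⊆q⇒∣p∣≤∣q∣ sub ⟩
        ∣ D ∩ (S ∪ ⁅ e ⁆) ∣          ≤⟨ ∣∩∣≤rank (S ∪ ⁅ e ⁆) d ⟩
        rank M (S ∪ ⁅ e ⁆)           ∎
        where
        open ≤-Reasoning
        D⊆F+e : D ⊆ F ∪ ⁅ e ⁆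
        D⊆F+e h with x∈p∪q⁻ (B ∩ S) A (D⊆ h)
        ... | inj₁ k = insert⁺ˡ (S⊆F (p∩q⊆q B S k))
        ... | inj₂ k = A⊆ k
        sub : (B ∩ S) ∪ ⁅ e ⁆ ⊆ D ∩ (S ∪ ⁅ e ⁆)
        sub h with insert⁻ h
        ... | inj₁ k    = x∈p∩q⁺ (B∩S⊆D k , insert⁺ˡ (p∩q⊆q B S k))
        ... | inj₂ refl = x∈p∩q⁺ (e∈bases d D⊆F+e , insert⁺ʳ S e)

-- The exchange graph of a basis and its fundamental circuits and cocircuits

module ExchangeGraph where
  open import Data.Bool.Base using (true)
  open import Data.Fin.Base using (Fin)
  open import Data.Fin.Properties using (_≟_)
  open import Data.Fin.Subset
  open import Data.Fin.Subset.Properties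
  open import Data.Nat.Base using (ℕ; suc)
  open import Data.Nat.Properties using (≤-reflexive)
  open import Data.Product.Base using (_×_; _,_)
  open import Data.Sum.Base using (_⊎_; inj₁; inj₂)
  open import Data.Vec.Base using (tabulate)
  open import Data.Vec.Properties using (lookup∘tabulate; lookup⇒[]=; []=⇒lookup)
  open import Function.Base using (_∘_)
  open import Relation.Binary.PropositionalEquality
  open import Relation.Nullary using (¬_; Dec; does; contradiction; yes; no)
  open import Relation.Nullary.Decidable
    using (_×-dec_; _⊎-dec_; ¬?; decidable-stable; dec-true)
  open Subsets
  open Bases

  private
    variable
      n : ℕ

  module _ (M : Matroid n) where
    open Matroid M

    Adj : Subset n → Fin n → Fin n → Set
    Adj B i j = (i ∈ B × j ∉ B × IsBasis (swap B i j))
              ⊎ (i ∉ B × j ∈ B × IsBasis (swap B j i))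

    adj? : ∀ B i j → Dec (Adj B i j)
    adj? B i j = ((i ∈? B) ×-dec ¬? (j ∈? B) ×-dec isBasis? (swap B i j))
           ⊎-dec (¬? (i ∈? B) ×-dec (j ∈? B) ×-dec isBasis? (swap B j i))

    -- When `B` is a basis: the fundamental circuit of `i` without `i` if `i ∉ B`, and the
    -- fundamental cocircuit of `i` without `i` if `i ∈ B`.
    nbr : Subset n → Fin n → Subset n
    nbr B i = tabulate (does ∘ adj? B i)

    ∈-nbr⁺ : ∀ {B i j} → Adj B i j → j ∈ nbr B i
    ∈-nbr⁺ {B} {i} {j} h = lookup⇒[]= j (nbr B i)
      (trans (lookup∘tabulate (does ∘ adj? B i) j) (dec-true (adj? B i j) h))

    ∈-nbr⁻ : ∀ {B i j} → j ∈ nbr B i → Adj B i j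
    ∈-nbr⁻ {B} {i} {j} h = fromDoes (adj? B i j)
      (trans (sym (lookup∘tabulate (does ∘ adj? B i) j)) ([]=⇒lookup h))
      where
      fromDoes : ∀ {P : Set} (P? : Dec P) → does P? ≡ true → P
      fromDoes (yes p) _ = p

    -- A basis through this set, completed from `B`, would contain `B` as well as `u`, against the
    -- incomparability of bases. A proper subset that misses `u` lies in `B`, and one that misses a
    -- neighbour `w` lies in the basis `swap B w u`.
    fundamentalCircuit : ∀ {B u} → IsBasis B → u ∉ B → IsCircuit (nbr B u ∪ ⁅ u ⁆)
    fundamentalCircuit {B} {u} b u∉B = dependent , minimal
      where
      C : Subset n
      C = nbr B u ∪ ⁅ u ⁆

      dependent : Dependent C
      dependent C-ind with augment M C-ind b
      ... | D , d , C⊆D , D⊆ = u∉B (basis-⊆⇒⊇ M b d B⊆D (C⊆D (insert⁺ʳ (nbr B u) u)))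
        where
        D⊆B+u : ∀ {z} → z ∈ D → z ≢ u → z ∈ B
        D⊆B+u z∈D z≢u with x∈p∪q⁻ C B (D⊆ z∈D)
        ... | inj₂ z∈B = z∈B
        ... | inj₁ z∈C with insert⁻ z∈C
        ...   | inj₂ z≡u = contradiction z≡u z≢u
        ...   | inj₁ z∈N with ∈-nbr⁻ z∈N
        ...     | inj₁ (u∈B , _)     = contradiction u∈B u∉B
        ...     | inj₂ (_ , z∈B , _) = z∈B

        -- Any z ∈ B ∖ D would force D = B - z + u, making z a neighbour of u.
        B⊆D : B ⊆ D
        B⊆D {z} z∈B = decidable-stable (z ∈? D) absurd
          where
          absurd : ¬ (z ∉ D)
          absurd z∉D = z∉D (C⊆D (insert⁺ˡ (∈-nbr⁺ (inj₂ (u∉B , z∈B ,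
              subst IsBasis (⊆-antisym D⊆swap swap⊆D) d)))))
            where
            D⊆swap : D ⊆ swap B z u
            D⊆swap {w} w∈D with w ≟ u
            ... | yes refl = swap⁺ʳ B z u
            ... | no w≢u   = swap⁺ˡ (D⊆B+u w∈D w≢u) (λ { refl → z∉D w∈D })
            swap⊆D : swap B z u ⊆ D
            swap⊆D = ⊆∧∣≤∣⇒⊇ D⊆swap
              (≤-reflexive (trans (∣swap∣ z∈B u∉B) (∣basis∣ M b d)))

      minimal : ∀ {D} → D ⊂ C → Independent D
      minimal {D} (D⊆C , w , w∈C , w∉D) with insert⁻ w∈C
      ... | inj₂ refl = B , b , λ {z} z∈D → inB z∈D (insert⁻ (D⊆C z∈D))
        where
        inB : ∀ {z} → z ∈ D → z ∈ nbr B u ⊎ z ≡ u → z ∈ B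
        inB z∈D (inj₂ refl) = contradiction z∈D w∉D
        inB z∈D (inj₁ z∈N) with ∈-nbr⁻ z∈N
        ... | inj₁ (u∈B , _)     = contradiction u∈B u∉B
        ... | inj₂ (_ , z∈B , _) = z∈B
      ... | inj₁ w∈N with ∈-nbr⁻ w∈N
      ...   | inj₁ (u∈B , _)     = contradiction u∈B u∉B
      ...   | inj₂ (_ , w∈B , b′) = swap B w u , b′ , λ {z} z∈D → inSwap z∈D (insert⁻ (D⊆C z∈D))
        where
        inSwap : ∀ {z} → z ∈ D → z ∈ nbr B u ⊎ z ≡ u → z ∈ swap B w u
        inSwap z∈D (inj₂ refl) = swap⁺ʳ B w u
        inSwap z∈D (inj₁ z∈N) with ∈-nbr⁻ z∈N
        ... | inj₁ (u∈B , _)     = contradiction u∈B u∉B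
        ... | inj₂ (_ , z∈B , _) = swap⁺ˡ z∈B (λ { refl → w∉D z∈D })

    ∣nbr+self∣ : ∀ B u → ∣ nbr B u ∪ ⁅ u ⁆ ∣ ≡ suc ∣ nbr B u ∣
    ∣nbr+self∣ B u = ∣insert∣ (nbr B u) u (irrefl ∘ ∈-nbr⁻)
      where
      irrefl : ¬ Adj B u u
      irrefl (inj₁ (u∈B , u∉B , _)) = u∉B u∈B
      irrefl (inj₂ (u∉B , u∈B , _)) = u∉B u∈B

  ∁-involutive : ∀ (p : Subset n) → ∁ (∁ p) ≡ p
  ∁-involutive p = ⊆-antisym (x∉∁p⇒x∈p ∘ x∈∁p⇒x∉p) (x∉p⇒x∈∁p ∘ x∈p⇒x∉∁p)

  ∁-swap-∁ : ∀ {B : Subset n} {v j} → v ∈ B → j ∉ B → ∁ (swap (∁ B) j v) ≡ swap B v j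
  ∁-swap-∁ {B = B} {v} {j} v∈B j∉B = ⊆-antisym to from
    where
    to : ∁ (swap (∁ B) j v) ⊆ swap B v j
    to {z} h with z ≟ j
    ... | yes refl = swap⁺ʳ B v j
    ... | no z≢j   = swap⁺ˡ
      (x∉∁p⇒x∈p (λ z∈∁B → x∈∁p⇒x∉p h (swap⁺ˡ z∈∁B z≢j)))
      (λ { refl → x∈∁p⇒x∉p h (swap⁺ʳ (∁ B) j v) })
    from : swap B v j ⊆ ∁ (swap (∁ B) j v)
    from h = x∉p⇒x∈∁p (λ k → clash (swap⁻ h) (swap⁻ k))
      where
      clash : ∀ {z} → (z ∈ B × z ≢ v) ⊎ z ≡ j → ¬ ((z ∈ ∁ B × z ≢ j) ⊎ z ≡ v)
      clash (inj₁ (z∈B , _)) (inj₁ (z∈∁B , _)) = x∈∁p⇒x∉p z∈∁B z∈B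
      clash (inj₁ (_ , z≢v)) (inj₂ z≡v)        = z≢v z≡v
      clash (inj₂ z≡j)       (inj₁ (_ , z≢j))  = z≢j z≡j
      clash (inj₂ refl)      (inj₂ refl)       = j∉B v∈B

  -- Complementation interchanges the two elements of an exchange. One graph thus serves both
  -- matroids, and what is known about circuits carries over to cocircuits.
  nbr-dual : ∀ (M : Matroid n) {B v} → v ∈ B → nbr (dual M) (∁ B) v ≡ nbr M B v
  nbr-dual M {B} {v} v∈B = ⊆-antisym
    (λ h → ∈-nbr⁺ M (to (∈-nbr⁻ (dual M) h)))
    (λ h → ∈-nbr⁺ (dual M) (from (∈-nbr⁻ M h)))
    where
    open Matroid M
    to : ∀ {j} → Adj (dual M) (∁ B) v j → Adj M B v j
    to (inj₁ (v∈∁B , _)) = contradiction v∈B (x∈∁p⇒x∉p v∈∁B)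
    to (inj₂ (_ , j∈∁B , b)) =
      let j∉B = x∈∁p⇒x∉p j∈∁B in
      inj₁ (v∈B , j∉B , subst IsBasis (∁-swap-∁ v∈B j∉B) b)
    from : ∀ {j} → Adj M B v j → Adj (dual M) (∁ B) v j
    from (inj₁ (_ , j∉B , b)) =
      inj₂ (x∈p⇒x∉∁p v∈B , x∉p⇒x∈∁p j∉B , subst IsBasis (sym (∁-swap-∁ v∈B j∉B)) b)
    from (inj₂ (v∉B , _)) = contradiction v∈B v∉B

  fundamentalCocircuit : ∀ (M : Matroid n) {B v} → Matroid.IsBasis M B → v ∈ B →
                         Matroid.IsCircuit (dual M) (nbr M B v ∪ ⁅ v ⁆)
  fundamentalCocircuit M {B} {v} b v∈B =
    subst (λ N → Matroid.IsCircuit (dual M) (N ∪ ⁅ v ⁆)) (nbr-dual M v∈B)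
      (fundamentalCircuit (dual M) (subst (Matroid.IsBasis M) (sym (∁-involutive B)) b)
        (x∈p⇒x∉∁p v∈B))

-- Expansion of the Tutte polynomial by activities

module Activities where
  open import Data.Bool.Base using (if_then_else_)
  open import Data.Fin.Base using (Fin; zero; suc)
  open import Data.Fin.Subset
  open import Data.Fin.Subset.Properties
  open import Data.Integer.Base as ℤ using (ℤ; +_; 0ℤ; 1ℤ)
  import Data.Integer.Properties as ℤ
  open import Data.Integer.Tactic.RingSolver using (solve-∀)
  open import Data.List.Base using (List; []; _∷_; _++_; map; foldr; allFin)
  open import Data.List.Properties using (map-++; map-∘; map-tabulate)
  open import Data.List.Membership.Propositional as List using ()
  open import Data.List.Relation.Binary.Permutation.Propositional as Perm using (_↭_)
  open import Data.List.Relation.Unary.All as All using (All; []; _∷_)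
  open import Data.List.Relation.Unary.AllPairs using ([]; _∷_)
  open import Data.List.Relation.Unary.Any as Any using (Any; here; there)
  open import Data.List.Relation.Unary.Unique.Propositional using (Unique)
  open import Data.Nat.Base as ℕ using (ℕ; suc; _∸_; _*_; _≤_)
  import Data.Nat.Properties as ℕ
  open import Data.Product.Base using (∃-syntax; _×_; _,_; proj₁; proj₂)
  open import Data.Sum.Base using (_⊎_; inj₁; inj₂; [_,_]′)
  open import Data.Vec.Base as Vec using ()
  open import Function.Base using (_∘_)
  open import Relation.Binary.PropositionalEquality
  open import Relation.Nullary using (¬_; Dec; does; contradiction; yes; no)
  open import Relation.Nullary.Decidable using (_×-dec_; dec-true; dec-false; decidable-stable)
  open Subsets
  open Bases
  open ExchangeGraph

  private
    variable
      n : ℕ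

  elems : List (Fin n) → Subset n
  elems []       = ⊥
  elems (e ∷ es) = elems es ∪ ⁅ e ⁆

  ∈-elems⁻ : ∀ {z} (es : List (Fin n)) → z ∈ elems es → z List.∈ es
  ∈-elems⁻ []       z∈ = contradiction z∈ ∉⊥
  ∈-elems⁻ (e ∷ es) z∈ with insert⁻ z∈
  ... | inj₁ h = there (∈-elems⁻ es h)
  ... | inj₂ h = here h

  ∈-elems⁺ : ∀ {z} {es : List (Fin n)} → z List.∈ es → z ∈ elems es
  ∈-elems⁺ {es = e ∷ es} (here refl) = insert⁺ʳ (elems es) e
  ∈-elems⁺ {es = e ∷ es} (there h)   = insert⁺ˡ (∈-elems⁺ h)

  -- The sum of g S over C ⊆ S ⊆ C ∪ elems es.
  intervalSum : List (Fin n) → Subset n → (Subset n → ℤ) → ℤ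
  intervalSum []       C g = g C
  intervalSum (e ∷ es) C g = intervalSum es C g ℤ.+ intervalSum es (C ∪ ⁅ e ⁆) g

  insert-comm : ∀ (C : Subset n) e f → (C ∪ ⁅ e ⁆) ∪ ⁅ f ⁆ ≡ (C ∪ ⁅ f ⁆) ∪ ⁅ e ⁆
  insert-comm C e f = trans (∪-assoc C ⁅ e ⁆ ⁅ f ⁆)
    (trans (cong (C ∪_) (∪-comm ⁅ e ⁆ ⁅ f ⁆)) (sym (∪-assoc C ⁅ f ⁆ ⁅ e ⁆)))

  intervalSum-cong : ∀ (es : List (Fin n)) C {g h} →
    (∀ {S} → C ⊆ S → S ⊆ C ∪ elems es → g S ≡ h S) →
    intervalSum es C g ≡ intervalSum es C h
  intervalSum-cong []       C eq = eq ⊆-refl (p⊆p∪q ⊥)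
  intervalSum-cong (e ∷ es) C eq = cong₂ ℤ._+_
    (intervalSum-cong es C λ C⊆S S⊆ → eq C⊆S (λ {z} → wider ∘ S⊆))
    (intervalSum-cong es (C ∪ ⁅ e ⁆) λ Ce⊆S S⊆ → eq (Ce⊆S ∘ insert⁺ˡ) (λ {z} → wider′ ∘ S⊆))
    where
    wider : C ∪ elems es ⊆ C ∪ elems (e ∷ es)
    wider h with x∈p∪q⁻ C (elems es) h
    ... | inj₁ k = x∈p∪q⁺ (inj₁ k)
    ... | inj₂ k = x∈p∪q⁺ (inj₂ (insert⁺ˡ k))
    wider′ : (C ∪ ⁅ e ⁆) ∪ elems es ⊆ C ∪ elems (e ∷ es)
    wider′ h with x∈p∪q⁻ (C ∪ ⁅ e ⁆) (elems es) h
    ... | inj₂ k = x∈p∪q⁺ (inj₂ (insert⁺ˡ k))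
    ... | inj₁ k with insert⁻ k
    ...   | inj₁ k₁   = x∈p∪q⁺ (inj₁ k₁)
    ...   | inj₂ refl = x∈p∪q⁺ (inj₂ (insert⁺ʳ (elems es) e))

  intervalSum-* : ∀ (es : List (Fin n)) C k {g} →
    intervalSum es C (λ S → k ℤ.* g S) ≡ k ℤ.* intervalSum es C g
  intervalSum-* []       C k = refl
  intervalSum-* (e ∷ es) C k = trans
    (cong₂ ℤ._+_ (intervalSum-* es C k) (intervalSum-* es (C ∪ ⁅ e ⁆) k))
    (sym (ℤ.*-distribˡ-+ k _ _))

  intervalSum-shift : ∀ (es : List (Fin n)) C e {g} →
    intervalSum es (C ∪ ⁅ e ⁆) g ≡ intervalSum es C (λ S → g (S ∪ ⁅ e ⁆))
  intervalSum-shift []       C e = refl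
  intervalSum-shift (f ∷ es) C e {g} = cong₂ ℤ._+_ (intervalSum-shift es C e)
    (trans (cong (λ D → intervalSum es D g) (insert-comm C e f))
      (intervalSum-shift es (C ∪ ⁅ f ⁆) e))

  -- This lets the Tutte polynomial be expanded in any order of the ground set. Only a transposition
  -- of the first two elements needs an argument: it exchanges the middle two of four partial sums.
  intervalSum-↭ : ∀ {es fs : List (Fin n)} → es ↭ fs → ∀ C g →
    intervalSum es C g ≡ intervalSum fs C g
  intervalSum-↭ Perm.refl          C g = refl
  intervalSum-↭ (Perm.prep e p)    C g =
    cong₂ ℤ._+_ (intervalSum-↭ p C g) (intervalSum-↭ p (C ∪ ⁅ e ⁆) g)
  intervalSum-↭ (Perm.swap {xs = es} {ys = fs} e f p) C g = begin
    (I es C ℤ.+ I es (C ∪ ⁅ f ⁆)) ℤ.+ (I es (C ∪ ⁅ e ⁆) ℤ.+ I es ((C ∪ ⁅ e ⁆) ∪ ⁅ f ⁆))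
      ≡⟨ cong₂ ℤ._+_ (cong₂ ℤ._+_ (↭ C) (↭ (C ∪ ⁅ f ⁆)))
           (cong₂ ℤ._+_ (↭ (C ∪ ⁅ e ⁆))
             (trans (↭ ((C ∪ ⁅ e ⁆) ∪ ⁅ f ⁆)) (cong (I fs) (insert-comm C e f)))) ⟩
    (I fs C ℤ.+ I fs (C ∪ ⁅ f ⁆)) ℤ.+ (I fs (C ∪ ⁅ e ⁆) ℤ.+ I fs ((C ∪ ⁅ f ⁆) ∪ ⁅ e ⁆))
      ≡⟨ interchange (I fs C) _ _ _ ⟩
    (I fs C ℤ.+ I fs (C ∪ ⁅ e ⁆)) ℤ.+ (I fs (C ∪ ⁅ f ⁆) ℤ.+ I fs ((C ∪ ⁅ f ⁆) ∪ ⁅ e ⁆)) ∎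
    where
    open ≡-Reasoning
    I : List (Fin _) → Subset _ → ℤ
    I es C = intervalSum es C g
    ↭ : ∀ C → I es C ≡ I fs C
    ↭ C = intervalSum-↭ p C g
    interchange : ∀ a b c d → (a ℤ.+ b) ℤ.+ (c ℤ.+ d) ≡ (a ℤ.+ c) ℤ.+ (b ℤ.+ d)
    interchange = solve-∀
  intervalSum-↭ (Perm.trans p q) C g = trans (intervalSum-↭ p C g) (intervalSum-↭ q C g)

  sumℤ : List ℤ → ℤ
  sumℤ = foldr ℤ._+_ 0ℤ

  sumℤ-++ : ∀ xs ys → sumℤ (xs ++ ys) ≡ sumℤ xs ℤ.+ sumℤ ys
  sumℤ-++ []       ys = sym (ℤ.+-identityˡ _)
  sumℤ-++ (x ∷ xs) ys = trans (cong (λ s → x ℤ.+ s) (sumℤ-++ xs ys)) (sym (ℤ.+-assoc x _ _))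

  intervalSum-allFin : ∀ (g : Subset n → ℤ) →
    intervalSum (allFin n) ⊥ g ≡ sumℤ (map g (allSubsets n))
  intervalSum-allFin {ℕ.zero} g = sym (ℤ.+-identityʳ _)
  intervalSum-allFin {suc n}  g = begin
    I (zero ∷ Data.List.Base.tabulate suc) ⊥
      ≡⟨ cong (λ es → I (zero ∷ es) ⊥) (sym (map-tabulate (λ i → i) suc)) ⟩
    I (map suc (allFin n)) ⊥ ℤ.+ I (map suc (allFin n)) (⊥ ∪ ⁅ zero ⁆)
      ≡⟨ cong₂ ℤ._+_ (onTail (allFin n) outside ⊥)
           (trans (cong (I (map suc (allFin n)) ∘ (inside Vec.∷_)) (∪-identityʳ ⊥))
             (onTail (allFin n) inside ⊥)) ⟩
    intervalSum (allFin n) ⊥ (g ∘ (outside Vec.∷_)) ℤ.+ intervalSum (allFin n) ⊥ (g ∘ (inside Vec.∷_))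
      ≡⟨ cong₂ ℤ._+_ (intervalSum-allFin {n} (g ∘ (outside Vec.∷_)))
           (intervalSum-allFin {n} (g ∘ (inside Vec.∷_))) ⟩
    sumℤ (map (g ∘ (outside Vec.∷_)) (allSubsets n)) ℤ.+ sumℤ (map (g ∘ (inside Vec.∷_)) (allSubsets n))
      ≡⟨ cong₂ (λ xs ys → sumℤ xs ℤ.+ sumℤ ys) (map-∘ (allSubsets n)) (map-∘ (allSubsets n)) ⟩
    sumℤ (map g outs) ℤ.+ sumℤ (map g ins)
      ≡⟨ sumℤ-++ (map g outs) (map g ins) ⟨
    sumℤ (map g outs ++ map g ins)
      ≡⟨ cong sumℤ (map-++ g outs ins) ⟨
    sumℤ (map g (allSubsets (suc n))) ∎
    where
    open ≡-Reasoning
    outs ins : List (Subset (suc n))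
    outs = map (outside Vec.∷_) (allSubsets n)
    ins  = map (inside  Vec.∷_) (allSubsets n)
    I : List (Fin (suc n)) → Subset (suc n) → ℤ
    I es C = intervalSum es C g
    onTail : ∀ es s C → I (map suc es) (s Vec.∷ C) ≡ intervalSum es C (g ∘ (s Vec.∷_))
    onTail []       s       C = refl
    onTail (e ∷ es) outside C =
      cong₂ ℤ._+_ (onTail es outside C) (onTail es outside (C ∪ ⁅ e ⁆))
    onTail (e ∷ es) inside  C =
      cong₂ ℤ._+_ (onTail es inside C) (onTail es inside (C ∪ ⁅ e ⁆))

  module _ (M : Matroid n) where
    open Matroid M

    -- An element is active if it comes after all its neighbours in the exchange
    -- graph; it then contributes x if it lies in B and y otherwise.
    factor : ℕ → ℕ → Subset n → Fin n → List (Fin n) → ℕ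
    factor x y B e later =
      if does (Any.any? (adj? M B e) later) then 1 else (if does (e ∈? B) then x else y)

    weight : ℕ → ℕ → List (Fin n) → Subset n → ℕ
    weight x y []       B = 1
    weight x y (e ∷ es) B = factor x y B e es * weight x y es B

    basisWeight : ℕ → ℕ → List (Fin n) → Subset n → ℕ
    basisWeight x y es B = if does (isBasis? B) then weight x y es B else 0

    -- Detects loops and coloops in `activityExpansion`: `e` is a loop of the current minor if no
    -- basis lies between `C ∪ ⁅ e ⁆` and `F+e`, and a coloop if none lies between `C` and `F`.
    basisIn? : ∀ C F → Dec (∃[ B ] IsBasis B × C ⊆ B × B ⊆ F)
    basisIn? C F = anySubset? λ B → isBasis? B ×-dec (C ⊆? B) ×-dec (B ⊆? F)

    private
      factor-inactive : ∀ x y {B e later} → Any (Adj M B e) later → factor x y B e later ≡ 1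
      factor-inactive x y {B} {e} {later} h
        rewrite dec-true (Any.any? (adj? M B e) later) h = refl

      factor-internal : ∀ x y {B e later} → ¬ Any (Adj M B e) later → e ∈ B →
                        factor x y B e later ≡ x
      factor-internal x y {B} {e} {later} h e∈B
        rewrite dec-false (Any.any? (adj? M B e) later) h | dec-true (e ∈? B) e∈B = refl

      factor-external : ∀ x y {B e later} → ¬ Any (Adj M B e) later → e ∉ B →
                        factor x y B e later ≡ y
      factor-external x y {B} {e} {later} h e∉B
        rewrite dec-false (Any.any? (adj? M B e) later) h | dec-false (e ∈? B) e∉B = refl

      basisWeight-step : ∀ x y e es {S k} → (IsBasis S → factor x y S e es ≡ k) →
        + basisWeight x y (e ∷ es) S ≡ + k ℤ.* + basisWeight x y es S
      basisWeight-step x y e es {S} {k} eq with isBasis? S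
      ... | yes b = trans (cong (λ f → + (f * weight x y es S)) (eq b)) (ℤ.pos-* k _)
      ... | no  _ = sym (ℤ.*-zeroʳ (+ k))

      -- The zero is written as a product so that `intervalSum-*` with the factor 0 makes the sum
      -- over an interval without bases vanish.
      basisWeight-nonbasis : ∀ x y {es S} → ¬ IsBasis S → + basisWeight x y es S ≡ 0ℤ ℤ.* 0ℤ
      basisWeight-nonbasis x y {es} {S} ¬b rewrite dec-false (isBasis? S) ¬b = refl

      ∸-drop : ∀ {m n} → n ≤ m → suc m ∸ n ≡ suc (m ∸ n)
      ∸-drop n≤m = ℕ.+-∸-assoc 1 n≤m

    -- Deletion and contraction along the list: `C` holds the contracted elements, and the elements
    -- already treated that are not in `C` are deleted. A basis between `C` and `C ∪ elems es`
    -- ensures that the bases of this minor come from the bases of `M` in that interval. The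
    -- undecided elements are the later ones, so exchanging `e` with one of them stays between `C`
    -- and `C ∪ elems (e ∷ es)`; this is why having no later neighbour amounts to being a loop or a
    -- coloop.
    activityExpansion : ∀ x y es C → All (_∉ C) es → Unique es →
      ∃[ B ] IsBasis B × C ⊆ B × B ⊆ C ∪ elems es →
      intervalSum es C (λ S → (+ x ℤ.- 1ℤ) ℤ.^ (rank M ⊤ ∸ rank M S)
                         ℤ.* (+ y ℤ.- 1ℤ) ℤ.^ (∣ S ∣ ∸ rank M S))
        ≡ intervalSum es C (λ B → + basisWeight x y es B)
    activityExpansion x y [] C _ _ (B , b , C⊆B , B⊆) = begin
      X ℤ.^ (rank M ⊤ ∸ rank M C) ℤ.* Y ℤ.^ (∣ C ∣ ∸ rank M C)
        ≡⟨ cong₂ (λ i j → X ℤ.^ i ℤ.* Y ℤ.^ j)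
             (trans (cong₂ _∸_ (rank-⊤ M c) (rank-basis M c)) (ℕ.n∸n≡0 ∣ C ∣))
             (trans (cong (∣ C ∣ ∸_) (rank-basis M c)) (ℕ.n∸n≡0 ∣ C ∣)) ⟩
      + 1
        ≡⟨ cong (λ d → + (if d then 1 else 0)) (dec-true (isBasis? C) c) ⟨
      + basisWeight x y [] C ∎
      where
      open ≡-Reasoning
      X Y : ℤ
      X = + x ℤ.- 1ℤ
      Y = + y ℤ.- 1ℤ
      c : IsBasis C
      c = subst IsBasis (⊆-antisym
            (λ {z} z∈B → [ (λ h → h) , (λ h → contradiction h ∉⊥) ]′ (x∈p∪q⁻ C ⊥ (B⊆ z∈B)))
            C⊆B) b
    activityExpansion x y (e ∷ es) C (e∉C ∷ es∉C) (e∉es ∷ es!) (B , b , C⊆B , B⊆) =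
      step (basisIn? (C ∪ ⁅ e ⁆) F+e) (basisIn? C F)
      where
      open ≡-Reasoning
      X Y : ℤ
      X = + x ℤ.- 1ℤ
      Y = + y ℤ.- 1ℤ
      F F+e : Subset n
      F   = C ∪ elems es
      F+e = C ∪ elems (e ∷ es)
      t : Subset n → ℤ
      t S = X ℤ.^ (rank M ⊤ ∸ rank M S) ℤ.* Y ℤ.^ (∣ S ∣ ∸ rank M S)
      w w₊ : Subset n → ℤ
      w  S = + basisWeight x y es S
      w₊ S = + basisWeight x y (e ∷ es) S

      C-ind : Independent C
      C-ind = B , b , C⊆B

      e∉F : e ∉ F
      e∉F h with x∈p∪q⁻ C (elems es) h
      ... | inj₁ k = e∉C k
      ... | inj₂ k = All.lookup e∉es (∈-elems⁻ es k) refl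

      F-split : ∀ {z} → z ∈ F+e → z ∈ F ⊎ z ≡ e
      F-split h with x∈p∪q⁻ C (elems (e ∷ es)) h
      ... | inj₁ k = inj₁ (x∈p∪q⁺ (inj₁ k))
      ... | inj₂ k with insert⁻ k
      ...   | inj₁ k₁ = inj₁ (x∈p∪q⁺ (inj₂ k₁))
      ...   | inj₂ k₂ = inj₂ k₂

      F⊆F+e : F ⊆ F+e
      F⊆F+e h with x∈p∪q⁻ C (elems es) h
      ... | inj₁ k = x∈p∪q⁺ (inj₁ k)
      ... | inj₂ k = x∈p∪q⁺ (inj₂ (insert⁺ˡ k))

      e∈F+e : e ∈ F+e
      e∈F+e = x∈p∪q⁺ (inj₂ (insert⁺ʳ (elems es) e))

      Ce-wide : ∀ {z} → z ∈ (C ∪ ⁅ e ⁆) ∪ elems es → z ∈ F+e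
      Ce-wide h with x∈p∪q⁻ (C ∪ ⁅ e ⁆) (elems es) h
      ... | inj₂ k = F⊆F+e (x∈p∪q⁺ (inj₂ k))
      ... | inj₁ k with insert⁻ k
      ...   | inj₁ k₁   = x∈p∪q⁺ (inj₁ k₁)
      ...   | inj₂ refl = e∈F+e

      Ce-wide⁻ : ∀ {z} → z ∈ F+e → z ∈ (C ∪ ⁅ e ⁆) ∪ elems es
      Ce-wide⁻ h with F-split h
      ... | inj₂ refl = x∈p∪q⁺ (inj₁ (insert⁺ʳ C e))
      ... | inj₁ k with x∈p∪q⁻ C (elems es) k
      ...   | inj₁ k₁ = x∈p∪q⁺ (inj₁ (insert⁺ˡ k₁))
      ...   | inj₂ k₁ = x∈p∪q⁺ (inj₂ k₁)

      later : ∀ {z} → z ∈ F → z ∉ C → z List.∈ es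
      later h z∉C with x∈p∪q⁻ C (elems es) h
      ... | inj₁ k = contradiction k z∉C
      ... | inj₂ k = ∈-elems⁻ es k

      Ce⊆ : ∀ {S} → C ⊆ S → e ∈ S → C ∪ ⁅ e ⁆ ⊆ S
      Ce⊆ C⊆S e∈S h with insert⁻ h
      ... | inj₁ k    = C⊆S k
      ... | inj₂ refl = e∈S

      narrow : ∀ {S} → S ⊆ F+e → e ∉ S → S ⊆ F
      narrow S⊆ e∉S {z} z∈S with F-split (S⊆ z∈S)
      ... | inj₁ k    = k
      ... | inj₂ refl = contradiction z∈S e∉S

      es∉Ce : All (_∉ C ∪ ⁅ e ⁆) es
      es∉Ce = All.tabulate λ {z} z∈es h →
        [ All.lookup es∉C z∈es , (λ { refl → All.lookup e∉es z∈es refl }) ]′ (insert⁻ h)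

      step : Dec (∃[ D ] IsBasis D × C ∪ ⁅ e ⁆ ⊆ D × D ⊆ F+e) →
             Dec (∃[ D ] IsBasis D × C ⊆ D × D ⊆ F) →
             intervalSum (e ∷ es) C t ≡ intervalSum (e ∷ es) C w₊
      -- Loop: adding `e` raises only the nullity, and the two halves combine to the factor 1 + (y -
      -- 1). All bases of the interval avoid `e`, and a later neighbour of `e` would produce one
      -- containing it, so `e` is active.
      step (no loop) _ = begin
        intervalSum es C t ℤ.+ intervalSum es (C ∪ ⁅ e ⁆) t
          ≡⟨ cong (λ s → intervalSum es C t ℤ.+ s) (trans (intervalSum-shift es C e)
               (trans (intervalSum-cong es C t-loop) (intervalSum-* es C Y))) ⟩
        intervalSum es C t ℤ.+ Y ℤ.* intervalSum es C t
          ≡⟨ collect (+ y) (intervalSum es C t) ⟩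
        + y ℤ.* intervalSum es C t
          ≡⟨ cong (+ y ℤ.*_) (activityExpansion x y es C es∉C es! (B , b , C⊆B , narrow B⊆ e∉B)) ⟩
        + y ℤ.* intervalSum es C w
          ≡⟨ intervalSum-* es C (+ y) ⟨
        intervalSum es C (λ S → + y ℤ.* w S)
          ≡⟨ intervalSum-cong es C (λ C⊆S S⊆ → sym (basisWeight-step x y e es (external C⊆S S⊆))) ⟩
        intervalSum es C w₊
          ≡⟨ ℤ.+-identityʳ _ ⟨
        intervalSum es C w₊ ℤ.+ 0ℤ
          ≡⟨ cong (λ s → intervalSum es C w₊ ℤ.+ s) (trans
               (intervalSum-cong es (C ∪ ⁅ e ⁆) λ {S} Ce⊆S S⊆ → basisWeight-nonbasis x y {e ∷ es} λ s →
                  loop (S , s , Ce⊆S , Ce-wide ∘ S⊆))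
               (intervalSum-* es (C ∪ ⁅ e ⁆) 0ℤ {λ _ → 0ℤ})) ⟨
        intervalSum es C w₊ ℤ.+ intervalSum es (C ∪ ⁅ e ⁆) w₊ ∎
        where
        collect : ∀ y s → s ℤ.+ (y ℤ.- 1ℤ) ℤ.* s ≡ y ℤ.* s
        collect = solve-∀
        e∉B : e ∉ B
        e∉B e∈B = loop (B , b , Ce⊆ C⊆B e∈B , B⊆)
        Ce-dep : Dependent (C ∪ ⁅ e ⁆)
        Ce-dep Ce-ind with augment M Ce-ind b
        ... | D , d , Ce⊆D , D⊆ = loop (D , d , Ce⊆D , λ {z} z∈D →
          [ (λ k → Ce-wide (x∈p∪q⁺ (inj₁ k))) , B⊆ ]′ (x∈p∪q⁻ (C ∪ ⁅ e ⁆) B (D⊆ z∈D)))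
        t-loop : ∀ {S} → C ⊆ S → S ⊆ F → t (S ∪ ⁅ e ⁆) ≡ Y ℤ.* t S
        t-loop {S} C⊆S S⊆F = trans
          (cong₂ (λ i j → X ℤ.^ i ℤ.* Y ℤ.^ j) (cong (rank M ⊤ ∸_) r≡) nullity)
          (swap* (X ℤ.^ (rank M ⊤ ∸ rank M S)) Y _)
          where
          r≡ : rank M (S ∪ ⁅ e ⁆) ≡ rank M S
          r≡ = rank-insert-loop M {S = S} C-ind Ce-dep C⊆S
          nullity : ∣ S ∪ ⁅ e ⁆ ∣ ∸ rank M (S ∪ ⁅ e ⁆) ≡ suc (∣ S ∣ ∸ rank M S)
          nullity = trans (cong₂ _∸_ (∣insert∣ S e (e∉F ∘ S⊆F)) r≡) (∸-drop (rank≤∣∣ M S))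
          swap* : ∀ a b c → a ℤ.* (b ℤ.* c) ≡ b ℤ.* (a ℤ.* c)
          swap* = solve-∀
        external : ∀ {S} → C ⊆ S → S ⊆ F → IsBasis S → factor x y S e es ≡ y
        external {S} C⊆S S⊆F s = factor-external x y inactive (e∉F ∘ S⊆F)
          where
          inactive : ¬ Any (Adj M S e) es
          inactive h with List.find h
          ... | v , v∈es , inj₁ (e∈S , _) = e∉F (S⊆F e∈S)
          ... | v , v∈es , inj₂ (_ , v∈S , s′) = loop (swap S v e , s′ ,
                Ce⊆ (λ z∈C → swap⁺ˡ (C⊆S z∈C) (λ { refl → All.lookup es∉C v∈es z∈C }))
                    (swap⁺ʳ S v e) ,
                (λ h → [ F⊆F+e ∘ S⊆F ∘ proj₁ , (λ { refl → e∈F+e }) ]′ (swap⁻ h)))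
      -- Coloop: adding `e` lowers only the corank, and the two halves combine to the factor (x - 1)
      -- + 1. A later neighbour of `e` would produce a basis of the interval avoiding `e`.
      step (yes _) (no coloop) = begin
        intervalSum es C t ℤ.+ intervalSum es (C ∪ ⁅ e ⁆) t
          ≡⟨ cong (ℤ._+ intervalSum es (C ∪ ⁅ e ⁆) t) (trans (intervalSum-cong es C t-coloop)
               (trans (intervalSum-* es C X) (cong (X ℤ.*_) (sym (intervalSum-shift es C e))))) ⟩
        X ℤ.* intervalSum es (C ∪ ⁅ e ⁆) t ℤ.+ intervalSum es (C ∪ ⁅ e ⁆) t
          ≡⟨ collect (+ x) (intervalSum es (C ∪ ⁅ e ⁆) t) ⟩
        + x ℤ.* intervalSum es (C ∪ ⁅ e ⁆) t
          ≡⟨ cong (+ x ℤ.*_) (activityExpansion x y es (C ∪ ⁅ e ⁆) es∉Ce es!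
               (B , b , Ce⊆ C⊆B (inAll b B⊆) , Ce-wide⁻ ∘ B⊆)) ⟩
        + x ℤ.* intervalSum es (C ∪ ⁅ e ⁆) w
          ≡⟨ intervalSum-* es (C ∪ ⁅ e ⁆) (+ x) ⟨
        intervalSum es (C ∪ ⁅ e ⁆) (λ S → + x ℤ.* w S)
          ≡⟨ intervalSum-cong es (C ∪ ⁅ e ⁆)
               (λ Ce⊆S S⊆ → sym (basisWeight-step x y e es (internal Ce⊆S S⊆))) ⟩
        intervalSum es (C ∪ ⁅ e ⁆) w₊
          ≡⟨ ℤ.+-identityˡ _ ⟨
        0ℤ ℤ.+ intervalSum es (C ∪ ⁅ e ⁆) w₊
          ≡⟨ cong (ℤ._+ intervalSum es (C ∪ ⁅ e ⁆) w₊) (trans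
               (intervalSum-cong es C λ {S} C⊆S S⊆ → basisWeight-nonbasis x y {e ∷ es} λ s →
                  coloop (S , s , C⊆S , S⊆))
               (intervalSum-* es C 0ℤ {λ _ → 0ℤ})) ⟨
        intervalSum es C w₊ ℤ.+ intervalSum es (C ∪ ⁅ e ⁆) w₊ ∎
        where
        collect : ∀ x s → (x ℤ.- 1ℤ) ℤ.* s ℤ.+ s ≡ x ℤ.* s
        collect = solve-∀
        inAll : ∀ {D} → IsBasis D → D ⊆ F+e → e ∈ D
        inAll {D} d D⊆ = decidable-stable (e ∈? D) λ e∉D → noBasis e∉D (augment M C-ind d)
          where
          noBasis : e ∉ D → ¬ (∃[ A ] IsBasis A × C ⊆ A × A ⊆ C ∪ D)
          noBasis e∉D (A , a , C⊆A , A⊆) = coloop (A , a , C⊆A , λ {z} z∈A →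
            [ (λ k → x∈p∪q⁺ (inj₁ k)) , narrow D⊆ e∉D ]′ (x∈p∪q⁻ C D (A⊆ z∈A)))
        ⊆insert : ∀ {D} → D ⊆ F+e → D ⊆ F ∪ ⁅ e ⁆
        ⊆insert D⊆ h = [ insert⁺ˡ , (λ { refl → insert⁺ʳ F e }) ]′ (F-split (D⊆ h))
        insert⊆ : ∀ {D} → D ⊆ F ∪ ⁅ e ⁆ → D ⊆ F+e
        insert⊆ D⊆ h = [ F⊆F+e , (λ { refl → e∈F+e }) ]′ (insert⁻ (D⊆ h))
        t-coloop : ∀ {S} → C ⊆ S → S ⊆ F → t S ≡ X ℤ.* t (S ∪ ⁅ e ⁆)
        t-coloop {S} C⊆S S⊆F = trans
          (cong₂ (λ i j → X ℤ.^ i ℤ.* Y ℤ.^ j) corank nullity)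
          (ℤ.*-assoc X (X ℤ.^ (rank M ⊤ ∸ rank M (S ∪ ⁅ e ⁆))) _)
          where
          r+1 : rank M (S ∪ ⁅ e ⁆) ≡ suc (rank M S)
          r+1 = rank-insert-coloop M b (⊆insert B⊆) (λ d D⊆ → inAll d (insert⊆ D⊆))
                  S⊆F (e∉F ∘ S⊆F)
          corank : rank M ⊤ ∸ rank M S ≡ suc (rank M ⊤ ∸ rank M (S ∪ ⁅ e ⁆))
          corank = trans (cong (suc (rank M ⊤) ∸_) (sym r+1))
            (∸-drop (rank-mono M {S ∪ ⁅ e ⁆} {⊤} (⊆-max (S ∪ ⁅ e ⁆))))
          nullity : ∣ S ∣ ∸ rank M S ≡ ∣ S ∪ ⁅ e ⁆ ∣ ∸ rank M (S ∪ ⁅ e ⁆)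
          nullity = sym (cong₂ _∸_ (∣insert∣ S e (e∉F ∘ S⊆F)) r+1)
        internal : ∀ {S} → C ∪ ⁅ e ⁆ ⊆ S → S ⊆ (C ∪ ⁅ e ⁆) ∪ elems es → IsBasis S →
                   factor x y S e es ≡ x
        internal {S} Ce⊆S S⊆ s = factor-internal x y inactive e∈S
          where
          e∈S : e ∈ S
          e∈S = Ce⊆S (insert⁺ʳ C e)
          inactive : ¬ Any (Adj M S e) es
          inactive h with List.find h
          ... | f , f∈es , inj₂ (e∉S , _) = e∉S e∈S
          ... | f , f∈es , inj₁ (_ , f∉S , s′) = coloop (swap S e f , s′ ,
                (λ z∈C → swap⁺ˡ (Ce⊆S (insert⁺ˡ z∈C)) (λ { refl → e∉C z∈C })) ,
                narrow (λ h → [ Ce-wide ∘ S⊆ ∘ proj₁ ,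
                                (λ { refl → F⊆F+e (x∈p∪q⁺ (inj₂ (∈-elems⁺ f∈es))) }) ]′ (swap⁻ h))
                  (λ h → [ (λ k → proj₂ k refl) , (λ { refl → All.lookup e∉es f∈es refl }) ]′
                           (swap⁻ h)))
      -- Neither: both halves are expanded inductively. Exchange against a basis of the other half
      -- yields a neighbour of `e`; since that basis or the given one contains `C`, the neighbour is
      -- outside `C` and hence later, so the factor is 1.
      step (yes (B₁ , b₁ , Ce⊆B₁ , B₁⊆)) (yes (B₀ , b₀ , C⊆B₀ , B₀⊆)) = cong₂ ℤ._+_
        (trans (activityExpansion x y es C es∉C es! (B₀ , b₀ , C⊆B₀ , B₀⊆))
          (intervalSum-cong es C λ C⊆S S⊆ → sym (trans
            (basisWeight-step x y e es (λ s → factor-inactive x y (outer C⊆S S⊆ s))) (ℤ.*-identityˡ _))))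
        (trans (activityExpansion x y es (C ∪ ⁅ e ⁆) es∉Ce es! (B₁ , b₁ , Ce⊆B₁ , Ce-wide⁻ ∘ B₁⊆))
          (intervalSum-cong es (C ∪ ⁅ e ⁆) λ Ce⊆S S⊆ → sym (trans
            (basisWeight-step x y e es (λ s → factor-inactive x y (inner Ce⊆S s))) (ℤ.*-identityˡ _))))
        where
        outer : ∀ {S} → C ⊆ S → S ⊆ F → IsBasis S → Any (Adj M S e) es
        outer {S} C⊆S S⊆F s with coexchange M s b₁ (Ce⊆B₁ (insert⁺ʳ C e)) (e∉F ∘ S⊆F)
        ... | v , v∈S , v∉B₁ , s′ = List.lose (later (S⊆F v∈S) (v∉B₁ ∘ Ce⊆B₁ ∘ insert⁺ˡ))
                                      (inj₂ (e∉F ∘ S⊆F , v∈S , s′))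
        inner : ∀ {S} → C ∪ ⁅ e ⁆ ⊆ S → IsBasis S → Any (Adj M S e) es
        inner {S} Ce⊆S s with exchange s b₀ (Ce⊆S (insert⁺ʳ C e)) (e∉F ∘ B₀⊆)
        ... | f , f∈B₀ , f∉S , s′ = List.lose (later (B₀⊆ f∈B₀) (f∉S ∘ Ce⊆S ∘ insert⁺ˡ))
                                      (inj₁ (Ce⊆S (insert⁺ʳ C e) , f∉S , s′))

-- Finite sums and Chebyshev's sum inequality

module Sums where
  open import Data.Nat.Base
  open import Data.Nat.Properties
  open import Data.Nat.Tactic.RingSolver using (solve-∀)
  open import Data.Product.Base using (_×_; _,_)
  open import Data.Sum.Base using (_⊎_; inj₁; inj₂)
  open import Relation.Binary.PropositionalEquality
  open import Relation.Nullary using (yes; no)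

  sum< : ℕ → (ℕ → ℕ) → ℕ
  sum< zero    f = 0
  sum< (suc L) f = sum< L f + f L

  sum<-mono : ∀ L {f g} → (∀ c → c < L → f c ≤ g c) → sum< L f ≤ sum< L g
  sum<-mono zero    f≤g = z≤n
  sum<-mono (suc L) f≤g =
    +-mono-≤ (sum<-mono L λ c c<L → f≤g c (m<n⇒m<1+n c<L)) (f≤g L ≤-refl)

  sum<-cong : ∀ L {f g} → (∀ c → f c ≡ g c) → sum< L f ≡ sum< L g
  sum<-cong zero    f≡g = refl
  sum<-cong (suc L) f≡g = cong₂ _+_ (sum<-cong L f≡g) (f≡g L)

  sum<-* : ∀ L k f → sum< L (λ c → k * f c) ≡ k * sum< L f
  sum<-* zero    k f = sym (*-zeroʳ k)
  sum<-* (suc L) k f = trans (cong (_+ k * f L) (sum<-* L k f)) (sym (*-distribˡ-+ k _ _))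

  sum<-*ʳ : ∀ L k f → sum< L (λ c → f c * k) ≡ sum< L f * k
  sum<-*ʳ L k f = trans (sum<-cong L (λ c → *-comm (f c) k)) (trans (sum<-* L k f) (*-comm k _))

  sum<-+ : ∀ L f g → sum< L (λ c → f c + g c) ≡ sum< L f + sum< L g
  sum<-+ zero    f g = refl
  sum<-+ (suc L) f g = trans (cong (_+ (f L + g L)) (sum<-+ L f g))
    (interchange (sum< L f) (sum< L g) (f L) (g L))
    where
    interchange : ∀ a b c d → (a + b) + (c + d) ≡ (a + c) + (b + d)
    interchange = solve-∀

  sum<-const : ∀ L k → sum< L (λ _ → k) ≡ L * k
  sum<-const zero    k = refl
  sum<-const (suc L) k = trans (cong (_+ k) (sum<-const L k)) (+-comm (L * k) k)

  lt : ℕ → ℕ → ℕ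
  lt _       zero    = 0
  lt zero    (suc _) = 1
  lt (suc a) (suc b) = lt a b

  lt≤1 : ∀ a b → lt a b ≤ 1
  lt≤1 a       zero    = z≤n
  lt≤1 zero    (suc b) = ≤-refl
  lt≤1 (suc a) (suc b) = lt≤1 a b

  lt-monoˡ : ∀ b {a a′} → a′ ≤ a → lt a b ≤ lt a′ b
  lt-monoˡ zero    a′≤a           = z≤n
  lt-monoˡ (suc b) {a} z≤n        = lt≤1 a (suc b)
  lt-monoˡ (suc b) (s≤s a′≤a)     = lt-monoˡ b a′≤a

  lt-monoʳ : ∀ a {b b′} → b ≤ b′ → lt a b ≤ lt a b′
  lt-monoʳ a       z≤n        = z≤n
  lt-monoʳ zero    (s≤s b≤b′) = ≤-refl
  lt-monoʳ (suc a) (s≤s b≤b′) = lt-monoʳ a b≤b′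

  lt≡1 : ∀ {a b} → a < b → lt a b ≡ 1
  lt≡1 (s≤s z≤n)         = refl
  lt≡1 (s≤s a<b@(s≤s _)) = lt≡1 a<b

  lt≡0 : ∀ {a b} → b ≤ a → lt a b ≡ 0
  lt≡0 z≤n       = refl
  lt≡0 (s≤s b≤a) = lt≡0 b≤a

  sum<-lt≤ : ∀ L k → sum< L (λ c → lt c k) ≤ k
  sum<-lt≤ zero    k = z≤n
  sum<-lt≤ (suc L) k with L <? k
  ... | yes L<k = ≤-trans (sum<-mono (suc L) (λ c _ → lt≤1 c k))
                    (≤-trans (≤-reflexive (trans (sum<-const (suc L) 1) (*-identityʳ (suc L)))) L<k)
  ... | no  L≮k rewrite lt≡0 (≮⇒≥ L≮k) | +-identityʳ (sum< L (λ c → lt c k)) = sum<-lt≤ L k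

  rearrangement : ∀ {a b c d} → a ≤ b → c ≤ d → a * d + b * c ≤ a * c + b * d
  rearrangement {a} {c = c} a≤b c≤d with m≤n⇒∃[o]m+o≡n a≤b | m≤n⇒∃[o]m+o≡n c≤d
  ... | k , refl | l , refl = ≤-trans (m≤m+n _ (k * l)) (≤-reflexive (expand a k c l))
    where
    expand : ∀ a k c l → a * (c + l) + (a + k) * c + k * l ≡ a * c + (a + k) * (c + l)
    expand = solve-∀

  SimilarlyOrdered : (f g : ℕ → ℕ) → Set
  SimilarlyOrdered f g = ∀ a b → (f a ≤ f b × g a ≤ g b) ⊎ (f b ≤ f a × g b ≤ g a)

  -- Adding the point `L` increases the right side minus the left side by the sum over c < L of w(L)
  -- w(c) (f(L) - f(c)) (g(L) - g(c)), whose terms are nonnegative for similarly ordered functions.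
  -- `cross` states this without subtraction.
  chebyshev : ∀ L w {f g} → SimilarlyOrdered f g →
    sum< L (λ c → w c * f c) * sum< L (λ c → w c * g c) ≤
    sum< L w * sum< L (λ c → w c * (f c * g c))
  chebyshev zero    w so = z≤n
  chebyshev (suc L) w {f} {g} so = begin
    (F + a * x) * (G + a * y)                      ≡⟨ expandˡ F G a x y ⟩
    F * G + (a * (x * G + y * F) + a * a * (x * y))
      ≤⟨ +-mono-≤ (chebyshev L w so) (+-monoˡ-≤ (a * a * (x * y)) (*-monoʳ-≤ a (cross L))) ⟩
    A * H + (a * (x * y * A + H) + a * a * (x * y)) ≡⟨ expandʳ A H a x y ⟩
    (A + a) * (H + a * (x * y))                    ∎
    where
    open ≤-Reasoning
    A F G H a x y : ℕ
    A = sum< L w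
    F = sum< L (λ c → w c * f c)
    G = sum< L (λ c → w c * g c)
    H = sum< L (λ c → w c * (f c * g c))
    a = w L
    x = f L
    y = g L
    expandˡ : ∀ F G a x y → (F + a * x) * (G + a * y) ≡
                            F * G + (a * (x * G + y * F) + a * a * (x * y))
    expandˡ = solve-∀
    expandʳ : ∀ A H a x y → A * H + (a * (x * y * A + H) + a * a * (x * y)) ≡
                            (A + a) * (H + a * (x * y))
    expandʳ = solve-∀
    term : ∀ c → x * g c + y * f c ≤ x * y + f c * g c
    term c with so c L
    ... | inj₁ (f≤ , g≤) = begin
      x * g c + y * f c   ≡⟨ cong₂ _+_ refl (*-comm y (f c)) ⟩
      x * g c + f c * y   ≡⟨ +-comm (x * g c) (f c * y) ⟩
      f c * y + x * g c   ≤⟨ rearrangement f≤ g≤ ⟩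
      f c * g c + x * y   ≡⟨ +-comm (f c * g c) (x * y) ⟩
      x * y + f c * g c   ∎
    ... | inj₂ (f≥ , g≥) = begin
      x * g c + y * f c   ≡⟨ cong (x * g c +_) (*-comm y (f c)) ⟩
      x * g c + f c * y   ≤⟨ rearrangement f≥ g≥ ⟩
      x * y + f c * g c   ∎
    cross : ∀ K → x * sum< K (λ c → w c * g c) + y * sum< K (λ c → w c * f c) ≤
                  x * y * sum< K w + sum< K (λ c → w c * (f c * g c))
    cross zero = ≤-reflexive (zeros x y)
      where
      zeros : ∀ x y → x * 0 + y * 0 ≡ x * y * 0 + 0
      zeros = solve-∀
    cross (suc K) = begin
      x * (G′ + u * g K) + y * (F′ + u * f K)         ≡⟨ regroupˡ x y G′ F′ u (f K) (g K) ⟩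
      (x * G′ + y * F′) + u * (x * g K + y * f K)     ≤⟨ +-mono-≤ (cross K) (*-monoʳ-≤ u (term K)) ⟩
      (x * y * A′ + H′) + u * (x * y + f K * g K)     ≡⟨ regroupʳ x y A′ H′ u (f K) (g K) ⟩
      x * y * (A′ + u) + (H′ + u * (f K * g K))       ∎
      where
      A′ F′ G′ H′ u : ℕ
      A′ = sum< K w
      F′ = sum< K (λ c → w c * f c)
      G′ = sum< K (λ c → w c * g c)
      H′ = sum< K (λ c → w c * (f c * g c))
      u = w K
      regroupˡ : ∀ x y G F u a b → x * (G + u * b) + y * (F + u * a) ≡
                                   (x * G + y * F) + u * (x * b + y * a)
      regroupˡ = solve-∀
      regroupʳ : ∀ x y A H u a b → (x * y * A + H) + u * (x * y + a * b) ≡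
                                   x * y * (A + u) + (H + u * (a * b))
      regroupʳ = solve-∀

-- Finite products

module Products where
  open import Data.Bool.Base using (if_then_else_)
  open import Data.Fin.Base using (Fin; zero; suc)
  open import Data.Fin.Subset using (Subset; inside; outside; ∣_∣)
  open import Data.Nat.Base
  open import Data.Nat.Properties
  open import Data.Nat.Tactic.RingSolver using (solve-∀)
  open import Data.Vec.Base using (_∷_; []; lookup)
  open import Function.Base using (_∘_)
  open import Relation.Binary.PropositionalEquality
  open import Algebra.Properties.CommutativeMonoid.Sum *-1-commutativeMonoid public
    using () renaming (sum to ∏; sum-cong-≗ to ∏-cong; ∑-distrib-+ to ∏-distrib-*)

  private
    variable
      n : ℕ

  ∏-mono : ∀ {f g : Fin n → ℕ} → (∀ i → f i ≤ g i) → ∏ f ≤ ∏ g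
  ∏-mono {zero}  f≤g = ≤-refl
  ∏-mono {suc n} f≤g = *-mono-≤ (f≤g zero) (∏-mono (f≤g ∘ suc))

  ∏-pos : ∀ {f : Fin n → ℕ} → (∀ i → 1 ≤ f i) → 1 ≤ ∏ f
  ∏-pos {zero}  1≤f = ≤-refl
  ∏-pos {suc n} 1≤f = *-mono-≤ (1≤f zero) (∏-pos (1≤f ∘ suc))

  ∏-const : ∀ k → ∏ {n} (λ _ → k) ≡ k ^ n
  ∏-const {zero}  k = refl
  ∏-const {suc n} k = cong (k *_) (∏-const {n} k)

  -- The factor `b ^ ∣ S ∣` on the left avoids an exponent n - |S|.
  ∏-if : ∀ (S : Subset n) a b →
    ∏ (λ j → if lookup S j then a else b) * b ^ ∣ S ∣ ≡ a ^ ∣ S ∣ * b ^ n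
  ∏-if []            a b = refl
  ∏-if (outside ∷ S) a b = trans (assoc b _ (b ^ ∣ S ∣)) (trans (cong (b *_) (∏-if S a b)) (out (a ^ ∣ S ∣) b _))
    where
    assoc : ∀ b P Q → b * P * Q ≡ b * (P * Q)
    assoc = solve-∀
    out : ∀ A b B → b * (A * B) ≡ A * (b * B)
    out = solve-∀
  ∏-if (inside  ∷ S) a b = trans (regroup a _ b (b ^ ∣ S ∣)) (trans (cong (a * b *_) (∏-if S a b)) (out a b (a ^ ∣ S ∣) _))
    where
    regroup : ∀ a P b Q → a * P * (b * Q) ≡ a * b * (P * Q)
    regroup = solve-∀
    out : ∀ a b A B → a * b * (A * B) ≡ a * A * (b * B)
    out = solve-∀

  ∏-if-1 : ∀ (S : Subset n) a → ∏ (λ j → if lookup S j then a else 1) ≡ a ^ ∣ S ∣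
  ∏-if-1 []            a = refl
  ∏-if-1 (outside ∷ S) a = trans (*-identityˡ _) (∏-if-1 S a)
  ∏-if-1 (inside  ∷ S) a = cong (a *_) (∏-if-1 S a)

-- Sums over configurations and Harris' inequality

module Configurations where
  open import Data.Bool.Base using (if_then_else_; true; false)
  open import Data.Fin.Base using (Fin; zero; suc)
  open import Data.Fin.Subset using (Subset)
  open import Data.Nat.Base
  open import Data.Nat.Properties
  open import Data.Nat.Tactic.RingSolver using (solve-∀)
  open import Data.Product.Base using (_,_)
  open import Data.Sum.Base using (inj₁; inj₂)
  open import Data.Vec.Base using (Vec; []; _∷_; lookup)
  open import Data.Vec.Relation.Binary.Pointwise.Inductive using (Pointwise; []; _∷_)
  open import Function.Base using (_∘_)
  open import Level using (0ℓ)
  open import Relation.Binary.Core using (Rel)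
  open import Relation.Binary.Definitions using (Total)
  open import Relation.Binary.PropositionalEquality
  open Sums
  open Products

  private
    variable
      n : ℕ

  -- The sum of f x, weighted by ∏ᵢ w i xᵢ, over x ∈ {0,…,L-1}ⁿ.
  Σᶜ : ℕ → (Fin n → ℕ → ℕ) → (Vec ℕ n → ℕ) → ℕ
  Σᶜ {zero}  L w f = f []
  Σᶜ {suc n} L w f = sum< L λ c → w zero c * Σᶜ L (w ∘ suc) (f ∘ (c ∷_))

  one : Fin n → ℕ → ℕ
  one _ _ = 1

  Σᶜ-mono : ∀ L (w : Fin n → ℕ → ℕ) {f g} → (∀ x → f x ≤ g x) → Σᶜ L w f ≤ Σᶜ L w g
  Σᶜ-mono {zero}  L w f≤g = f≤g []
  Σᶜ-mono {suc n} L w f≤g =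
    sum<-mono L λ c _ → *-monoʳ-≤ (w zero c) (Σᶜ-mono L (w ∘ suc) (f≤g ∘ (c ∷_)))

  Σᶜ-cong : ∀ L (w : Fin n → ℕ → ℕ) {f g} → (∀ x → f x ≡ g x) → Σᶜ L w f ≡ Σᶜ L w g
  Σᶜ-cong {zero}  L w f≡g = f≡g []
  Σᶜ-cong {suc n} L w f≡g =
    sum<-cong L λ c → cong (w zero c *_) (Σᶜ-cong L (w ∘ suc) (f≡g ∘ (c ∷_)))

  Σᶜ-* : ∀ L (w : Fin n → ℕ → ℕ) k f → Σᶜ L w (λ x → k * f x) ≡ k * Σᶜ L w f
  Σᶜ-* {zero}  L w k f = refl
  Σᶜ-* {suc n} L w k f = trans
    (sum<-cong L λ c → trans (cong (w zero c *_) (Σᶜ-* L (w ∘ suc) k (f ∘ (c ∷_))))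
                             (pull (w zero c) k _))
    (sum<-* L k _)
    where
    pull : ∀ a k b → a * (k * b) ≡ k * (a * b)
    pull = solve-∀

  Σᶜ-+ : ∀ L (w : Fin n → ℕ → ℕ) f g → Σᶜ L w (λ x → f x + g x) ≡ Σᶜ L w f + Σᶜ L w g
  Σᶜ-+ {zero}  L w f g = refl
  Σᶜ-+ {suc n} L w f g = trans
    (sum<-cong L λ c → trans (cong (w zero c *_) (Σᶜ-+ L (w ∘ suc) _ _)) (*-distribˡ-+ (w zero c) _ _))
    (sum<-+ L _ _)

  Σᶜ-const : ∀ L (w : Fin n → ℕ → ℕ) k → Σᶜ L w (λ _ → k) ≡ Σᶜ L w (λ _ → 1) * k
  Σᶜ-const L w k = trans (Σᶜ-cong L w (λ _ → sym (*-identityʳ k)))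
    (trans (Σᶜ-* L w k (λ _ → 1)) (*-comm k _))

  Σᶜ-sum< : ∀ L (w : Fin n → ℕ → ℕ) K (h : ℕ → Vec ℕ n → ℕ) →
    Σᶜ L w (λ x → sum< K (λ c → h c x)) ≡ sum< K (λ c → Σᶜ L w (h c))
  Σᶜ-sum< L w zero    h = trans (Σᶜ-const L w 0) (*-zeroʳ (Σᶜ L w (λ _ → 1)))
  Σᶜ-sum< L w (suc K) h = trans (Σᶜ-+ L w _ _) (cong (_+ Σᶜ L w (h K)) (Σᶜ-sum< L w K h))

  Σᶜ-∏ : ∀ L (w : Fin n → ℕ → ℕ) (g : Fin n → ℕ → ℕ) →
    Σᶜ L w (λ x → ∏ (λ i → g i (lookup x i))) ≡ ∏ (λ i → sum< L (λ c → w i c * g i c))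
  Σᶜ-∏ {zero}  L w g = refl
  Σᶜ-∏ {suc n} L w g = trans
    (sum<-cong L λ c → trans
      (cong (w zero c *_) (trans (Σᶜ-* L (w ∘ suc) (g zero c) _)
                                 (cong (g zero c *_) (Σᶜ-∏ L (w ∘ suc) (g ∘ suc)))))
      (sym (*-assoc (w zero c) (g zero c) _)))
    (sum<-*ʳ L _ _)

  Σᶜ-1 : ∀ L (w : Fin n → ℕ → ℕ) → Σᶜ L w (λ _ → 1) ≡ ∏ (λ i → sum< L (w i))
  Σᶜ-1 {zero}  L w = refl
  Σᶜ-1 {suc n} L w = trans (sum<-*ʳ L _ (w zero)) (cong (sum< L (w zero) *_) (Σᶜ-1 L (w ∘ suc)))

  Σᶜ-one : ∀ n L → Σᶜ {n} L one (λ _ → 1) ≡ L ^ n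
  Σᶜ-one n L = trans (Σᶜ-1 {n} L one)
    (trans (∏-cong {n} (λ _ → trans (sum<-const L 1) (*-identityʳ L))) (∏-const {n} L))

  -- The marginal of a product weight at one coordinate, with the denominators of both means
  -- multiplied out.
  Σᶜ-lookup : ∀ L (w : Fin n → ℕ → ℕ) i (h : ℕ → ℕ) →
    Σᶜ L w (λ x → h (lookup x i)) * sum< L (w i) ≡
    Σᶜ L w (λ _ → 1) * sum< L (λ c → w i c * h c)
  Σᶜ-lookup {suc n} L w zero h = begin
    sum< L (λ c → w zero c * Σᶜ L (w ∘ suc) (λ _ → h c)) * sum< L (w zero)
      ≡⟨ cong (_* sum< L (w zero)) (sum<-cong L λ c →
           trans (cong (w zero c *_) (Σᶜ-const L (w ∘ suc) (h c))) (pull (w zero c) W (h c))) ⟩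
    sum< L (λ c → W * (w zero c * h c)) * sum< L (w zero)
      ≡⟨ cong (_* sum< L (w zero)) (sum<-* L W _) ⟩
    W * t * sum< L (w zero)
      ≡⟨ rot W t (sum< L (w zero)) ⟩
    sum< L (w zero) * W * t
      ≡⟨ cong (_* t) (sum<-*ʳ L W (w zero)) ⟨
    Σᶜ L w (λ _ → 1) * t ∎
    where
    open ≡-Reasoning
    W t : ℕ
    W = Σᶜ L (w ∘ suc) (λ _ → 1)
    t = sum< L (λ c → w zero c * h c)
    pull : ∀ a b c → a * (b * c) ≡ b * (a * c)
    pull = solve-∀
    rot : ∀ a b c → a * b * c ≡ c * a * b
    rot = solve-∀
  Σᶜ-lookup {suc n} L w (suc i) h = begin
    sum< L (λ c → w zero c * Σᶜ L (w ∘ suc) (λ x → h (lookup x i))) * s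
      ≡⟨ cong (_* s) (sum<-*ʳ L _ _) ⟩
    sum< L (w zero) * Σᶜ L (w ∘ suc) (λ x → h (lookup x i)) * s
      ≡⟨ *-assoc (sum< L (w zero)) _ s ⟩
    sum< L (w zero) * (Σᶜ L (w ∘ suc) (λ x → h (lookup x i)) * s)
      ≡⟨ cong (sum< L (w zero) *_) (Σᶜ-lookup L (w ∘ suc) i h) ⟩
    sum< L (w zero) * (Σᶜ L (w ∘ suc) (λ _ → 1) * t)
      ≡⟨ *-assoc (sum< L (w zero)) _ t ⟨
    sum< L (w zero) * Σᶜ L (w ∘ suc) (λ _ → 1) * t
      ≡⟨ cong (_* t) (sum<-*ʳ L _ _) ⟨
    Σᶜ L w (λ _ → 1) * t ∎
    where
    open ≡-Reasoning
    s t : ℕ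
    s = sum< L (w (suc i))
    t = sum< L (λ c → w (suc i) c * h c)

  -- A change of density: weighted sums become uniform ones, which `reweigh` can compare term by
  -- term.
  Σᶜ-weight : ∀ L (w : Fin n → ℕ → ℕ) f →
    Σᶜ L w f ≡ Σᶜ L one (λ x → ∏ (λ i → w i (lookup x i)) * f x)
  Σᶜ-weight {zero}  L w f = sym (*-identityˡ _)
  Σᶜ-weight {suc n} L w f = sum<-cong L λ c → begin
    w zero c * Σᶜ L (w ∘ suc) (f ∘ (c ∷_))
      ≡⟨ cong (w zero c *_) (Σᶜ-weight L (w ∘ suc) (f ∘ (c ∷_))) ⟩
    w zero c * Σᶜ L one (λ x → ∏ (λ i → w (suc i) (lookup x i)) * f (c ∷ x))
      ≡⟨ Σᶜ-* {n} L one (w zero c) _ ⟨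
    Σᶜ L one (λ x → w zero c * (∏ (λ i → w (suc i) (lookup x i)) * f (c ∷ x)))
      ≡⟨ Σᶜ-cong {n} L one (λ x → sym (*-assoc (w zero c) _ _)) ⟩
    Σᶜ L one (λ x → w zero c * ∏ (λ i → w (suc i) (lookup x i)) * f (c ∷ x))
      ≡⟨ *-identityˡ _ ⟨
    1 * Σᶜ L one (λ x → w zero c * ∏ (λ i → w (suc i) (lookup x i)) * f (c ∷ x)) ∎
    where open ≡-Reasoning

  mix : Subset n → Vec ℕ n → Vec ℕ n → Vec ℕ n
  mix []      []       []       = []
  mix (a ∷ A) (y ∷ ys) (z ∷ zs) = (if a then z else y) ∷ mix A ys zs

  lookup-mix : ∀ (A : Subset n) y z i →
    lookup (mix A y z) i ≡ (if lookup A i then lookup z i else lookup y i)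
  lookup-mix (a ∷ A) (y ∷ ys) (z ∷ zs) zero    = refl
  lookup-mix (a ∷ A) (y ∷ ys) (z ∷ zs) (suc i) = lookup-mix A ys zs i

  -- The coordinates of `y` in `A` and those of `z` outside `A` do not enter `mix A y z`; their free
  -- choice accounts for `L ^ n`. Thus the coordinates on one side can be held fixed, and Harris'
  -- inequality applied to the others, without splitting the index set.
  Σᶜ-mix : ∀ L (A : Subset n) f →
    Σᶜ L one (λ y → Σᶜ L one (λ z → f (mix A y z))) ≡ L ^ n * Σᶜ L one f
  Σᶜ-mix {zero}  L []      f = sym (*-identityˡ _)
  Σᶜ-mix {suc n} L (a ∷ A) f = begin
    sum< L (λ c → 1 * Σᶜ L one (λ ys → sum< L (λ d → 1 * inner c d ys)))
      ≡⟨ sum<-cong L (λ c → trans (*-identityˡ _) (trans (Σᶜ-sum< {n} L one L _)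
           (sum<-cong L (λ d → trans (Σᶜ-* {n} L one 1 _) (*-identityˡ _))))) ⟩
    sum< L (λ c → sum< L (λ d → Σᶜ L one (inner c d)))
      ≡⟨ sum<-cong L (λ c → sum<-cong L (λ d → Σᶜ-mix L A (f ∘ ((if a then d else c) ∷_)))) ⟩
    sum< L (λ c → sum< L (λ d → L ^ n * Σᶜ L one (f ∘ ((if a then d else c) ∷_))))
      ≡⟨ collapse a ⟩
    L * (L ^ n * sum< L (λ c → 1 * Σᶜ L one (f ∘ (c ∷_))))
      ≡⟨ *-assoc L (L ^ n) _ ⟨
    L * L ^ n * sum< L (λ c → 1 * Σᶜ L one (f ∘ (c ∷_))) ∎
    where
    open ≡-Reasoning
    inner : ℕ → ℕ → Vec ℕ n → ℕ
    inner c d ys = Σᶜ L one (λ zs → f ((if a then d else c) ∷ mix A ys zs))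
    body : ℕ → ℕ
    body c = L ^ n * Σᶜ L one (f ∘ (c ∷_))
    body-sum : sum< L body ≡ L ^ n * sum< L (λ c → 1 * Σᶜ L one (f ∘ (c ∷_)))
    body-sum = trans (sum<-* L (L ^ n) _)
      (cong (L ^ n *_) (sum<-cong L (λ c → sym (*-identityˡ _))))
    collapse : ∀ a → sum< L (λ c → sum< L (λ d → body (if a then d else c))) ≡
                     L * (L ^ n * sum< L (λ c → 1 * Σᶜ L one (f ∘ (c ∷_))))
    collapse true  = trans (sum<-const L _) (cong (L *_) body-sum)
    collapse false = trans (sum<-cong L (λ c → sum<-const L (body c)))
      (trans (sum<-* L L body) (cong (L *_) body-sum))

  -- The order is a parameter because increasing functions are needed for the coordinates in `A` and
  -- decreasing ones for those outside.
  module Harris (_≼_ : Rel ℕ 0ℓ) (≼-total : Total _≼_) where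

    Monotone : (Vec ℕ n → ℕ) → Set
    Monotone f = ∀ {x y} → Pointwise _≼_ x y → f x ≤ f y

    private
      ≼-refl : ∀ {c} → c ≼ c
      ≼-refl {c} with ≼-total c c
      ... | inj₁ h = h
      ... | inj₂ h = h

      pointwise-refl : ∀ (x : Vec ℕ n) → Pointwise _≼_ x x
      pointwise-refl []      = []
      pointwise-refl (c ∷ x) = ≼-refl ∷ pointwise-refl x

    -- With the first coordinate fixed, induction treats the others. The resulting sums `F` and `G`
    -- over the other coordinates are monotone in the first one, so Chebyshev's inequality applies
    -- to them.
    harris : ∀ L (w : Fin n → ℕ → ℕ) {f g} → Monotone f → Monotone g →
      Σᶜ L w f * Σᶜ L w g ≤ Σᶜ L w (λ _ → 1) * Σᶜ L w (λ x → f x * g x)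
    harris {zero}  L w {f} {g} mf mg = ≤-reflexive (sym (*-identityˡ _))
    harris {suc n} L w {f} {g} mf mg = begin
      sum< L (λ c → w₀ c * F c) * sum< L (λ c → w₀ c * G c)
        ≤⟨ chebyshev L w₀ similarly ⟩
      sum< L w₀ * sum< L (λ c → w₀ c * (F c * G c))
        ≤⟨ *-monoʳ-≤ (sum< L w₀) (sum<-mono L λ c _ → *-monoʳ-≤ (w₀ c)
             (harris L (w ∘ suc) (λ p → mf (≼-refl ∷ p)) (λ p → mg (≼-refl ∷ p)))) ⟩
      sum< L w₀ * sum< L (λ c → w₀ c * (W * H c))
        ≡⟨ cong (sum< L w₀ *_) (trans (sum<-cong L (λ c → pull (w₀ c) W (H c))) (sum<-* L W _)) ⟩
      sum< L w₀ * (W * sum< L (λ c → w₀ c * H c))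
        ≡⟨ *-assoc (sum< L w₀) W _ ⟨
      sum< L w₀ * W * sum< L (λ c → w₀ c * H c)
        ≡⟨ cong (_* sum< L (λ c → w₀ c * H c)) (sum<-*ʳ L W w₀) ⟨
      sum< L (λ c → w₀ c * W) * sum< L (λ c → w₀ c * H c) ∎
      where
      open ≤-Reasoning
      w₀ F G H : ℕ → ℕ
      w₀ = w zero
      F c = Σᶜ L (w ∘ suc) (f ∘ (c ∷_))
      G c = Σᶜ L (w ∘ suc) (g ∘ (c ∷_))
      H c = Σᶜ L (w ∘ suc) (λ x → f (c ∷ x) * g (c ∷ x))
      W : ℕ
      W = Σᶜ L (w ∘ suc) (λ _ → 1)
      pull : ∀ a k b → a * (k * b) ≡ k * (a * b)
      pull = solve-∀
      similarly : SimilarlyOrdered F G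
      similarly a b with ≼-total a b
      ... | inj₁ a≼b = inj₁ (Σᶜ-mono L _ (λ x → mf (a≼b ∷ pointwise-refl x)) ,
                             Σᶜ-mono L _ (λ x → mg (a≼b ∷ pointwise-refl x)))
      ... | inj₂ b≼a = inj₂ (Σᶜ-mono L _ (λ x → mf (b≼a ∷ pointwise-refl x)) ,
                             Σᶜ-mono L _ (λ x → mg (b≼a ∷ pointwise-refl x)))

    -- If each f i has mean at least p i / q i, then ∏ f has mean at least ∏ p / ∏ q.
    harris-∏ : ∀ {m} L (w : Fin n → ℕ → ℕ) (f : Fin m → Vec ℕ n → ℕ) (p q : Fin m → ℕ) →
      1 ≤ Σᶜ L w (λ _ → 1) → (∀ i → Monotone (f i)) →
      (∀ i → Σᶜ L w (λ _ → 1) * p i ≤ Σᶜ L w (f i) * q i) →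
      Σᶜ L w (λ _ → 1) * ∏ p ≤ Σᶜ L w (λ x → ∏ (λ i → f i x)) * ∏ q
    harris-∏ {m = zero}  L w f p q 1≤W mono mean = ≤-refl
    harris-∏ {m = suc m} L w f p q 1≤W mono mean =
      *-cancelˡ-≤ W {{>-nonZero 1≤W}} (begin
        W * (W * (p zero * P))             ≡⟨ shuffle W (p zero) P ⟩
        W * p zero * (W * P)               ≤⟨ *-mono-≤ (mean zero)
                                               (harris-∏ L w (f ∘ suc) (p ∘ suc) (q ∘ suc) 1≤W
                                                 (mono ∘ suc) (mean ∘ suc)) ⟩
        F * q zero * (Φ * Q)               ≡⟨ shuffle′ F (q zero) Φ Q ⟩
        F * Φ * (q zero * Q)               ≤⟨ *-monoˡ-≤ (q zero * Q) (harris L w (mono zero) mono-∏) ⟩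
        W * Ψ * (q zero * Q)               ≡⟨ *-assoc W Ψ _ ⟩
        W * (Ψ * (q zero * Q))             ∎)
      where
      open ≤-Reasoning
      W P Q F Φ Ψ : ℕ
      W = Σᶜ L w (λ _ → 1)
      P = ∏ (p ∘ suc)
      Q = ∏ (q ∘ suc)
      F = Σᶜ L w (f zero)
      Φ = Σᶜ L w (λ x → ∏ (λ i → f (suc i) x))
      Ψ = Σᶜ L w (λ x → ∏ (λ i → f i x))
      mono-∏ : Monotone (λ x → ∏ (λ i → f (suc i) x))
      mono-∏ x≼y = ∏-mono (λ i → mono (suc i) x≼y)
      shuffle : ∀ W a P → W * (W * (a * P)) ≡ W * a * (W * P)
      shuffle = solve-∀
      shuffle′ : ∀ F a Φ Q → F * a * (Φ * Q) ≡ F * Φ * (a * Q)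
      shuffle′ = solve-∀

-- The two applications of Harris' inequality at a fixed basis

module LocalBound where
  open import Data.Bool.Base using (Bool; true; false; not; if_then_else_)
  open import Data.Fin.Base using (Fin)
  open import Data.Fin.Subset using (Subset; ∁; ∣_∣)
  open import Data.Nat.Base
  open import Data.Nat.Properties
  open import Data.Nat.Tactic.RingSolver using (solve-∀)
  open import Data.Vec.Base using (Vec; lookup)
  open import Data.Vec.Properties using (lookup-map)
  open import Data.Vec.Relation.Binary.Pointwise.Inductive using (Pointwise)
    renaming (lookup to pointwise)
  open import Function.Base using (flip)
  open import Relation.Binary.PropositionalEquality
  open Sums
  open Products
  open Configurations

  -- The coordinates outside A get density proportional to k d on
  -- {0,…,L-1}, where d is the degree; P is the set of admissible degrees, and
  -- Q / R bounds all the distribution functions from below.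
  record Calibration (P : ℕ → Set) : Set where
    field
      L R    : ℕ
      k      : ℕ → ℕ → ℕ
      Q      : ℕ → ℕ
      1≤L    : 1 ≤ L
      1≤R    : 1 ≤ R
      k≤     : ∀ d y → k d y ≤ L ^ d ∸ suc y ^ d
      cdf    : ∀ {d} → P d → ∀ c → c < L →
               sum< L (k d) * Q c ≤ sum< L (λ y → k d y * lt y c) * R
      strong : ∀ {d} → P d →
               L ^ (2 + d) * R ^ d ≤ (L * R ^ d + sum< L (λ c → Q c ^ d)) * sum< L (k d)

  1≤^ : ∀ {a} → 1 ≤ a → ∀ e → 1 ≤ a ^ e
  1≤^ {a} 1≤a e = >-nonZero⁻¹ (a ^ e) {{m^n≢0 a e {{>-nonZero 1≤a}}}}

  ∏∈ : ∀ {n} → Subset n → (Fin n → ℕ) → ℕ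
  ∏∈ S g = ∏ (λ j → if lookup S j then g j else 1)

  ∏∈-mono : ∀ {n} (S : Subset n) {f g} → (∀ j → f j ≤ g j) → ∏∈ S f ≤ ∏∈ S g
  ∏∈-mono S {f} {g} f≤g = ∏-mono (λ j → branch j (lookup S j))
    where
    branch : ∀ j b → (if b then f j else 1) ≤ (if b then g j else 1)
    branch j true  = f≤g j
    branch j false = ≤-refl

  ∏∈-cong : ∀ {n} (S : Subset n) {f g} → (∀ j → lookup S j ≡ true → f j ≡ g j) → ∏∈ S f ≡ ∏∈ S g
  ∏∈-cong S {f} {g} f≡g = ∏-cong (λ j → branch j (lookup S j) refl)
    where
    branch : ∀ j b → lookup S j ≡ b → (if b then f j else 1) ≡ (if b then g j else 1)
    branch j true  eq = f≡g j eq
    branch j false eq = refl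

  -- 2 or 1 at i ∈ A, according to whether xᵢ exceeds all neighbouring
  -- coordinates; 0 or 1 at i ∉ A, according to whether xᵢ is at least as large.
  localFactor : ∀ {n} → Subset n → (Fin n → Subset n) → Vec ℕ n → Fin n → ℕ
  localFactor A N x i =
    if lookup A i then 1 + ∏∈ (N i) (λ j → lt (lookup x j) (lookup x i))
                  else 1 ∸ ∏∈ (N i) (λ j → lt (lookup x j) (suc (lookup x i)))

  -- With `N` the exchange graph of `B`, this bounds X_B from below for `A = B` and Y_B for
  -- `A = ∁ B`.
  orientedSum : ∀ {n} → ℕ → Subset n → (Fin n → Subset n) → ℕ
  orientedSum L A N = Σᶜ L one (λ x → ∏ (localFactor A N x))

  Bipartite : ∀ {n} → Subset n → (Fin n → Subset n) → Set
  Bipartite A N = ∀ i j → lookup (N i) j ≡ true → lookup A j ≡ not (lookup A i)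

  module _ {P : ℕ → Set} (cal : Calibration P) where
    open Calibration cal

    private
      ρ S : ℕ → ℕ
      ρ d = sum< L (k d)
      S d = sum< L (λ c → Q c ^ d)

      1≤ρ : ∀ {d} → P d → 1 ≤ ρ d
      1≤ρ {d} Pd = 1≤ʳ {L * R ^ d + S d} (≤-trans (*-mono-≤ (1≤^ 1≤L (2 + d)) (1≤^ 1≤R d)) (strong Pd))
        where
        1≤ʳ : ∀ {a b} → 1 ≤ a * b → 1 ≤ b
        1≤ʳ {a} {zero}  h rewrite *-zeroʳ a = h
        1≤ʳ {a} {suc b} h = s≤s z≤n

    module _ {n : ℕ} (A : Subset n) (N : Fin n → Subset n)
             (bip : Bipartite A N) (degrees : ∀ i → P ∣ N i ∣) where

      private
        Xₒ : ℕ
        Xₒ = orientedSum L A N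

        W : ℕ
        W = Σᶜ {n} L one (λ _ → 1)

        W≡ : W ≡ L ^ n
        W≡ = Σᶜ-one n L

        1≤W : 1 ≤ W
        1≤W = subst (1 ≤_) (sym W≡) (1≤^ 1≤L n)

        below : Vec ℕ n → Fin n → ℕ → ℕ
        below y i c = ∏∈ (N i) (λ j → lt (lookup y j) c)

        count : Vec ℕ n → Fin n → ℕ
        count y i = sum< L (below y i)

        above : Vec ℕ n → Fin n → ℕ → ℕ
        above z i c = ∏∈ (N i) (λ j → lt (lookup z j) (suc c))

        -- The local factors when `y` supplies the coordinates outside `A` and `z` those in `A`; all
        -- of them increase with `z`. The quotient of `p₁` and `q₁` bounds the mean over `z` from
        -- below.
        f₁ : Vec ℕ n → Fin n → Vec ℕ n → ℕ
        f₁ y i z = if lookup A i then 1 + below y i (lookup z i) else 1 ∸ above z i (lookup y i)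

        p₁ : Vec ℕ n → Fin n → ℕ
        p₁ y i = if lookup A i then L + count y i else L ^ ∣ N i ∣ ∸ suc (lookup y i) ^ ∣ N i ∣

        q₁ : Fin n → ℕ
        q₁ i = if lookup A i then L else L ^ ∣ N i ∣

        localFactor-mix : ∀ y z i → localFactor A N (mix A y z) i ≡ f₁ y i z
        localFactor-mix y z i = branch (lookup A i) refl
          where
          at : ∀ j {a} → lookup A j ≡ a →
               lookup (mix A y z) j ≡ (if a then lookup z j else lookup y j)
          at j refl = lookup-mix A y z j
          branch : ∀ a → lookup A i ≡ a →
            (if a then 1 + below (mix A y z) i (lookup (mix A y z) i)
                  else 1 ∸ above (mix A y z) i (lookup (mix A y z) i)) ≡
            (if a then 1 + below y i (lookup z i) else 1 ∸ above z i (lookup y i))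
          branch true  eq = cong (1 +_) (∏∈-cong (N i) λ j e →
            cong₂ lt (at j (trans (bip i j e) (cong not eq))) (at i eq))
          branch false eq = cong (1 ∸_) (∏∈-cong (N i) λ j e →
            cong₂ lt (at j (trans (bip i j e) (cong not eq))) (cong suc (at i eq)))

        module Up = Harris _≤_ ≤-total

        f₁-mono : ∀ y i → Up.Monotone (f₁ y i)
        f₁-mono y i {z} {z′} z≤z′ = branch (lookup A i)
          where
          branch : ∀ a → (if a then 1 + below y i (lookup z i) else 1 ∸ above z i (lookup y i)) ≤
                         (if a then 1 + below y i (lookup z′ i) else 1 ∸ above z′ i (lookup y i))
          branch true  = s≤s (∏∈-mono (N i) λ j → lt-monoʳ (lookup y j) (pointwise z≤z′ i))
          branch false = ∸-monoʳ-≤ 1 (∏∈-mono (N i)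
            {f = λ j → lt (lookup z′ j) (suc (lookup y i))}
            {g = λ j → lt (lookup z j) (suc (lookup y i))}
            λ j → lt-monoˡ (suc (lookup y i)) (pointwise z≤z′ j))

        mean-inside : ∀ y i → W * (L + count y i) ≤ Σᶜ L one (λ z → 1 + below y i (lookup z i)) * L
        mean-inside y i = ≤-reflexive (begin
          W * (L + count y i)                       ≡⟨ *-distribˡ-+ W L (count y i) ⟩
          W * L + W * count y i                     ≡⟨ cong (W * L +_) (cong (W *_)
                                                        (sum<-cong L (λ c → sym (*-identityˡ _)))) ⟩
          W * L + W * sum< L (λ c → 1 * below y i c) ≡⟨ cong (W * L +_) (Σᶜ-lookup {n} L one i (below y i)) ⟨
          W * L + B * sum< L (λ _ → 1)              ≡⟨ cong (λ l → W * L + B * l)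
                                                        (trans (sum<-const L 1) (*-identityʳ L)) ⟩
          W * L + B * L                             ≡⟨ *-distribʳ-+ L W B ⟨
          (W + B) * L                               ≡⟨ cong (_* L) (Σᶜ-+ {n} L one (λ _ → 1) _) ⟨
          Σᶜ L one (λ z → 1 + below y i (lookup z i)) * L ∎)
          where
          open ≡-Reasoning
          B : ℕ
          B = Σᶜ {n} L one (λ z → below y i (lookup z i))

        mean-outside : ∀ y i → W * (L ^ ∣ N i ∣ ∸ suc (lookup y i) ^ ∣ N i ∣) ≤
                               Σᶜ L one (λ z → 1 ∸ above z i (lookup y i)) * L ^ ∣ N i ∣
        mean-outside y i = begin
          W * (Lᵈ ∸ sᵈ)                        ≡⟨ *-distribˡ-∸ W Lᵈ sᵈ ⟩
          W * Lᵈ ∸ W * sᵈ                      ≤⟨ m≤n+o⇒m∸n≤o (W * Lᵈ) (W * sᵈ) total ⟩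
          U * Lᵈ                               ∎
          where
          open ≤-Reasoning
          s Lᵈ sᵈ U V : ℕ
          s  = suc (lookup y i)
          Lᵈ = L ^ ∣ N i ∣
          sᵈ = s ^ ∣ N i ∣
          U  = Σᶜ {n} L one (λ z → 1 ∸ above z i (lookup y i))
          V  = Σᶜ {n} L one (λ z → above z i (lookup y i))
          -- Nothing here says that `lookup y i` is below `L`, hence an inequality; for larger
          -- values the truncated difference in `p₁` is 0.
          coordinate : ∀ b → sum< L (λ c → 1 * (if b then lt c s else 1)) ≤ (if b then s else L)
          coordinate true  = ≤-trans (≤-reflexive (sum<-cong L (λ c → *-identityˡ _))) (sum<-lt≤ L s)
          coordinate false = ≤-reflexive (trans (sum<-const L 1) (*-identityʳ L))
          V-bound : V * Lᵈ ≤ W * sᵈ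
          V-bound = begin
            V * Lᵈ
              ≡⟨ cong (_* Lᵈ) (Σᶜ-∏ {n} L one (λ j c → if lookup (N i) j then lt c s else 1)) ⟩
            ∏ (λ j → sum< L (λ c → 1 * (if lookup (N i) j then lt c s else 1))) * Lᵈ
              ≤⟨ *-monoˡ-≤ Lᵈ (∏-mono {n} (λ j → coordinate (lookup (N i) j))) ⟩
            ∏ (λ j → if lookup (N i) j then s else L) * Lᵈ
              ≡⟨ ∏-if (N i) s L ⟩
            sᵈ * L ^ n
              ≡⟨ trans (*-comm sᵈ (L ^ n)) (cong (_* sᵈ) (sym W≡)) ⟩
            W * sᵈ ∎
          total : W * Lᵈ ≤ W * sᵈ + U * Lᵈ
          total = begin
            W * Lᵈ            ≤⟨ *-monoˡ-≤ Lᵈ (Σᶜ-mono {n} L one (λ z → m≤n+m∸n 1 (above z i (lookup y i)))) ⟩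
            Σᶜ {n} L one (λ z → above z i (lookup y i) + (1 ∸ above z i (lookup y i))) * Lᵈ
                              ≡⟨ cong (_* Lᵈ) (Σᶜ-+ {n} L one _ _) ⟩
            (V + U) * Lᵈ      ≡⟨ *-distribʳ-+ Lᵈ V U ⟩
            V * Lᵈ + U * Lᵈ   ≤⟨ +-monoˡ-≤ (U * Lᵈ) V-bound ⟩
            W * sᵈ + U * Lᵈ   ∎

        mean₁ : ∀ y i → W * p₁ y i ≤ Σᶜ L one (f₁ y i) * q₁ i
        mean₁ y i = branch (lookup A i)
          where
          branch : ∀ a →
            W * (if a then L + count y i else L ^ ∣ N i ∣ ∸ suc (lookup y i) ^ ∣ N i ∣) ≤
            Σᶜ L one (λ z → if a then 1 + below y i (lookup z i) else 1 ∸ above z i (lookup y i)) *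
            (if a then L else L ^ ∣ N i ∣)
          branch true  = mean-inside y i
          branch false = mean-outside y i

        -- Harris' inequality in `z` for each fixed `y`, summed over `y`; `Σᶜ-mix` then restores the
        -- sum over a single configuration.
        stage₁ : Σᶜ L one (λ y → ∏ (p₁ y)) ≤ Xₒ * ∏ q₁
        stage₁ = *-cancelˡ-≤ W {{>-nonZero 1≤W}} (begin
          W * Σᶜ L one (λ y → ∏ (p₁ y))
            ≡⟨ Σᶜ-* {n} L one W _ ⟨
          Σᶜ L one (λ y → W * ∏ (p₁ y))
            ≤⟨ Σᶜ-mono {n} L one (λ y →
                 Up.harris-∏ L one (f₁ y) (p₁ y) q₁ 1≤W (f₁-mono y) (mean₁ y)) ⟩
          Σᶜ L one (λ y → Σᶜ L one (λ z → ∏ (λ i → f₁ y i z)) * ∏ q₁)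
            ≡⟨ Σᶜ-cong {n} L one (λ y → trans (*-comm _ (∏ q₁)) (cong (∏ q₁ *_)
                 (Σᶜ-cong {n} L one (λ z → ∏-cong {n} (λ i → sym (localFactor-mix y z i)))))) ⟩
          Σᶜ L one (λ y → ∏ q₁ * Σᶜ L one (λ z → ∏ (localFactor A N (mix A y z))))
            ≡⟨ Σᶜ-* {n} L one (∏ q₁) _ ⟩
          ∏ q₁ * Σᶜ L one (λ y → Σᶜ L one (λ z → ∏ (localFactor A N (mix A y z))))
            ≡⟨ cong (∏ q₁ *_) (Σᶜ-mix L A _) ⟩
          ∏ q₁ * (L ^ n * Xₒ)
            ≡⟨ cong (λ w → ∏ q₁ * (w * Xₒ)) W≡ ⟨
          ∏ q₁ * (W * Xₒ)
            ≡⟨ rotate (∏ q₁) W Xₒ ⟩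
          W * (Xₒ * ∏ q₁) ∎)
          where
          open ≤-Reasoning
          rotate : ∀ a b c → a * (b * c) ≡ b * (c * a)
          rotate = solve-∀

        -- The factor of `p₁` at an element outside `A` depends only on the coordinate of that
        -- element, so a minorant of it can be absorbed into a product weight. Only the factors `g`
        -- at the elements of `A` are left for the second application.
        w : Fin n → ℕ → ℕ
        w i c = if lookup A i then 1 else k ∣ N i ∣ c

        g : Fin n → Vec ℕ n → ℕ
        g i y = if lookup A i then L + count y i else 1

        p₂ q₂ ω : Fin n → ℕ
        p₂ i = if lookup A i then L * R ^ ∣ N i ∣ + S ∣ N i ∣ else 1
        q₂ i = if lookup A i then R ^ ∣ N i ∣ else 1
        ω  i = if lookup A i then L else ρ ∣ N i ∣

        ω≡ : ∀ i → sum< L (w i) ≡ ω i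
        ω≡ i = branch (lookup A i)
          where
          branch : ∀ a → sum< L (λ c → if a then 1 else k ∣ N i ∣ c) ≡ (if a then L else ρ ∣ N i ∣)
          branch true  = trans (sum<-const L 1) (*-identityʳ L)
          branch false = refl

        W₂ : ℕ
        W₂ = Σᶜ L w (λ _ → 1)

        W₂≡ : W₂ ≡ ∏ ω
        W₂≡ = trans (Σᶜ-1 L w) (∏-cong ω≡)

        1≤W₂ : 1 ≤ W₂
        1≤W₂ = subst (1 ≤_) (sym W₂≡) (∏-pos λ i → branch i (lookup A i))
          where
          branch : ∀ i a → 1 ≤ (if a then L else ρ ∣ N i ∣)
          branch i true  = 1≤L
          branch i false = 1≤ρ (degrees i)

        -- Larger coordinates outside `A` lower the counts, so the order is reversed.
        module Down = Harris _≥_ (flip ≤-total)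

        count-mono : ∀ i {y y′} → Pointwise _≥_ y y′ → count y i ≤ count y′ i
        count-mono i y≥y′ = sum<-mono L λ c _ →
          ∏∈-mono (N i) λ j → lt-monoˡ c (pointwise y≥y′ j)

        g-mono : ∀ i → Down.Monotone (g i)
        g-mono i {y} {y′} y≥y′ = branch (lookup A i)
          where
          branch : ∀ a → (if a then L + count y i else 1) ≤ (if a then L + count y′ i else 1)
          branch true  = +-monoʳ-≤ L (count-mono i y≥y′)
          branch false = ≤-refl

        -- The neighbours of `i` lie outside `A` and have independent coordinates under `w`, so the
        -- chance that all are below `c` is a product of distribution functions. Their degrees may
        -- differ; the common lower bound `Q c` over `R` for each factor makes the result depend on
        -- the degree of `i` alone.
        mean-count : ∀ i → lookup A i ≡ true → W₂ * S ∣ N i ∣ ≤ Σᶜ L w (λ y → count y i) * R ^ ∣ N i ∣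
        mean-count i Ai = begin
          W₂ * S ∣ N i ∣
            ≡⟨ sum<-* L W₂ _ ⟨
          sum< L (λ c → W₂ * Q c ^ ∣ N i ∣)
            ≤⟨ sum<-mono L pointwise-bound ⟩
          sum< L (λ c → Σᶜ L w (λ y → below y i c) * R ^ ∣ N i ∣)
            ≡⟨ sum<-*ʳ L _ _ ⟩
          sum< L (λ c → Σᶜ L w (λ y → below y i c)) * R ^ ∣ N i ∣
            ≡⟨ cong (_* R ^ ∣ N i ∣) (Σᶜ-sum< L w L (λ c y → below y i c)) ⟨
          Σᶜ L w (λ y → count y i) * R ^ ∣ N i ∣ ∎
          where
          open ≤-Reasoning
          pointwise-bound : ∀ c → c < L →
            W₂ * Q c ^ ∣ N i ∣ ≤ Σᶜ L w (λ y → below y i c) * R ^ ∣ N i ∣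
          pointwise-bound c c<L = begin
            W₂ * Q c ^ ∣ N i ∣
              ≡⟨ cong₂ _*_ (Σᶜ-1 L w) (sym (∏-if-1 (N i) (Q c))) ⟩
            ∏ (λ j → sum< L (w j)) * ∏∈ (N i) (λ _ → Q c)
              ≡⟨ ∏-distrib-* (λ j → sum< L (w j)) (λ j → if lookup (N i) j then Q c else 1) ⟨
            ∏ (λ j → sum< L (w j) * (if lookup (N i) j then Q c else 1))
              ≤⟨ ∏-mono (λ j → coordinate j (lookup (N i) j) refl) ⟩
            ∏ (λ j → sum< L (λ y → w j y * (if lookup (N i) j then lt y c else 1)) *
                     (if lookup (N i) j then R else 1))
              ≡⟨ ∏-distrib-* (λ j → sum< L (λ y → w j y * (if lookup (N i) j then lt y c else 1)))
                             (λ j → if lookup (N i) j then R else 1) ⟩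
            ∏ (λ j → sum< L (λ y → w j y * (if lookup (N i) j then lt y c else 1))) * ∏∈ (N i) (λ _ → R)
              ≡⟨ cong₂ _*_ (sym (Σᶜ-∏ L w (λ j y → if lookup (N i) j then lt y c else 1)))
                           (∏-if-1 (N i) R) ⟩
            Σᶜ L w (λ y → below y i c) * R ^ ∣ N i ∣ ∎
            where
            coordinate : ∀ j b → lookup (N i) j ≡ b →
              sum< L (w j) * (if b then Q c else 1) ≤
              sum< L (λ y → w j y * (if b then lt y c else 1)) * (if b then R else 1)
            coordinate j false _ = ≤-reflexive (cong (_* 1)
              (sum<-cong L (λ y → sym (*-identityʳ (w j y)))))
            coordinate j true  e = branch (lookup A j) (trans (bip i j e) (cong not Ai))
              where
              branch : ∀ a → a ≡ false →
                sum< L (λ y → if a then 1 else k ∣ N j ∣ y) * Q c ≤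
                sum< L (λ y → (if a then 1 else k ∣ N j ∣ y) * lt y c) * R
              branch false _ = cdf (degrees j) c c<L

        mean₂ : ∀ i → W₂ * p₂ i ≤ Σᶜ L w (g i) * q₂ i
        mean₂ i = branch (lookup A i) refl
          where
          open ≤-Reasoning
          branch : ∀ a → lookup A i ≡ a →
            W₂ * (if a then L * R ^ ∣ N i ∣ + S ∣ N i ∣ else 1) ≤
            Σᶜ L w (λ y → if a then L + count y i else 1) * (if a then R ^ ∣ N i ∣ else 1)
          branch false _  = ≤-refl
          branch true  Ai = begin
            W₂ * (L * Rᵈ + S ∣ N i ∣)          ≡⟨ spread W₂ L Rᵈ (S ∣ N i ∣) ⟩
            W₂ * L * Rᵈ + W₂ * S ∣ N i ∣       ≤⟨ +-monoʳ-≤ (W₂ * L * Rᵈ) (mean-count i Ai) ⟩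
            W₂ * L * Rᵈ + C * Rᵈ               ≡⟨ *-distribʳ-+ Rᵈ (W₂ * L) C ⟨
            (W₂ * L + C) * Rᵈ                  ≡⟨ cong (λ v → (v + C) * Rᵈ) (Σᶜ-const L w L) ⟨
            (Σᶜ L w (λ _ → L) + C) * Rᵈ        ≡⟨ cong (_* Rᵈ) (Σᶜ-+ L w _ _) ⟨
            Σᶜ L w (λ y → L + count y i) * Rᵈ  ∎
            where
            Rᵈ C : ℕ
            Rᵈ = R ^ ∣ N i ∣
            C = Σᶜ L w (λ y → count y i)
            spread : ∀ W l r s → W * (l * r + s) ≡ W * l * r + W * s
            spread = solve-∀

        stage₂ : W₂ * ∏ p₂ ≤ Σᶜ L w (λ y → ∏ (λ i → g i y)) * ∏ q₂
        stage₂ = Down.harris-∏ L w g p₂ q₂ 1≤W₂ g-mono mean₂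

        reweigh : Σᶜ L w (λ y → ∏ (λ i → g i y)) ≤ Σᶜ L one (λ y → ∏ (p₁ y))
        reweigh = begin
          Σᶜ L w (λ y → ∏ (λ i → g i y))
            ≡⟨ Σᶜ-weight L w _ ⟩
          Σᶜ L one (λ y → ∏ (λ i → w i (lookup y i)) * ∏ (λ i → g i y))
            ≡⟨ Σᶜ-cong {n} L one (λ y → ∏-distrib-* (λ i → w i (lookup y i)) (λ i → g i y)) ⟨
          Σᶜ L one (λ y → ∏ (λ i → w i (lookup y i) * g i y))
            ≤⟨ Σᶜ-mono {n} L one (λ y → ∏-mono (λ i → branch y i (lookup A i))) ⟩
          Σᶜ L one (λ y → ∏ (p₁ y)) ∎
          where
          open ≤-Reasoning
          branch : ∀ y i a →
            (if a then 1 else k ∣ N i ∣ (lookup y i)) * (if a then L + count y i else 1) ≤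
            (if a then L + count y i else L ^ ∣ N i ∣ ∸ suc (lookup y i) ^ ∣ N i ∣)
          branch y i true  = ≤-reflexive (*-identityˡ _)
          branch y i false = ≤-trans (≤-reflexive (*-identityʳ _)) (k≤ ∣ N i ∣ (lookup y i))

      -- After cancellation an element of `A` contributes L + S(d)/R^d and any other element
      -- ρ(d)/L^d, each to be measured against L.
      localBound :
        ∏ (λ i → if lookup A i then L * (L * R ^ ∣ N i ∣ + S ∣ N i ∣) else ρ ∣ N i ∣) ≤
        Xₒ * ∏ (λ i → if lookup A i then L * R ^ ∣ N i ∣ else L ^ ∣ N i ∣)
      localBound = begin
        ∏ (λ i → if lookup A i then L * (L * R ^ ∣ N i ∣ + S ∣ N i ∣) else ρ ∣ N i ∣)
          ≡⟨ ∏-cong (λ i → splitˡ i (lookup A i)) ⟩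
        ∏ (λ i → ω i * p₂ i)          ≡⟨ ∏-distrib-* ω p₂ ⟩
        ∏ ω * ∏ p₂                    ≡⟨ cong (_* ∏ p₂) W₂≡ ⟨
        W₂ * ∏ p₂                     ≤⟨ stage₂ ⟩
        Σᶜ L w (λ y → ∏ (λ i → g i y)) * ∏ q₂  ≤⟨ *-monoˡ-≤ (∏ q₂) (≤-trans reweigh stage₁) ⟩
        Xₒ * ∏ q₁ * ∏ q₂              ≡⟨ *-assoc Xₒ (∏ q₁) (∏ q₂) ⟩
        Xₒ * (∏ q₁ * ∏ q₂)            ≡⟨ cong (Xₒ *_) (∏-distrib-* q₁ q₂) ⟨
        Xₒ * ∏ (λ i → q₁ i * q₂ i)    ≡⟨ cong (Xₒ *_) (∏-cong (λ i → splitʳ i (lookup A i))) ⟨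
        Xₒ * ∏ (λ i → if lookup A i then L * R ^ ∣ N i ∣ else L ^ ∣ N i ∣) ∎
        where
        open ≤-Reasoning
        splitˡ : ∀ i a → (if a then L * (L * R ^ ∣ N i ∣ + S ∣ N i ∣) else ρ ∣ N i ∣) ≡
          (if a then L else ρ ∣ N i ∣) * (if a then L * R ^ ∣ N i ∣ + S ∣ N i ∣ else 1)
        splitˡ i true  = refl
        splitˡ i false = sym (*-identityʳ _)
        splitʳ : ∀ i a → (if a then L * R ^ ∣ N i ∣ else L ^ ∣ N i ∣) ≡
          (if a then L else L ^ ∣ N i ∣) * (if a then R ^ ∣ N i ∣ else 1)
        splitʳ i true  = refl
        splitʳ i false = sym (*-identityʳ _)

    Bipartite-∁ : ∀ {n} {A : Subset n} {N} → Bipartite A N → Bipartite (∁ A) N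
    Bipartite-∁ {A = A} bip i j e = trans (lookup-map j not A)
      (cong not (trans (bip i j e) (sym (lookup-map i not A))))

    -- Every element is inside for one of `A` and `∁ A` and outside for the other, with the same
    -- neighbours. Its two contributions can therefore be paired, and `strong`, read as (1 + S/(L
    -- R^d)) (ρ/L^(d+1)) ≥ 1, is precisely what each pair must satisfy.
    orientedSum-∁ : ∀ {n} (A : Subset n) N → Bipartite A N → (∀ i → P ∣ N i ∣) →
      L ^ n * L ^ n ≤ orientedSum L A N * orientedSum L (∁ A) N
    orientedSum-∁ {n} A N bip degrees = *-cancelʳ-≤ _ _ D {{>-nonZero 1≤D}} (begin
      L ^ n * L ^ n * D
        ≡⟨ cong (λ v → v * v * D) (∏-const {n} L) ⟨
      ∏ {n} (λ _ → L) * ∏ {n} (λ _ → L) * D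
        ≡⟨ cong (_* D) (∏-distrib-* {n} (λ _ → L) (λ _ → L)) ⟨
      ∏ {n} (λ _ → L * L) * D
        ≡⟨ ∏-distrib-* {n} (λ _ → L * L) (λ i → den i true * den i false) ⟨
      ∏ (λ i → L * L * (den i true * den i false))
        ≤⟨ ∏-mono (λ i → strong′ i (degrees i)) ⟩
      ∏ (λ i → num i true * num i false)
        ≡⟨ ∏-cong (λ i → pair num i (lookup A i)) ⟩
      ∏ (λ i → num i (lookup A i) * num i (not (lookup A i)))
        ≡⟨ ∏-distrib-* (λ i → num i (lookup A i)) (λ i → num i (not (lookup A i))) ⟩
      ∏ (λ i → num i (lookup A i)) * ∏ (λ i → num i (not (lookup A i)))
        ≡⟨ cong (∏ (λ i → num i (lookup A i)) *_) (∏-cong (λ i → cong (num i) (sym (lookup-map i not A)))) ⟩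
      ∏ (λ i → num i (lookup A i)) * ∏ (λ i → num i (lookup (∁ A) i))
        ≤⟨ *-mono-≤ (localBound A N bip degrees)
                    (localBound (∁ A) N (Bipartite-∁ {A = A} {N} bip) degrees) ⟩
      X * ∏ (λ i → den i (lookup A i)) * (X′ * ∏ (λ i → den i (lookup (∁ A) i)))
        ≡⟨ cong (λ v → X * ∏ (λ i → den i (lookup A i)) * (X′ * v))
             (∏-cong (λ i → cong (den i) (lookup-map i not A))) ⟩
      X * ∏ (λ i → den i (lookup A i)) * (X′ * ∏ (λ i → den i (not (lookup A i))))
        ≡⟨ regroup X _ X′ _ ⟩
      X * X′ * (∏ (λ i → den i (lookup A i)) * ∏ (λ i → den i (not (lookup A i))))
        ≡⟨ cong (X * X′ *_) (∏-distrib-* (λ i → den i (lookup A i)) (λ i → den i (not (lookup A i)))) ⟨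
      X * X′ * ∏ (λ i → den i (lookup A i) * den i (not (lookup A i)))
        ≡⟨ cong (X * X′ *_) (∏-cong (λ i → pair den i (lookup A i))) ⟨
      X * X′ * D ∎)
      where
      open ≤-Reasoning
      X X′ : ℕ
      X  = orientedSum L A N
      X′ = orientedSum L (∁ A) N
      num den : Fin n → Bool → ℕ
      num i a = if a then L * (L * R ^ ∣ N i ∣ + S ∣ N i ∣) else ρ ∣ N i ∣
      den i a = if a then L * R ^ ∣ N i ∣ else L ^ ∣ N i ∣
      D : ℕ
      D = ∏ (λ i → den i true * den i false)
      1≤D : 1 ≤ D
      1≤D = ∏-pos λ i → *-mono-≤ (*-mono-≤ 1≤L (1≤^ 1≤R ∣ N i ∣)) (1≤^ 1≤L ∣ N i ∣)
      pair : ∀ (f : Fin n → Bool → ℕ) i a → f i true * f i false ≡ f i a * f i (not a)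
      pair f i true  = refl
      pair f i false = *-comm (f i true) (f i false)
      regroup : ∀ a b c d → a * b * (c * d) ≡ a * c * (b * d)
      regroup = solve-∀
      strong′ : ∀ i → P ∣ N i ∣ → L * L * (den i true * den i false) ≤ num i true * num i false
      strong′ i Pd = begin
        L * L * (L * Rᵈ * Lᵈ)                    ≡⟨ out L Rᵈ Lᵈ ⟩
        L * (L * (L * Lᵈ) * Rᵈ)                  ≤⟨ *-monoʳ-≤ L (strong Pd) ⟩
        L * ((L * Rᵈ + S ∣ N i ∣) * ρ ∣ N i ∣)   ≡⟨ *-assoc L _ _ ⟨
        num i true * num i false                 ∎
        where
        Rᵈ Lᵈ : ℕ
        Rᵈ = R ^ ∣ N i ∣
        Lᵈ = L ^ ∣ N i ∣
        out : ∀ l r e → l * l * (l * r * e) ≡ l * (l * (l * e) * r)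
        out = solve-∀

-- Bernoulli inequalities and power sums

module PowerSums where
  open import Data.Nat.Base
  open import Data.Nat.Properties
  open import Data.Nat.Tactic.RingSolver using (solve-∀)
  open import Data.Sum.Base using (inj₁; inj₂)
  open import Relation.Binary.PropositionalEquality
  open Sums
  open ≤-Reasoning

  bernoulli : ∀ j d → j ^ suc d + suc d * j ^ d ≤ suc j ^ suc d
  bernoulli j zero    = ≤-reflexive (base j)
    where
    base : ∀ j → j * 1 + 1 * 1 ≡ suc j * 1
    base = solve-∀
  bernoulli j (suc d) = begin
    j * P + (2 + d) * P                      ≤⟨ m≤m+n _ (suc d * j ^ d) ⟩
    j * P + (2 + d) * P + suc d * j ^ d      ≡⟨ expand j d (j ^ d) ⟩
    suc j * (P + suc d * j ^ d)              ≤⟨ *-monoʳ-≤ (suc j) (bernoulli j d) ⟩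
    suc j * suc j ^ suc d                    ∎
    where
    P : ℕ
    P = j ^ suc d
    expand : ∀ j d r → j * (j * r) + (2 + d) * (j * r) + suc d * r ≡ suc j * (j * r + suc d * r)
    expand = solve-∀

  bernoulli′ : ∀ j d → suc j ^ suc d ≤ j ^ suc d + suc d * suc j ^ d
  bernoulli′ j zero    = ≤-reflexive (base j)
    where
    base : ∀ j → suc j * 1 ≡ j * 1 + 1 * 1
    base = solve-∀
  bernoulli′ j (suc d) = begin
    P + j * P                                     ≤⟨ +-monoʳ-≤ P (*-monoʳ-≤ j (bernoulli′ j d)) ⟩
    P + j * (j ^ suc d + suc d * suc j ^ d)       ≤⟨ m≤m+n _ (suc d * suc j ^ d) ⟩
    P + j * (j ^ suc d + suc d * suc j ^ d) + suc d * suc j ^ d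
                                                  ≡⟨ collect j d (j ^ suc d) (suc j ^ d) ⟩
    j * j ^ suc d + (2 + d) * P                   ∎
    where
    P : ℕ
    P = suc j ^ suc d
    collect : ∀ j d q r → suc j * r + j * (q + suc d * r) + suc d * r ≡ j * q + (2 + d) * (suc j * r)
    collect = solve-∀

  -- The first three terms of the binomial expansion, doubled to keep the quadratic coefficient free
  -- of division.
  bernoulli₂ : ∀ p c → p ^ c * (2 * (p * p) + 2 * (2 + c) * p + (2 + c) * suc c) ≤ 2 * suc p ^ (2 + c)
  bernoulli₂ p zero    = ≤-reflexive (base p)
    where
    base : ∀ p → 1 * (2 * (p * p) + 4 * p + 2) ≡ 2 * (suc p * (suc p * 1))
    base = solve-∀
  bernoulli₂ p (suc c) = begin
    p * p ^ c * (2 * (p * p) + 2 * (3 + c) * p + (3 + c) * (2 + c))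
      ≤⟨ m≤m+n _ (p ^ c * ((2 + c) * suc c)) ⟩
    p * p ^ c * (2 * (p * p) + 2 * (3 + c) * p + (3 + c) * (2 + c)) + p ^ c * ((2 + c) * suc c)
      ≡⟨ expand p c (p ^ c) ⟩
    suc p * (p ^ c * (2 * (p * p) + 2 * (2 + c) * p + (2 + c) * suc c))
      ≤⟨ *-monoʳ-≤ (suc p) (bernoulli₂ p c) ⟩
    suc p * (2 * suc p ^ (2 + c))
      ≡⟨ comm (suc p) (suc p ^ (2 + c)) ⟩
    2 * (suc p * suc p ^ (2 + c)) ∎
    where
    expand : ∀ p c r →
      p * r * (2 * (p * p) + 2 * (3 + c) * p + (3 + c) * (2 + c)) + r * ((2 + c) * suc c) ≡
      suc p * (r * (2 * (p * p) + 2 * (2 + c) * p + (2 + c) * suc c))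
    expand = solve-∀
    comm : ∀ a b → a * (2 * b) ≡ 2 * (a * b)
    comm = solve-∀

  -- Bernoulli's inequality telescopes. This and `powerSum-≥` compare the left and right Riemann
  -- sums of the d-th power with its integral.
  powerSum-≤ : ∀ d T → suc d * sum< T (_^ d) ≤ T ^ suc d
  powerSum-≤ d zero    = ≤-trans (≤-reflexive (*-zeroʳ (suc d))) z≤n
  powerSum-≤ d (suc T) = begin
    suc d * (sum< T (_^ d) + T ^ d)           ≡⟨ *-distribˡ-+ (suc d) _ (T ^ d) ⟩
    suc d * sum< T (_^ d) + suc d * T ^ d     ≤⟨ +-monoˡ-≤ (suc d * T ^ d) (powerSum-≤ d T) ⟩
    T ^ suc d + suc d * T ^ d                 ≤⟨ bernoulli T d ⟩
    suc T ^ suc d                             ∎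

  powerSum-≥ : ∀ d T → T ^ suc d ≤ suc d * sum< T (λ j → suc j ^ d)
  powerSum-≥ d zero    = z≤n
  powerSum-≥ d (suc T) = begin
    suc T ^ suc d                                               ≤⟨ bernoulli′ T d ⟩
    T ^ suc d + suc d * suc T ^ d                               ≤⟨ +-monoˡ-≤ _ (powerSum-≥ d T) ⟩
    suc d * sum< T (λ j → suc j ^ d) + suc d * suc T ^ d        ≡⟨ *-distribˡ-+ (suc d) _ (suc T ^ d) ⟨
    suc d * (sum< T (λ j → suc j ^ d) + suc T ^ d)              ∎

  powerSum-shift : ∀ d T → sum< T (λ j → suc j ^ d) ≤ sum< T (_^ d) + T ^ d
  powerSum-shift d zero    = z≤n
  powerSum-shift d (suc T) = +-monoˡ-≤ (suc T ^ d) (powerSum-shift d T)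

  ^-distribʳ-* : ∀ d a b → (a * b) ^ d ≡ a ^ d * b ^ d
  ^-distribʳ-* zero    a b = refl
  ^-distribʳ-* (suc d) a b = trans (cong (a * b *_) (^-distribʳ-* d a b)) (interchange a b (a ^ d) (b ^ d))
    where
    interchange : ∀ a b x y → a * b * (x * y) ≡ a * x * (b * y)
    interchange = solve-∀

  sum<-split : ∀ T m f → sum< (m + T) f ≡ sum< T f + sum< m (λ c → f (c + T))
  sum<-split T zero    f = sym (+-identityʳ _)
  sum<-split T (suc m) f = trans (cong (_+ f (m + T)) (sum<-split T m f)) (+-assoc (sum< T f) _ _)

  sum<-lt-* : ∀ T m f → sum< (m + T) (λ c → lt c T * f c) ≡ sum< T f
  sum<-lt-* T m f = trans (sum<-split T m _) (trans (cong₂ _+_ (inside T ≤-refl) outside) (+-identityʳ _))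
    where
    inside : ∀ K → K ≤ T → sum< K (λ c → lt c T * f c) ≡ sum< K f
    inside zero    _   = refl
    inside (suc K) K<T = cong₂ _+_ (inside K (<⇒≤ K<T))
      (trans (cong (_* f K) (lt≡1 K<T)) (*-identityˡ (f K)))
    outside : sum< m (λ c → lt (c + T) T * f (c + T)) ≡ 0
    outside = trans (sum<-cong m (λ c → cong (_* f (c + T)) (lt≡0 (m≤n+m T c))))
      (trans (sum<-const m 0) (*-zeroʳ m))

  sum<-lt : ∀ T m → sum< (m + T) (λ c → lt c T) ≡ T
  sum<-lt T m = trans (sum<-cong (m + T) (λ c → sym (*-identityʳ (lt c T))))
    (trans (sum<-lt-* T m (λ _ → 1)) (trans (sum<-const T 1) (*-identityʳ T)))

  ≤-sum< : ∀ K f {c} → c < K → f c ≤ sum< K f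
  ≤-sum< (suc K) f {c} c<1+K with m≤n⇒m<n∨m≡n c<1+K
  ... | inj₁ c<K  = ≤-trans (≤-sum< K f (s<s⁻¹ c<K)) (m≤m+n _ (f K))
  ... | inj₂ refl = m≤n+m (f K) _

-- The calibration with a uniform cut-off

module Truncated where
  open import Data.Nat.Base
  open import Data.Nat.Properties
  open import Data.Nat.Tactic.RingSolver using (solve-∀)
  open import Data.Product.Base using (_,_)
  open import Data.Sum.Base using (inj₁; inj₂)
  open import Relation.Binary.PropositionalEquality
  open import Relation.Nullary using (yes; no)
  open Sums
  open PowerSums
  open LocalBound

  -- As m → ∞, the condition strong below becomes a²(p+1)^(a+1) < U p a * V p d, a = d + 1.
  U V : ℕ → ℕ → ℕ
  U p a = a * (2 + p) + p
  V p d = suc d * p * suc p ^ d ∸ p ^ suc d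

  private
    -- All rounding errors, of relative order 1/m, are absorbed by the strictness of G < u v.
    absorb : ∀ {t s m u v α β G X Y} → α * v + β * u ≤ m → suc G ≤ u * v →
             t * (m * u) ≤ X + α * t → s * (m * v) ≤ Y + β * s →
             t * s * (m * m * G) ≤ X * Y
    absorb {t} {s} {m} {u} {v} {α} {β} {G} {X} {Y} m≥ gap hX hY = begin
      t * s * (m * m * G)          ≤⟨ *-monoʳ-≤ (t * s) core ⟩
      t * s * (u′ * v′)            ≡⟨ swap t s u′ v′ ⟩
      t * u′ * (s * v′)            ≤⟨ *-mono-≤ (lower t (m * u) α X hX) (lower s (m * v) β Y hY) ⟩
      X * Y                        ∎
      where
      open ≤-Reasoning
      u′ v′ : ℕ
      u′ = m * u ∸ α
      v′ = m * v ∸ β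
      swap : ∀ t s u v → t * s * (u * v) ≡ t * u * (s * v)
      swap = solve-∀
      lower : ∀ t a b X → t * a ≤ X + b * t → t * (a ∸ b) ≤ X
      lower t a b X h = ≤-trans (≤-reflexive (*-distribˡ-∸ t a b))
        (m≤n+o⇒m∸n≤o (t * a) (t * b) (≤-trans h (≤-reflexive (trans (+-comm X (b * t)) (cong (_+ X) (*-comm b t))))))
      1≤uv : 1 ≤ u * v
      1≤uv = ≤-trans (s≤s z≤n) gap
      left-pos : ∀ a b → 1 ≤ a * b → 1 ≤ a
      left-pos (suc _) _ _ = s≤s z≤n
      1≤u : 1 ≤ u
      1≤u = left-pos u v 1≤uv
      1≤v : 1 ≤ v
      1≤v = left-pos v u (subst (1 ≤_) (*-comm u v) 1≤uv)
      grow : ∀ a {b} → 1 ≤ b → a ≤ a * b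
      grow a 1≤b = ≤-trans (≤-reflexive (sym (*-identityʳ a))) (*-monoʳ-≤ a 1≤b)
      α≤ : α ≤ m * u
      α≤ = ≤-trans (≤-trans (grow α 1≤v) (≤-trans (m≤m+n _ _) m≥)) (grow m 1≤u)
      β≤ : β ≤ m * v
      β≤ = ≤-trans (≤-trans (grow β 1≤u) (≤-trans (m≤n+m _ _) m≥)) (grow m 1≤v)
      core : m * m * G ≤ u′ * v′
      core = +-cancelʳ-≤ (m * m) _ _ (begin
        m * m * G + m * m                       ≡⟨ a*g+a (m * m) G ⟩
        m * m * suc G                           ≤⟨ *-monoʳ-≤ (m * m) gap ⟩
        m * m * (u * v)                         ≤⟨ m≤m+n _ (α * β) ⟩
        m * m * (u * v) + α * β                 ≡⟨ rearr m u v (α * β) ⟩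
        m * u * (m * v) + α * β                 ≡⟨ cong₂ (λ x y → x * y + α * β) (m∸n+n≡m α≤) (m∸n+n≡m β≤) ⟨
        (u′ + α) * (v′ + β) + α * β             ≡⟨ expand u′ α v′ β ⟩
        u′ * v′ + (α * (v′ + β) + β * (u′ + α)) ≡⟨ cong₂ (λ x y → u′ * v′ + (α * y + β * x)) (m∸n+n≡m α≤) (m∸n+n≡m β≤) ⟩
        u′ * v′ + (α * (m * v) + β * (m * u))   ≡⟨ cong (u′ * v′ +_) (factor m α v β u) ⟩
        u′ * v′ + m * (α * v + β * u)           ≤⟨ +-monoʳ-≤ (u′ * v′) (*-monoʳ-≤ m m≥) ⟩
        u′ * v′ + m * m                         ∎)
        where
        a*g+a : ∀ a g → a * g + a ≡ a * suc g
        a*g+a = solve-∀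
        rearr : ∀ m u v r → m * m * (u * v) + r ≡ m * u * (m * v) + r
        rearr = solve-∀
        expand : ∀ u a v b → (u + a) * (v + b) + a * b ≡ u * v + (a * (v + b) + b * (u + a))
        expand = solve-∀
        factor : ∀ m a v b u → a * (m * v) + b * (m * u) ≡ m * (a * v + b * u)
        factor = solve-∀

  -- The uniform density on the initial segment of relative length p/(p+1).
  truncated : ∀ {P : ℕ → Set} p m → 1 ≤ p → 1 ≤ m →
    (∀ {d} → P d → suc (suc d * suc d * suc p ^ (2 + d)) ≤ U p (suc d) * V p d) →
    (∀ {d} → P d → suc d * V p d + suc d * p ^ d * U p (suc d) ≤ m) →
    Calibration P
  truncated {P} p m 1≤p 1≤m gap m≥ = record
    { L = L ; R = T ; k = k ; Q = T ⊓_
    ; 1≤L = ≤-trans 1≤m (m≤m+n m (p * m))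
    ; 1≤R = *-mono-≤ 1≤p 1≤m
    ; k≤ = λ d y → ≤-trans (*-monoˡ-≤ _ (lt≤1 y T)) (≤-reflexive (*-identityˡ _))
    ; cdf = λ {d} _ → cdf d
    ; strong = λ {d} → strong d
    }
    where
    open ≤-Reasoning
    T L : ℕ
    T = p * m
    L = m + T
    k : ℕ → ℕ → ℕ
    k d y = lt y T * (L ^ d ∸ suc y ^ d)

    -- On y < T both the density and the indicator of y < c decrease, so by Chebyshev's inequality
    -- the distribution function is at least min(c, T)/T, that of the uniform density on y < T,
    -- whatever `d` is.
    cdf : ∀ d c → c < L → sum< L (k d) * (T ⊓ c) ≤ sum< L (λ y → k d y * lt y c) * T
    cdf d c _ = begin
      sum< L (k d) * (T ⊓ c)
        ≡⟨ cong (sum< L (k d) *_) initial ⟨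
      sum< L (k d) * sum< L (λ y → lt y T * lt y c)
        ≤⟨ chebyshev L (λ y → lt y T) similarly ⟩
      sum< L (λ y → lt y T) * sum< L (λ y → lt y T * ((L ^ d ∸ suc y ^ d) * lt y c))
        ≡⟨ cong₂ _*_ (sum<-lt T m) (sum<-cong L (λ y → sym (*-assoc (lt y T) _ _))) ⟩
      T * sum< L (λ y → k d y * lt y c)
        ≡⟨ *-comm T _ ⟩
      sum< L (λ y → k d y * lt y c) * T ∎
      where
      similarly : SimilarlyOrdered (λ y → L ^ d ∸ suc y ^ d) (λ y → lt y c)
      similarly a b with ≤-total a b
      ... | inj₁ a≤b = inj₂ (∸-monoʳ-≤ (L ^ d) (^-monoˡ-≤ d (s≤s a≤b)) , lt-monoˡ c a≤b)
      ... | inj₂ b≤a = inj₁ (∸-monoʳ-≤ (L ^ d) (^-monoˡ-≤ d (s≤s b≤a)) , lt-monoˡ c b≤a)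
      prefix : ∀ K → sum< K (λ y → lt y c) ≡ K ⊓ c
      prefix zero    = refl
      prefix (suc K) with K <? c
      ... | yes K<c = trans (cong₂ _+_ (trans (prefix K) (m≤n⇒m⊓n≡m (<⇒≤ K<c))) (lt≡1 K<c))
                            (trans (+-comm K 1) (sym (m≤n⇒m⊓n≡m K<c)))
      ... | no K≮c  = trans (cong₂ _+_ (trans (prefix K) (m≥n⇒m⊓n≡n (≮⇒≥ K≮c))) (lt≡0 (≮⇒≥ K≮c)))
                            (trans (+-identityʳ c) (sym (m≥n⇒m⊓n≡n (m≤n⇒m≤1+n (≮⇒≥ K≮c)))))
      initial : sum< L (λ y → lt y T * lt y c) ≡ T ⊓ c
      initial = trans (sum<-lt-* T m (λ y → lt y c)) (prefix T)

    module _ (d : ℕ) where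
      a ρ S Tᵈ Lᵈ : ℕ
      a = suc d
      ρ = sum< L (k d)
      S = sum< L (λ c → (T ⊓ c) ^ d)
      Tᵈ = T ^ d
      Lᵈ = L ^ d

      S≡ : S ≡ sum< T (_^ d) + m * Tᵈ
      S≡ = trans (sum<-split T m _) (cong₂ _+_ (small T ≤-refl)
        (trans (sum<-cong m (λ c → cong (_^ d) (m≤n⇒m⊓n≡m (m≤n+m T c)))) (sum<-const m Tᵈ)))
        where
        small : ∀ K → K ≤ T → sum< K (λ c → (T ⊓ c) ^ d) ≡ sum< K (_^ d)
        small zero    _   = refl
        small (suc K) K<T = cong₂ _+_ (small K (<⇒≤ K<T)) (cong (_^ d) (m≥n⇒m⊓n≡n (<⇒≤ K<T)))

      -- Dividing by a L T^d and putting ε = 1/(p+1) turns `U p a` into 1 + ε + (1-ε)/a, the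
      -- limiting factor of an inside element; the last term is the error 1/L of the Riemann sum.
      X-bound : Tᵈ * (m * U p a) ≤ a * (L * Tᵈ + S) + a * Tᵈ
      X-bound = begin
        Tᵈ * (m * U p a)
          ≡⟨ expand Tᵈ m p a ⟩
        a * ((m + p * m) * Tᵈ) + a * (m * Tᵈ) + p * m * Tᵈ
          ≤⟨ +-monoʳ-≤ (a * ((m + p * m) * Tᵈ) + a * (m * Tᵈ)) (powerSum-≥ d T) ⟩
        a * (L * Tᵈ) + a * (m * Tᵈ) + a * sum< T (λ j → suc j ^ d)
          ≤⟨ +-monoʳ-≤ (a * (L * Tᵈ) + a * (m * Tᵈ)) (*-monoʳ-≤ a (powerSum-shift d T)) ⟩
        a * (L * Tᵈ) + a * (m * Tᵈ) + a * (sum< T (_^ d) + Tᵈ)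
          ≡⟨ collect a (L * Tᵈ) (m * Tᵈ) (sum< T (_^ d)) Tᵈ ⟩
        a * (L * Tᵈ + (sum< T (_^ d) + m * Tᵈ)) + a * Tᵈ
          ≡⟨ cong (λ s → a * (L * Tᵈ + s) + a * Tᵈ) S≡ ⟨
        a * (L * Tᵈ + S) + a * Tᵈ ∎
        where
        expand : ∀ t m p a → t * (m * (a * (2 + p) + p)) ≡ a * ((m + p * m) * t) + a * (m * t) + p * m * t
        expand = solve-∀
        collect : ∀ a x y z t → a * x + a * y + a * (z + t) ≡ a * (x + (z + y)) + a * t
        collect = solve-∀

      ρ-bound : a * (T * Lᵈ) ≤ a * ρ + (T ^ a + a * Tᵈ)
      ρ-bound = begin
        a * (T * Lᵈ)
          ≡⟨ cong (a *_) (sum<-const T Lᵈ) ⟨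
        a * sum< T (λ _ → Lᵈ)
          ≤⟨ *-monoʳ-≤ a (sum<-mono T (λ y _ → m≤n+m∸n Lᵈ (suc y ^ d))) ⟩
        a * sum< T (λ y → suc y ^ d + (Lᵈ ∸ suc y ^ d))
          ≡⟨ cong (a *_) (sum<-+ T _ _) ⟩
        a * (sum< T (λ y → suc y ^ d) + sum< T (λ y → Lᵈ ∸ suc y ^ d))
          ≡⟨ cong (λ r → a * (sum< T (λ y → suc y ^ d) + r)) (sum<-lt-* T m _) ⟨
        a * (sum< T (λ y → suc y ^ d) + ρ)
          ≤⟨ *-monoʳ-≤ a (+-monoˡ-≤ ρ (powerSum-shift d T)) ⟩
        a * (sum< T (_^ d) + Tᵈ + ρ)
          ≡⟨ expand a (sum< T (_^ d)) Tᵈ ρ ⟩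
        a * ρ + (a * sum< T (_^ d) + a * Tᵈ)
          ≤⟨ +-monoʳ-≤ (a * ρ) (+-monoˡ-≤ (a * Tᵈ) (powerSum-≤ d T)) ⟩
        a * ρ + (T ^ a + a * Tᵈ) ∎
        where
        expand : ∀ a s t r → a * (s + t + r) ≡ a * r + (a * s + a * t)
        expand = solve-∀

      -- Dividing by a L^a turns `V p d` into 1 - ε - (1-ε)^a/a, the limiting mass of the truncated
      -- density; the last term is again a rounding error of order 1/m.
      Y-bound : m ^ d * (m * V p d) ≤ a * ρ + a * p ^ d * m ^ d
      Y-bound = begin
        mᵈ * (m * (a * p * suc p ^ d ∸ p ^ a))
          ≡⟨ trans (cong (mᵈ *_) (*-distribˡ-∸ m _ _)) (*-distribˡ-∸ mᵈ _ _) ⟩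
        mᵈ * (m * (a * p * suc p ^ d)) ∸ mᵈ * (m * p ^ a)
          ≡⟨ cong₂ _∸_ main (cancelled mᵈ m (p ^ d) p) ⟩
        a * (T * Lᵈ) ∸ T * (p ^ d * mᵈ)
          ≤⟨ m≤n+o⇒m∸n≤o (a * (T * Lᵈ)) (T * (p ^ d * mᵈ)) rest ⟩
        a * ρ + a * p ^ d * mᵈ ∎
        where
        mᵈ : ℕ
        mᵈ = m ^ d
        main : mᵈ * (m * (a * p * suc p ^ d)) ≡ a * (T * Lᵈ)
        main = trans (shuffle mᵈ m a p (suc p ^ d))
          (cong (λ l → a * (T * l)) (sym (^-distribʳ-* d (suc p) m)))
          where
          shuffle : ∀ q m a p r → q * (m * (a * p * r)) ≡ a * (p * m * (r * q))
          shuffle = solve-∀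
        cancelled : ∀ q m r p → q * (m * (p * r)) ≡ p * m * (r * q)
        cancelled = solve-∀
        rest : a * (T * Lᵈ) ≤ T * (p ^ d * mᵈ) + (a * ρ + a * p ^ d * mᵈ)
        rest = begin
          a * (T * Lᵈ)                                      ≤⟨ ρ-bound ⟩
          a * ρ + (T * Tᵈ + a * Tᵈ)
            ≡⟨ cong (λ t → a * ρ + (T * t + a * t)) (^-distribʳ-* d p m) ⟩
          a * ρ + (T * (p ^ d * mᵈ) + a * (p ^ d * mᵈ))     ≡⟨ move (a * ρ) (T * (p ^ d * mᵈ)) a (p ^ d) mᵈ ⟩
          T * (p ^ d * mᵈ) + (a * ρ + a * p ^ d * mᵈ)       ∎
          where
          move : ∀ x y a r q → x + (y + a * (r * q)) ≡ y + (x + a * r * q)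
          move = solve-∀

      strong : P d → L ^ (2 + d) * Tᵈ ≤ (L * Tᵈ + S) * ρ
      strong Pd = *-cancelˡ-≤ (a * a) (begin
        a * a * (L * (L * Lᵈ) * Tᵈ)
          ≡⟨ cong (λ l → a * a * (L * (L * l) * Tᵈ)) (^-distribʳ-* d (suc p) m) ⟩
        a * a * (suc p * m * (suc p * m * (suc p ^ d * m ^ d)) * Tᵈ)
          ≡⟨ gather a p m (suc p ^ d) (m ^ d) Tᵈ ⟩
        Tᵈ * m ^ d * (m * m * (a * a * suc p ^ (2 + d)))
          ≤⟨ absorb {t = Tᵈ} {s = m ^ d} {u = U p a} {v = V p d} {α = a} {β = a * p ^ d}
               {X = a * (L * Tᵈ + S)} {Y = a * ρ} (m≥ Pd) (gap Pd) X-bound Y-bound ⟩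
        a * (L * Tᵈ + S) * (a * ρ)
          ≡⟨ regroup a (L * Tᵈ + S) ρ ⟩
        a * a * ((L * Tᵈ + S) * ρ) ∎)
        where
        gather : ∀ a p m r q t → a * a * (suc p * m * (suc p * m * (r * q)) * t) ≡
                                 t * q * (m * m * (a * a * (suc p * (suc p * r))))
        gather = solve-∀
        regroup : ∀ a x y → a * x * (a * y) ≡ a * a * (x * y)
        regroup = solve-∀

-- The case ℓ ≥ 5

module LongCircuits where
  open import Data.Nat.Base
  open import Data.Nat.Properties
  open import Data.Nat.Tactic.RingSolver using (solve-∀)
  open import Data.Product.Base using (_×_; _,_)
  open import Relation.Binary.PropositionalEquality
  open import Relation.Nullary using (yes; no)
  open Sums
  open PowerSums
  open LocalBound
  open Truncated
  open ≤-Reasoning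

  -- Here e stands for ℓ - 5, and side e for (ℓ - 2)² - 1.
  private
    side : ℕ → ℕ
    side e = 8 + 6 * e + e * e

  Admissible : ℕ → ℕ → Set
  Admissible e d = 4 + e ≤ d × suc d < side e * side e

  private
    -- The growth (1 + 1/p)^(pj) ≥ 2^j without division; `tail` needs it when a is close to p².
    doublings : ∀ p → 2 * p ^ p ≤ suc p ^ p → ∀ j → 2 ^ j * p ^ (p * j) ≤ suc p ^ (p * j)
    doublings p doubling zero    rewrite *-zeroʳ p = ≤-refl
    doublings p doubling (suc j)
      rewrite *-suc p j | ^-distribˡ-+-* p p (p * j) | ^-distribˡ-+-* (suc p) p (p * j) = begin
      2 * 2 ^ j * (p ^ p * p ^ (p * j))       ≡⟨ interchange 2 (2 ^ j) (p ^ p) _ ⟩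
      2 * p ^ p * (2 ^ j * p ^ (p * j))       ≤⟨ *-mono-≤ doubling (doublings p doubling j) ⟩
      suc p ^ p * suc p ^ (p * j)             ∎
      where
      interchange : ∀ a b c d → a * b * (c * d) ≡ a * c * (b * d)
      interchange = solve-∀

  -- With p = side e, the product (p² - a)(1 + 1/p)^a increases in a while p² - a > p + 1,
  -- so there its value at a = 5 + e bounds it; beyond a = p² - p, (1 + 1/p)^a does.
  module _ (e r : ℕ) (r≡ : r ≡ 7 + 6 * e + e * e) where
    private
      -- `C` over 5 + e is the value of (p+1) U(p,a)/a at a = 5 + e. That quotient decreases in a,
      -- so it is bounded by this constant throughout the admissible range.
      p C : ℕ
      p = suc r
      C = suc p * ((5 + e) * (2 + p) + p)

      -- Three terms of the binomial expansion of (p+1)^(5+e) suffice. With p^(3+e) cancelled, a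
      -- polynomial inequality in e remains; `b` is p² - (5+e) expanded, and `excess` is the
      -- remaining difference, with nonnegative coefficients.
      base : C * p ^ (5 + e) < (5 + e) * ((p * p ∸ (5 + e)) * suc p ^ (5 + e))
      base = *-cancelˡ-< 2 _ _ (begin-strict
        2 * (C * (p * (p * p ^ (3 + e))))
          ≡⟨ collect C p (p ^ (3 + e)) ⟩
        p ^ (3 + e) * (2 * (C * (p * p)))
          <⟨ *-monoʳ-< (p ^ (3 + e)) {{m^n≢0 p (3 + e)}} polynomial ⟩
        p ^ (3 + e) * ((5 + e) * (b * q))
          ≡⟨ out (p ^ (3 + e)) (5 + e) b q ⟩
        (5 + e) * b * (p ^ (3 + e) * q)
          ≤⟨ *-monoʳ-≤ ((5 + e) * b) (bernoulli₂ p (3 + e)) ⟩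
        (5 + e) * b * (2 * suc p ^ (5 + e))
          ≡⟨ cong (λ b → (5 + e) * b * (2 * suc p ^ (5 + e))) b≡ ⟨
        (5 + e) * (p * p ∸ (5 + e)) * (2 * suc p ^ (5 + e))
          ≡⟨ regroup (5 + e) (p * p ∸ (5 + e)) (suc p ^ (5 + e)) ⟩
        2 * ((5 + e) * ((p * p ∸ (5 + e)) * suc p ^ (5 + e))) ∎)
        where
        b q : ℕ
        b = 59 + 95 * e + 52 * (e * e) + 12 * (e * e * e) + e * e * e * e
        q = 2 * (p * p) + 2 * (5 + e) * p + (5 + e) * (4 + e)
        b≡ : p * p ∸ (5 + e) ≡ b
        b≡ = trans (cong (λ r → suc r * suc r ∸ (5 + e)) r≡)
          (trans (cong (_∸ (5 + e)) (square e)) (m+n∸m≡n (5 + e) b))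
          where
          square : ∀ e → (8 + 6 * e + e * e) * (8 + 6 * e + e * e) ≡
            (5 + e) + (59 + 95 * e + 52 * (e * e) + 12 * (e * e * e) + e * e * e * e)
          square = solve-∀
        collect : ∀ C p r → 2 * (C * (p * (p * r))) ≡ r * (2 * (C * (p * p)))
        collect = solve-∀
        out : ∀ r l b q → r * (l * (b * q)) ≡ l * b * (r * q)
        out = solve-∀
        regroup : ∀ l b r → l * b * (2 * r) ≡ 2 * (l * (b * r))
        regroup = solve-∀
        excess : ℕ
        excess = 443 + 5707 * e + 9155 * (e * e) + 6463 * (e * e * e) + 2471 * (e * e * e * e)
               + 535 * (e * e * e * e * e) + 62 * (e * e * e * e * e * e) + 3 * (e * e * e * e * e * e * e)
        polynomial : 2 * (C * (p * p)) < (5 + e) * (b * q)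
        polynomial = subst (λ r → 2 * ((2 + r) * ((5 + e) * (3 + r) + suc r) * (suc r * suc r)) <
              (5 + e) * (b * (2 * (suc r * suc r) + 2 * (5 + e) * suc r + (5 + e) * (4 + e)))) (sym r≡)
          (≤-trans (m≤m+n _ excess) (≤-reflexive (expand e)))
          where
          expand : ∀ e → suc (2 * ((9 + 6 * e + e * e) *
                      ((5 + e) * (10 + 6 * e + e * e) + (8 + 6 * e + e * e)) *
                      ((8 + 6 * e + e * e) * (8 + 6 * e + e * e))))
            + (443 + 5707 * e + 9155 * (e * e) + 6463 * (e * e * e) + 2471 * (e * e * e * e)
               + 535 * (e * e * e * e * e) + 62 * (e * e * e * e * e * e) + 3 * (e * e * e * e * e * e * e))
            ≡ (5 + e) * ((59 + 95 * e + 52 * (e * e) + 12 * (e * e * e) + e * e * e * e) *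
              (2 * ((8 + 6 * e + e * e) * (8 + 6 * e + e * e)) + 2 * (5 + e) * (8 + 6 * e + e * e)
                + (5 + e) * (4 + e)))
          expand = solve-∀

      rising : ∀ i → 5 + e + i + p ≤ p * p →
        C * p ^ (5 + e + i) < (5 + e) * ((p * p ∸ (5 + e + i)) * suc p ^ (5 + e + i))
      rising zero    _ = subst
        (λ a → C * p ^ a < (5 + e) * ((p * p ∸ a) * suc p ^ a)) (sym (+-identityʳ (5 + e))) base
      rising (suc i) h rewrite +-suc e i = begin-strict
        C * (p * p ^ a)                                   ≡⟨ swap C p (p ^ a) ⟩
        p * (C * p ^ a)                                   <⟨ *-monoʳ-< p (rising i (≤-trans (n≤1+n _) h)) ⟩
        p * ((5 + e) * ((p * p ∸ a) * suc p ^ a))         ≡⟨ cong (λ b → p * ((5 + e) * (b * suc p ^ a))) b≡ ⟩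
        p * ((5 + e) * (suc b * suc p ^ a))               ≡⟨ regroup p (5 + e) (suc b) (suc p ^ a) ⟩
        (5 + e) * (suc b * p * suc p ^ a)                 ≤⟨ *-monoʳ-≤ (5 + e) (*-monoˡ-≤ (suc p ^ a) step) ⟩
        (5 + e) * (b * suc p * suc p ^ a)                 ≡⟨ cong ((5 + e) *_) (*-assoc b (suc p) _) ⟩
        (5 + e) * (b * (suc p * suc p ^ a))               ∎
        where
        a b : ℕ
        a = 5 + e + i
        b = p * p ∸ suc a
        b≡ : p * p ∸ a ≡ suc b
        b≡ = +-∸-assoc 1 (≤-trans (m≤m+n (suc a) p) h)
        p≤b : p ≤ b
        p≤b = m+n≤o⇒m≤o∸n p (≤-trans (≤-reflexive (+-comm p (suc a))) h)
        step : suc b * p ≤ b * suc p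
        step = ≤-trans (+-monoˡ-≤ (b * p) p≤b) (≤-reflexive (sym (*-suc b p)))
        swap : ∀ C p r → C * (p * r) ≡ p * (C * r)
        swap = solve-∀
        regroup : ∀ p l b r → p * (l * (b * r)) ≡ l * (b * p * r)
        regroup = solve-∀

      doubling : 2 * p ^ p ≤ suc p ^ p
      doubling = ≤-trans (≤-reflexive (cong (p ^ p +_) (+-identityʳ (p ^ p)))) (bernoulli p r)

      -- An elementary comparison with an exponential, from which `ceiling<` gets its bound on `C`.
      quartic : ∀ e → (3 + e) * (3 + e) * (3 + e) * (4 + e) < 128 * 4 ^ e
      -- The two sides are 108 and 128, and 109 + 19 = 128.
      quartic zero    = m≤m+n 109 19
      quartic (suc e) = begin-strict
        (4 + e) * (4 + e) * (4 + e) * (5 + e)           ≤⟨ m≤m+n _ excess ⟩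
        (4 + e) * (4 + e) * (4 + e) * (5 + e) + excess  ≡⟨ expand e ⟩
        4 * ((3 + e) * (3 + e) * (3 + e) * (4 + e))     <⟨ *-monoʳ-< 4 (quartic e) ⟩
        4 * (128 * 4 ^ e)                               ≡⟨ swap 4 128 (4 ^ e) ⟩
        128 * (4 * 4 ^ e)                               ∎
        where
        excess : ℕ
        excess = 112 + 236 * e + 144 * (e * e) + 35 * (e * e * e) + 3 * (e * e * e * e)
        expand : ∀ e → (4 + e) * (4 + e) * (4 + e) * (5 + e) +
          (112 + 236 * e + 144 * (e * e) + 35 * (e * e * e) + 3 * (e * e * e * e)) ≡
          4 * ((3 + e) * (3 + e) * (3 + e) * (4 + e))
        expand = solve-∀
        swap : ∀ a b r → a * (b * r) ≡ b * (a * r)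
        swap = solve-∀

      -- A polynomial of degree 5 in e against an exponential: `C` is below (5+e)(3+e)³(4+e), and
      -- 128 times 4^e is 2^(7+2e), whose exponent is at most r.
      ceiling< : C < (5 + e) * 2 ^ r
      ceiling< = subst (λ r → (2 + r) * ((5 + e) * (3 + r) + suc r) < (5 + e) * 2 ^ r) (sym r≡) (begin-strict
        C′                                                   ≤⟨ m≤m+n _ (18 + 21 * e + 8 * (e * e) + e * e * e) ⟩
        C′ + (18 + 21 * e + 8 * (e * e) + e * e * e)         ≡⟨ expand e ⟩
        (5 + e) * ((3 + e) * (3 + e) * (3 + e) * (4 + e))    <⟨ *-monoʳ-< (5 + e) (quartic e) ⟩
        (5 + e) * (128 * 4 ^ e)                             ≡⟨ cong (λ r → (5 + e) * (128 * r)) (^-*-assoc 2 2 e) ⟩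
        (5 + e) * (128 * 2 ^ (2 * e))                        ≡⟨ cong ((5 + e) *_) (^-distribˡ-+-* 2 7 (2 * e)) ⟨
        (5 + e) * 2 ^ (7 + 2 * e)                            ≤⟨ *-monoʳ-≤ (5 + e) (^-monoʳ-≤ 2
          (≤-trans (+-monoʳ-≤ 7 (*-monoˡ-≤ e (m≤m+n 2 4))) (m≤m+n (7 + 6 * e) (e * e)))) ⟩
        (5 + e) * 2 ^ (7 + 6 * e + e * e)                    ∎)
        where
        C′ : ℕ
        C′ = (9 + 6 * e + e * e) * ((5 + e) * (10 + 6 * e + e * e) + (8 + 6 * e + e * e))
        expand : ∀ e → (9 + 6 * e + e * e) * ((5 + e) * (10 + 6 * e + e * e) + (8 + 6 * e + e * e)) +
          (18 + 21 * e + 8 * (e * e) + e * e * e) ≡ (5 + e) * ((3 + e) * (3 + e) * (3 + e) * (4 + e))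
        expand = solve-∀

      -- Here a exceeds p² - p = p r, so (1 + 1/p)^a is at least 2^r, which already beats `C` over 5
      -- + e; from p² - a only positivity is used.
      tail : ∀ a → p * p < a + p → a < p * p →
        C * p ^ a < (5 + e) * ((p * p ∸ a) * suc p ^ a)
      tail a large a<p² = begin-strict
        C * p ^ a
          <⟨ *-monoˡ-< (p ^ a) {{m^n≢0 p a}} ceiling< ⟩
        (5 + e) * 2 ^ r * p ^ a
          ≡⟨ cong (λ a → (5 + e) * 2 ^ r * p ^ a) a≡ ⟩
        (5 + e) * 2 ^ r * p ^ (p * r + s)
          ≡⟨ cong ((5 + e) * 2 ^ r *_) (^-distribˡ-+-* p (p * r) s) ⟩
        (5 + e) * 2 ^ r * (p ^ (p * r) * p ^ s)
          ≡⟨ regroup (5 + e) (2 ^ r) (p ^ (p * r)) (p ^ s) ⟩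
        (5 + e) * (2 ^ r * p ^ (p * r) * p ^ s)
          ≤⟨ *-monoʳ-≤ (5 + e) (*-mono-≤ (doublings p doubling r) (^-monoˡ-≤ s (n≤1+n p))) ⟩
        (5 + e) * (suc p ^ (p * r) * suc p ^ s)
          ≡⟨ cong ((5 + e) *_) (^-distribˡ-+-* (suc p) (p * r) s) ⟨
        (5 + e) * suc p ^ (p * r + s)
          ≡⟨ cong (λ a → (5 + e) * suc p ^ a) a≡ ⟨
        (5 + e) * suc p ^ a
          ≤⟨ *-monoʳ-≤ (5 + e) (m≤n*m (suc p ^ a) (p * p ∸ a) {{>-nonZero (m<n⇒0<n∸m a<p²)}}) ⟩
        (5 + e) * ((p * p ∸ a) * suc p ^ a) ∎
        where
        s : ℕ
        s = a ∸ p * r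
        a≡ : a ≡ p * r + s
        a≡ = sym (m+[n∸m]≡n (+-cancelˡ-≤ p _ _
          (≤-trans (≤-reflexive (sym (*-suc p r))) (≤-trans (<⇒≤ large) (≤-reflexive (+-comm a p))))))
        regroup : ∀ l t x y → l * t * (x * y) ≡ l * (t * x * y)
        regroup = solve-∀

      key : ∀ a → 5 + e ≤ a → a < p * p →
        C * p ^ a < (5 + e) * ((p * p ∸ a) * suc p ^ a)
      key a 5+e≤a a<p² with a + p ≤? p * p
      ... | no  h = tail a (≰⇒> h) a<p²
      ... | yes h = subst (λ a → C * p ^ a < (5 + e) * ((p * p ∸ a) * suc p ^ a)) a≡
                      (rising (a ∸ (5 + e)) (subst (λ a → a + p ≤ p * p) (sym a≡) h))
        where
        a≡ : 5 + e + (a ∸ (5 + e)) ≡ a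
        a≡ = m+[n∸m]≡n 5+e≤a

      -- Since U p - a (p+1)² = p² - a, the claim reduces to U p^a < a (p² - a) (p+1)^d. This is
      -- where the upper bound on the circuit lengths enters: p² - a has to be positive.
      gap : ∀ {d} → 4 + e ≤ d × suc d < p * p → suc (suc d * suc d * suc p ^ (2 + d)) ≤ U p (suc d) * V p d
      gap {d} (4+e≤d , a<p²) = +-cancelʳ-≤ (U p a * p ^ a) _ _ (begin
        suc (a * a * suc p ^ (2 + d)) + U p a * p ^ a
          ≡⟨ +-suc (a * a * suc p ^ (2 + d)) (U p a * p ^ a) ⟨
        a * a * suc p ^ (2 + d) + suc (U p a * p ^ a)
          ≤⟨ +-monoʳ-≤ (a * a * suc p ^ (2 + d)) reduced ⟩
        a * a * suc p ^ (2 + d) + a * (b * suc p ^ d)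
          ≡⟨ factor a p b (suc p ^ d) ⟩
        (a * (1 + 2 * p) + a * (p * p) + b) * (a * suc p ^ d)
          ≡⟨ cong (_* (a * suc p ^ d)) U*p ⟩
        U p a * p * (a * suc p ^ d)
          ≡⟨ regroup (U p a) p a (suc p ^ d) ⟩
        U p a * (a * p * suc p ^ d)
          ≤⟨ *-monoʳ-≤ (U p a) (m≤n+m∸n (a * p * suc p ^ d) (p ^ a)) ⟩
        U p a * (p ^ a + V p d)
          ≡⟨ spread (U p a) (p ^ a) (V p d) ⟩
        U p a * V p d + U p a * p ^ a ∎)
        where
        a b : ℕ
        a = suc d
        b = p * p ∸ a
        U*p : a * (1 + 2 * p) + a * (p * p) + b ≡ U p a * p
        U*p = trans (split a p b) (trans (cong (a * (2 * p) + a * (p * p) +_) (m+[n∸m]≡n (<⇒≤ a<p²)))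
          (collect a p))
          where
          split : ∀ a p b → a * (1 + 2 * p) + a * (p * p) + b ≡ a * (2 * p) + a * (p * p) + (a + b)
          split = solve-∀
          collect : ∀ a p → a * (2 * p) + a * (p * p) + p * p ≡ (a * (2 + p) + p) * p
          collect = solve-∀
        factor : ∀ a p b r → a * a * (suc p * (suc p * r)) + a * (b * r) ≡
                             (a * (1 + 2 * p) + a * (p * p) + b) * (a * r)
        factor = solve-∀
        regroup : ∀ u p a r → u * p * (a * r) ≡ u * (a * p * r)
        regroup = solve-∀
        spread : ∀ u x v → u * (x + v) ≡ u * v + u * x
        spread = solve-∀
        reduced : U p a * p ^ a < a * (b * suc p ^ d)
        reduced = *-cancelˡ-< ((5 + e) * suc p) _ _ (begin-strict
          (5 + e) * suc p * (U p a * p ^ a)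
            ≡⟨ expandˡ (5 + e) p a (p ^ a) ⟩
          suc p * (a * ((5 + e) * (2 + p)) + (5 + e) * p) * p ^ a
            ≤⟨ *-monoˡ-≤ (p ^ a) (*-monoʳ-≤ (suc p) (+-monoʳ-≤ (a * ((5 + e) * (2 + p)))
                 (*-monoˡ-≤ p (s≤s 4+e≤d)))) ⟩
          suc p * (a * ((5 + e) * (2 + p)) + a * p) * p ^ a
            ≡⟨ expandʳ (5 + e) p a (p ^ a) ⟩
          a * (C * p ^ a)
            <⟨ *-monoʳ-< a (key a (s≤s 4+e≤d) a<p²) ⟩
          a * ((5 + e) * (b * (suc p * suc p ^ d)))
            ≡⟨ pull a (5 + e) b (suc p) (suc p ^ d) ⟩
          (5 + e) * suc p * (a * (b * suc p ^ d)) ∎)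
          where
          expandˡ : ∀ l p a r → l * suc p * ((a * (2 + p) + p) * r) ≡ suc p * (a * (l * (2 + p)) + l * p) * r
          expandˡ = solve-∀
          expandʳ : ∀ l p a r → suc p * (a * (l * (2 + p)) + a * p) * r ≡ a * (suc p * (l * (2 + p) + p) * r)
          expandʳ = solve-∀
          pull : ∀ a l b q r → a * (l * (b * (q * r))) ≡ l * q * (a * (b * r))
          pull = solve-∀

    calibrated : Calibration (λ d → 4 + e ≤ d × suc d < p * p)
    -- Only finitely many degrees are admissible, so the sum of all their rounding errors is a
    -- common lower bound to impose on m; the successor keeps m positive.
    calibrated = truncated p (suc (sum< (p * p) error)) (s≤s z≤n) (s≤s z≤n) gap
      (λ (_ , 1+d<p²) → ≤-trans (≤-sum< (p * p) error (<-trans (n<1+n _) 1+d<p²)) (n≤1+n _))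
      where
      error : ℕ → ℕ
      error d = suc d * V p d + suc d * p ^ d * U p (suc d)

  calibration : ∀ e → Calibration (Admissible e)
  calibration e = calibrated e (7 + 6 * e + e * e) refl

-- Calibrations verified by evaluation

module Tabulated where
  open import Data.Bool.Base using (Bool; true; false; _∧_; if_then_else_; T)
  open import Data.List.Base using (List; []; _∷_)
  open import Data.List.Membership.Propositional using (_∈_)
  open import Data.List.Relation.Unary.Any using (here; there)
  open import Data.Nat.Base
  open import Data.Nat.Properties
  open import Data.Product.Base using (_×_; _,_; proj₁; proj₂)
  open import Data.Sum.Base using (inj₁; inj₂)
  open import Relation.Binary.PropositionalEquality
  open Sums
  open PowerSums
  open LocalBound

  private
    ∧⁻ : ∀ a {b} → T (a ∧ b) → T a × T b
    ∧⁻ true h = _ , h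

    below : ℕ → (ℕ → Bool) → Bool
    below zero    b = true
    below (suc K) b = b K ∧ below K b

    below-sound : ∀ K {b} → T (below K b) → ∀ c → c < K → T (b c)
    below-sound (suc K) {b} h c c<1+K with ∧⁻ (b K) h | m≤n⇒m<n∨m≡n c<1+K
    ... | _ , hs | inj₁ c<K  = below-sound K hs c (s<s⁻¹ c<K)
    ... | hK , _ | inj₂ refl = hK

    every : List ℕ → (ℕ → Bool) → Bool
    every []       b = true
    every (d ∷ ds) b = b d ∧ every ds b

    every-sound : ∀ {ds b} → T (every ds b) → ∀ {d} → d ∈ ds → T (b d)
    every-sound {d ∷ ds} {b} h (here refl) = proj₁ (∧⁻ (b d) h)
    every-sound {d ∷ ds} {b} h (there d∈)  = every-sound {ds} (proj₂ (∧⁻ (b d) h)) d∈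

  -- Degree d gets the density 1 - ((y+1)/L)ᵈ on y < cut d; the distribution
  -- function of degree d₀ is required to be the smallest one.
  module _ (L : ℕ) (cut : ℕ → ℕ) (d₀ : ℕ) (ds : List ℕ) where

    density : ℕ → ℕ → ℕ
    density d y = if y <ᵇ cut d then L ^ d ∸ suc y ^ d else 0

    distribution : ℕ → ℕ → ℕ
    distribution d c = sum< c (density d)

    cdfCheck : ℕ → ℕ → ℕ → Bool
    cdfCheck d ρ R = below L (λ c → ρ * distribution d₀ c ≤ᵇ distribution d c * R)

    strongCheck : ℕ → ℕ → ℕ → Bool
    strongCheck d ρ R = L ^ (2 + d) * R ^ d ≤ᵇ (L * R ^ d + sum< L (λ c → distribution d₀ c ^ d)) * ρ

    check : ℕ → Bool
    check R = every ds (λ d → cdfCheck d (distribution d L) R ∧ strongCheck d (distribution d L) R)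

    tabulated : 1 ≤ L → 1 ≤ distribution d₀ L → T (check (distribution d₀ L)) →
                Calibration (_∈ ds)
    tabulated 1≤L 1≤R h = record
      { L = L ; R = R ; k = density ; Q = distribution d₀
      ; 1≤L = 1≤L
      ; 1≤R = 1≤R
      ; k≤ = λ d y → bound d y (y <ᵇ cut d)
      ; cdf = λ {d} d∈ c c<L → subst (λ N → distribution d L * distribution d₀ c ≤ N * R)
          (sym (initial d c c<L))
          (≤ᵇ⇒≤ _ _ (below-sound L (proj₁ (checked d d∈)) c c<L))
      ; strong = λ {d} d∈ → ≤ᵇ⇒≤ _ _ (proj₂ (checked d d∈))
      }
      where
      R : ℕ
      R = distribution d₀ L
      checked : ∀ d → d ∈ ds → T (cdfCheck d (distribution d L) R) × T (strongCheck d (distribution d L) R)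
      checked d d∈ = ∧⁻ (cdfCheck d (distribution d L) R) (every-sound {ds} h d∈)
      bound : ∀ d y b → (if b then L ^ d ∸ suc y ^ d else 0) ≤ L ^ d ∸ suc y ^ d
      bound d y true  = ≤-refl
      bound d y false = z≤n
      initial : ∀ d c → c < L → sum< L (λ y → density d y * lt y c) ≡ distribution d c
      initial d c c<L = subst (λ L′ → sum< L′ (λ y → density d y * lt y c) ≡ distribution d c)
        (m∸n+n≡m (<⇒≤ c<L))
        (trans (sum<-cong (L ∸ c + c) (λ y → *-comm (density d y) (lt y c)))
               (sum<-lt-* c (L ∸ c) (density d)))

-- The case ℓ = 4

module ShortCircuits where
  open import Data.List.Base using (List; []; _∷_)
  open import Data.List.Membership.Propositional using (_∈_)
  open import Data.Nat.Base using (ℕ; s≤s; z≤n)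
  open import Data.Nat.Properties using (≤ᵇ⇒≤)
  open import Data.Unit.Base using (tt)
  open LocalBound
  open Tabulated

  shortDegrees : List ℕ
  shortDegrees = 3 ∷ 4 ∷ 5 ∷ 6 ∷ 7 ∷ []

  -- A higher degree has a flatter density, whose distribution function is smaller for the same
  -- cut-off. Degrees 6 and 7 are therefore cut off lower, so that degree 5 still has the smallest
  -- distribution function.
  cut : ℕ → ℕ
  cut 3 = 96
  cut 4 = 94
  cut 5 = 96
  cut 6 = 88
  cut _ = 86

  calibration : Calibration (_∈ shortDegrees)
  -- The first `tt` evaluates the positivity of the total mass; the second evaluates, for each of
  -- the five degrees, 100 comparisons of distribution functions and one instance of `strong`.
  calibration = tabulated 100 cut 5 shortDegrees (s≤s z≤n) (≤ᵇ⇒≤ 1 _ tt) tt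

-- From activities to local factors

module Expansion where
  open import Data.Bool.Base using (true; false; not; if_then_else_)
  open import Data.Fin.Base using (Fin; zero; suc)
  open import Data.Fin.Properties using () renaming (_≟_ to _≟ᶠ_)
  open import Data.Fin.Subset
  open import Data.Fin.Subset.Properties
  open import Data.Integer.Base as ℤ using (ℤ; +_)
  import Data.Integer.Properties as ℤ
  open import Data.List.Base using (List; []; _∷_; map; allFin; tabulate)
  open import Data.List.Properties using (map-tabulate)
  open import Data.List.Membership.Propositional as List using ()
  open import Data.List.Membership.Propositional.Properties using (∈-allFin)
  open import Data.List.Relation.Binary.Permutation.Propositional using (_↭_; ↭-sym; ↭⇒↭ₛ)
  open import Data.List.Relation.Binary.Permutation.Propositional.Properties using (∈-resp-↭; map⁺)
  import Data.List.Relation.Binary.Permutation.Setoid.Properties as Permₛ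
  open import Data.List.Relation.Unary.All as All using (All)
  open import Data.List.Relation.Unary.AllPairs using (AllPairs; []; _∷_)
  open import Data.List.Relation.Unary.Any as Any using (Any; here; there)
  import Data.List.Relation.Unary.Sorted.TotalOrder.Properties as Sorted
  open import Data.List.Relation.Unary.Unique.Propositional.Properties using (allFin⁺)
  open import Data.List.Sort using (sort; sort-↭; sort-↗)
  open import Data.Nat.Base
  open import Data.Nat.ListAction using (sum; product)
  open import Data.Nat.ListAction.Properties using (product-↭)
  open import Data.Nat.Properties
  open import Data.Product.Base using (_,_; proj₁; proj₂)
  open import Data.Sum.Base using (_⊎_; inj₁; inj₂)
  open import Data.Vec.Base using (Vec; lookup)
  open import Data.Vec.Properties using ([]=⇒lookup; lookup⇒[]=; lookup-map)
  open import Function.Base using (_∘_)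
  open import Relation.Binary.Bundles using (DecTotalOrder)
  import Relation.Binary.Construct.On as On
  open import Relation.Binary.PropositionalEquality
  open import Relation.Nullary using (does; yes; no; contradiction)
  open import Relation.Nullary.Decidable using (dec-false)
  open Sums
  open Products
  open Configurations
  open LocalBound
  open ExchangeGraph
  open Activities

  private
    variable
      n : ℕ

  module _ (x : Vec ℕ n) where
    order : DecTotalOrder _ _ _
    order = On.decTotalOrder ≤-decTotalOrder (lookup x)

    sorted : List (Fin n)
    sorted = sort order (allFin n)

    sorted-↭ : sorted ↭ allFin n
    sorted-↭ = sort-↭ order (allFin n)

    sorted-pairs : AllPairs (λ i j → lookup x i ≤ lookup x j) sorted
    sorted-pairs = Sorted.Sorted⇒AllPairs (DecTotalOrder.totalOrder order) (sort-↗ order (allFin n))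

  module _ (M : Matroid n) where
    open Matroid M

    sum-pos : ∀ {A : Set} (f : A → ℕ) xs → sumℤ (map (λ a → + f a) xs) ≡ + sum (map f xs)
    sum-pos f []       = refl
    sum-pos f (a ∷ xs) = cong (λ s → + f a ℤ.+ s) (sum-pos f xs)

    tutte-activities : ∀ a b {es} → es ↭ allFin n →
      tutte M (+ a) (+ b) ≡ + sum (map (basisWeight M a b es) (allSubsets n))
    tutte-activities a b {es} p = begin
      tutte M (+ a) (+ b)
        ≡⟨ intervalSum-allFin {n} _ ⟨
      intervalSum (allFin n) ⊥ _
        ≡⟨ intervalSum-↭ p ⊥ _ ⟨
      intervalSum es ⊥ _
        ≡⟨ activityExpansion M a b es ⊥ (All.universal (λ _ → ∉⊥) es) unique
             (proj₁ nonempty , proj₂ nonempty , ⊆-min _ , λ {z} _ →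
               x∈p∪q⁺ (inj₂ (∈-elems⁺ (∈-resp-↭ (↭-sym p) (∈-allFin z))))) ⟩
      intervalSum es ⊥ (λ B → + basisWeight M a b es B)
        ≡⟨ intervalSum-↭ p ⊥ _ ⟩
      intervalSum (allFin n) ⊥ (λ B → + basisWeight M a b es B)
        ≡⟨ intervalSum-allFin {n} _ ⟩
      sumℤ (map (λ B → + basisWeight M a b es B) (allSubsets n))
        ≡⟨ sum-pos (basisWeight M a b es) (allSubsets n) ⟩
      + sum (map (basisWeight M a b es) (allSubsets n)) ∎
      where
      open ≡-Reasoning
      unique = Permₛ.Unique-resp-↭ (setoid (Fin n)) (↭⇒↭ₛ (↭-sym p)) (allFin⁺ n)

    -- The common form of factor 2 0, with A = B, and of factor 0 2, with A = ∁ B.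
    factorOf : Subset n → Subset n → Fin n → List (Fin n) → ℕ
    factorOf A B e later =
      if does (Any.any? (adj? M B e) later) then 1 else (if lookup A e then 2 else 0)

    private
      ∏∈-lt≤1 : ∀ (S : Subset n) (a b : Fin n → ℕ) → ∏∈ S (λ j → lt (a j) (b j)) ≤ 1
      ∏∈-lt≤1 S a b = ≤-trans (∏-mono (λ j → branch j (lookup S j)))
        (≤-reflexive (trans (∏-const {n} 1) (^-zeroˡ n)))
        where
        branch : ∀ j s → (if s then lt (a j) (b j) else 1) ≤ 1
        branch j true  = lt≤1 (a j) (b j)
        branch j false = ≤-refl

      ∏-zero : ∀ {m} (f : Fin m → ℕ) i → f i ≡ 0 → ∏ f ≡ 0
      ∏-zero f zero    eq = cong (_* ∏ (f ∘ suc)) eq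
      ∏-zero f (suc i) eq = trans (cong (f zero *_) (∏-zero (f ∘ suc) i eq)) (*-zeroʳ (f zero))

    -- If a neighbour comes later, its coordinate is at least that of `e`, so the strict comparison
    -- fails and an inside factor is 1. If none does, no neighbour has a larger coordinate, so an
    -- outside factor is 0. Strict comparison inside and weak comparison outside thus give a lower
    -- bound however the sorting breaks ties.
    localFactor≤ : ∀ A B x e later → All (λ j → lookup x e ≤ lookup x j) later →
      (∀ j → j List.∈ later ⊎ lookup x j ≤ lookup x e) →
      localFactor A (nbr M B) x e ≤ factorOf A B e later
    localFactor≤ A B x e later after split with Any.any? (adj? M B e) later
    ... | yes active with List.find active
    ...   | j , j∈ , adj = branch (lookup A e)
      where
      j∈nbr : lookup (nbr M B e) j ≡ true
      j∈nbr = []=⇒lookup (∈-nbr⁺ M adj)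
      branch : ∀ a → (if a then 1 + ∏∈ (nbr M B e) (λ j → lt (lookup x j) (lookup x e))
                           else 1 ∸ ∏∈ (nbr M B e) (λ j → lt (lookup x j) (suc (lookup x e)))) ≤ 1
      branch true  = ≤-reflexive (cong suc (∏-zero
        (λ j → if lookup (nbr M B e) j then lt (lookup x j) (lookup x e) else 1) j
        (trans (cong (if_then lt (lookup x j) (lookup x e) else 1) j∈nbr)
               (lt≡0 (All.lookup after j∈)))))
      branch false = m∸n≤m 1 (∏∈ (nbr M B e) (λ j → lt (lookup x j) (suc (lookup x e))))
    localFactor≤ A B x e later after split | no ¬active = branch (lookup A e)
      where
      branch : ∀ a → (if a then 1 + ∏∈ (nbr M B e) (λ j → lt (lookup x j) (lookup x e))
                           else 1 ∸ ∏∈ (nbr M B e) (λ j → lt (lookup x j) (suc (lookup x e)))) ≤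
                     (if a then 2 else 0)
      branch true  = s≤s (∏∈-lt≤1 (nbr M B e) (lookup x) (λ _ → lookup x e))
      branch false = ≤-reflexive (m≤n⇒m∸n≡0 (∏-pos {n} (λ j → one≤ j (lookup (nbr M B e) j) refl)))
        where
        one≤ : ∀ j s → lookup (nbr M B e) j ≡ s →
               1 ≤ (if s then lt (lookup x j) (suc (lookup x e)) else 1)
        one≤ j false _  = ≤-refl
        one≤ j true  eq with split j
        ... | inj₁ j∈  = contradiction (List.lose j∈ (∈-nbr⁻ M (lookup⇒[]= j _ eq))) ¬active
        ... | inj₂ j≤e = ≤-reflexive (sym (lt≡1 (s≤s j≤e)))

    weightOf : Subset n → Subset n → List (Fin n) → ℕ
    weightOf A B []       = 1
    weightOf A B (e ∷ es) = factorOf A B e es * weightOf A B es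

    -- The second hypothesis is the invariant of the induction: an element absent from the remaining
    -- list has already been passed, so its coordinate is at most all remaining ones.
    product≤weightOf : ∀ A B x es → AllPairs (λ i j → lookup x i ≤ lookup x j) es →
      (∀ j → j List.∈ es ⊎ All (λ f → lookup x j ≤ lookup x f) es) →
      product (map (localFactor A (nbr M B) x) es) ≤ weightOf A B es
    product≤weightOf A B x []       _               _     = ≤-refl
    product≤weightOf A B x (e ∷ es) (e≤ ∷ es-pairs) split = *-mono-≤
      (localFactor≤ A B x e es e≤ λ j → here′ j (split j))
      (product≤weightOf A B x es es-pairs λ j → there′ j (split j))
      where
      here′ : ∀ j → j List.∈ e ∷ es ⊎ All (λ f → lookup x j ≤ lookup x f) (e ∷ es) →
              j List.∈ es ⊎ lookup x j ≤ lookup x e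
      here′ j (inj₁ (here refl)) = inj₂ ≤-refl
      here′ j (inj₁ (there j∈))  = inj₁ j∈
      here′ j (inj₂ j≤)          = inj₂ (All.head j≤)
      there′ : ∀ j → j List.∈ e ∷ es ⊎ All (λ f → lookup x j ≤ lookup x f) (e ∷ es) →
               j List.∈ es ⊎ All (λ f → lookup x j ≤ lookup x f) es
      there′ j (inj₁ (here refl)) = inj₂ e≤
      there′ j (inj₁ (there j∈))  = inj₁ j∈
      there′ j (inj₂ j≤)          = inj₂ (All.tail j≤)

    product-allFin : ∀ {m} (f : Fin m → ℕ) → product (map f (allFin m)) ≡ ∏ f
    product-allFin {m} f = trans (cong product (map-tabulate (λ i → i) f)) (go f)
      where
      go : ∀ {m} (f : Fin m → ℕ) → product (tabulate f) ≡ ∏ f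
      go {zero}  f = refl
      go {suc m} f = cong (f zero *_) (go (f ∘ suc))

    ∏localFactor≤ : ∀ A B x → ∏ (localFactor A (nbr M B) x) ≤ weightOf A B (sorted x)
    ∏localFactor≤ A B x = begin
      ∏ (localFactor A (nbr M B) x)
        ≡⟨ product-allFin (localFactor A (nbr M B) x) ⟨
      product (map (localFactor A (nbr M B) x) (allFin n))
        ≡⟨ product-↭ (map⁺ (localFactor A (nbr M B) x) (sorted-↭ x)) ⟨
      product (map (localFactor A (nbr M B) x) (sorted x))
        ≤⟨ product≤weightOf A B x (sorted x) (sorted-pairs x)
             (λ j → inj₁ (∈-resp-↭ (↭-sym (sorted-↭ x)) (∈-allFin j))) ⟩
      weightOf A B (sorted x) ∎
      where open ≤-Reasoning

    private
      does-∈? : ∀ (B : Subset n) e → does (e ∈? B) ≡ lookup B e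
      does-∈? B e with e ∈? B | lookup B e in eq
      ... | yes _   | true  = refl
      ... | yes e∈B | false = trans (sym ([]=⇒lookup e∈B)) eq
      ... | no e∉B  | true  = contradiction (lookup⇒[]= e B eq) e∉B
      ... | no _    | false = refl

      ∉⇒lookup : ∀ {B : Subset n} {j} → j ∉ B → lookup B j ≡ false
      ∉⇒lookup {B} {j} j∉B = trans (sym (does-∈? B j)) (dec-false (j ∈? B) j∉B)

    weight-2-0 : ∀ B es → weight M 2 0 es B ≡ weightOf B B es
    weight-2-0 B []       = refl
    weight-2-0 B (e ∷ es) = cong₂ _*_
      (cong (λ b → if does (Any.any? (adj? M B e) es) then 1 else (if b then 2 else 0)) (does-∈? B e))
      (weight-2-0 B es)

    weight-0-2 : ∀ B es → weight M 0 2 es B ≡ weightOf (∁ B) B es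
    weight-0-2 B []       = refl
    weight-0-2 B (e ∷ es) = cong₂ _*_
      (cong (λ v → if does (Any.any? (adj? M B e) es) then 1 else v)
        (trans (cong (if_then 0 else 2) (does-∈? B e)) (trans (flip (lookup B e))
          (cong (if_then 2 else 0) (sym (lookup-map e not B))))))
      (weight-0-2 B es)
      where
      flip : ∀ b → (if b then 0 else 2) ≡ (if not b then 2 else 0)
      flip true  = refl
      flip false = refl

    weight-1-1 : ∀ B es → weight M 1 1 es B ≡ 1
    weight-1-1 B []       = refl
    weight-1-1 B (e ∷ es) = cong₂ _*_ (both (does (Any.any? (adj? M B e) es)) (does (e ∈? B))) (weight-1-1 B es)
      where
      both : ∀ a b → (if a then 1 else (if b then 1 else 1)) ≡ 1
      both true  _     = refl
      both false true  = refl
      both false false = refl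

    exchange-bipartite : ∀ B → Bipartite B (nbr M B)
    exchange-bipartite B i j eq with ∈-nbr⁻ M {B} {i} {j} (lookup⇒[]= j (nbr M B i) eq)
    ... | inj₁ (i∈B , j∉B , _) = trans (∉⇒lookup {B} j∉B) (cong not (sym ([]=⇒lookup i∈B)))
    ... | inj₂ (i∉B , j∈B , _) = trans ([]=⇒lookup j∈B) (cong not (sym (∉⇒lookup {B} i∉B)))

-- Summation over the bases and the final inequality

module MerinoWelsh where
  open import Data.Fin.Base using (Fin)
  open import Data.Fin.Subset using (Subset; ∁; ∣_∣; ⁅_⁆; _∪_; _∈_)
  open import Data.Fin.Subset.Properties using (_∈?_)
  open import Data.Integer.Base as ℤ using (ℤ; +_; -[1+_]; +≤+)
  import Data.Integer.Properties as ℤ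
  import Data.Integer.Solver as ℤ-Solver
  open import Data.List.Base using (List; []; _∷_; map; allFin)
  open import Data.List.Membership.Propositional as List using ()
  open import Data.List.Relation.Binary.Permutation.Propositional using (↭-refl)
  open import Data.List.Relation.Unary.Any using (here; there)
  open import Data.Nat.Base
  open import Data.Nat.ListAction using (sum)
  open import Data.Nat.Properties
  open import Data.Nat.Tactic.RingSolver using (solve-∀)
  open import Data.Product.Base using (_×_; _,_)
  open import Data.Sum.Base using (inj₁; inj₂)
  open import Data.Vec.Base using (Vec)
  open import Relation.Binary.PropositionalEquality
  open import Relation.Nullary using (Dec; yes; no; contradiction)
  open Configurations
  open LocalBound
  open ExchangeGraph
  open Activities
  open Expansion
  open ≤-Reasoning

  square-cancel-≤ : ∀ {a b} → a * a ≤ b * b → a ≤ b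
  square-cancel-≤ {a} {b} h with a ≤? b
  ... | yes a≤b = a≤b
  ... | no  a≰b = contradiction (*-mono-< (≰⇒> a≰b) (≰⇒> a≰b)) (≤⇒≯ h)

  4ab≤[a+b]² : ∀ a b → 4 * (a * b) ≤ (a + b) * (a + b)
  4ab≤[a+b]² a b with ≤-total a b
  ... | inj₁ a≤b with m≤n⇒∃[o]m+o≡n a≤b
  ...   | k , refl = ≤-trans (m≤m+n _ (k * k)) (≤-reflexive (expand a k))
    where
    expand : ∀ a k → 4 * (a * (a + k)) + k * k ≡ (a + (a + k)) * (a + (a + k))
    expand = solve-∀
  4ab≤[a+b]² a b | inj₂ b≤a with m≤n⇒∃[o]m+o≡n b≤a
  ...   | k , refl = ≤-trans (m≤m+n _ (k * k)) (≤-reflexive (expand b k))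
    where
    expand : ∀ b k → 4 * ((b + k) * b) + k * k ≡ (b + k + b) * (b + k + b)
    expand = solve-∀

  -- The mixed term needs 2xy ≤ Ab + aB. It is obtained by comparing squares, as 4x²y² ≤ 4(Ab)(aB) ≤
  -- (Ab + aB)², which avoids square roots.
  cauchySchwarz₂ : ∀ {x y A B a b} → x * x ≤ A * B → y * y ≤ a * b →
                   (x + y) * (x + y) ≤ (A + a) * (B + b)
  cauchySchwarz₂ {x} {y} {A} {B} {a} {b} hx hy = begin
    (x + y) * (x + y)                        ≡⟨ binomial x y ⟩
    x * x + y * y + 2 * (x * y)              ≤⟨ +-mono-≤ (+-mono-≤ hx hy) (square-cancel-≤ mixed) ⟩
    A * B + a * b + (A * b + a * B)          ≡⟨ collect A B a b ⟩
    (A + a) * (B + b)                        ∎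
    where
    binomial : ∀ x y → (x + y) * (x + y) ≡ x * x + y * y + 2 * (x * y)
    binomial = solve-∀
    collect : ∀ A B a b → A * B + a * b + (A * b + a * B) ≡ (A + a) * (B + b)
    collect = solve-∀
    square : ∀ x y → 2 * (x * y) * (2 * (x * y)) ≡ 4 * (x * x * (y * y))
    square = solve-∀
    swap : ∀ A B a b → 4 * (A * B * (a * b)) ≡ 4 * (A * b * (a * B))
    swap = solve-∀
    mixed : 2 * (x * y) * (2 * (x * y)) ≤ (A * b + a * B) * (A * b + a * B)
    mixed = begin
      2 * (x * y) * (2 * (x * y))            ≡⟨ square x y ⟩
      4 * (x * x * (y * y))                  ≤⟨ *-monoʳ-≤ 4 (*-mono-≤ hx hy) ⟩
      4 * (A * B * (a * b))                  ≡⟨ swap A B a b ⟩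
      4 * (A * b * (a * B))                  ≤⟨ 4ab≤[a+b]² (A * b) (a * B) ⟩
      (A * b + a * B) * (A * b + a * B)      ∎

  cauchySchwarz : ∀ {X : Set} (f g h : X → ℕ) → (∀ x → h x * h x ≤ f x * g x) → ∀ xs →
    sum (map h xs) * sum (map h xs) ≤ sum (map f xs) * sum (map g xs)
  cauchySchwarz f g h h²≤fg []       = z≤n
  cauchySchwarz f g h h²≤fg (x ∷ xs) =
    cauchySchwarz₂ {h x} {_} {f x} {g x} (h²≤fg x) (cauchySchwarz f g h h²≤fg xs)

  Σᶜ-sum : ∀ {n} {X : Set} L (w : Fin n → ℕ → ℕ) (h : Vec ℕ n → X → ℕ) xs →
    Σᶜ L w (λ c → sum (map (h c) xs)) ≡ sum (map (λ x → Σᶜ L w (λ c → h c x)) xs)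
  Σᶜ-sum L w h []       = trans (Σᶜ-const L w 0) (*-zeroʳ (Σᶜ L w (λ _ → 1)))
  Σᶜ-sum L w h (x ∷ xs) =
    trans (Σᶜ-+ L w _ _) (cong (λ s → Σᶜ L w (λ c → h c x) + s) (Σᶜ-sum L w h xs))

  sum-* : ∀ {X : Set} k (f : X → ℕ) xs → sum (map (λ x → k * f x) xs) ≡ k * sum (map f xs)
  sum-* k f []       = sym (*-zeroʳ k)
  sum-* k f (x ∷ xs) = trans (cong (λ s → k * f x + s) (sum-* k f xs)) (sym (*-distribˡ-+ k (f x) _))

  module _ {n : ℕ} (M : Matroid n) where
    open Matroid M

    basisSum : ℕ → ℕ → ℕ
    basisSum a b = sum (map (basisWeight M a b (allFin n)) (allSubsets n))

    tutte≡basisSum : ∀ a b → tutte M (+ a) (+ b) ≡ + basisSum a b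
    tutte≡basisSum a b = tutte-activities M a b ↭-refl

    averaged : ℕ → ℕ → ℕ → Subset n → ℕ
    averaged L a b B = Σᶜ L one (λ x → basisWeight M a b (sorted x) B)

    -- `basisSum` uses one fixed order, but its value is the same for every order, so each of the
    -- `L ^ n` configurations may use its own.
    averaged-sum : ∀ L a b → L ^ n * basisSum a b ≡ sum (map (averaged L a b) (allSubsets n))
    averaged-sum L a b = begin-equality
      L ^ n * basisSum a b
        ≡⟨ cong (_* basisSum a b) (Σᶜ-one n L) ⟨
      Σᶜ {n} L one (λ _ → 1) * basisSum a b
        ≡⟨ Σᶜ-const {n} L one (basisSum a b) ⟨
      Σᶜ {n} L one (λ _ → basisSum a b)
        ≡⟨ Σᶜ-cong {n} L one (λ x → ℤ.+-injective (trans (sym (tutte≡basisSum a b))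
             (tutte-activities M a b (sorted-↭ x)))) ⟩
      Σᶜ L one (λ x → sum (map (basisWeight M a b (sorted x)) (allSubsets n)))
        ≡⟨ Σᶜ-sum {n} L one (λ x → basisWeight M a b (sorted x)) (allSubsets n) ⟩
      sum (map (averaged L a b) (allSubsets n)) ∎

    module _ {P : ℕ → Set} (cal : Calibration P)
             (degrees : ∀ {B} → IsBasis B → ∀ i → P ∣ nbr M B i ∣) where
      open Calibration cal

      private
        K : ℕ
        K = L ^ n

        -- At (1,1) every activity factor is 1, so this is 1 on bases and 0 elsewhere, in any order.
        indicator : Subset n → ℕ
        indicator B = basisWeight M 1 1 (allFin n) B

        local : ∀ B → (K * indicator B) * (K * indicator B) ≤ averaged L 2 0 B * averaged L 0 2 B
        local B with isBasis? B
        ... | no  _ = ≤-trans (≤-reflexive (cong₂ _*_ (*-zeroʳ K) (*-zeroʳ K))) z≤n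
        ... | yes β = begin
          (K * weight M 1 1 (allFin n) B) * (K * weight M 1 1 (allFin n) B)
            ≡⟨ cong (λ v → (K * v) * (K * v)) (weight-1-1 M B (allFin n)) ⟩
          (K * 1) * (K * 1)
            ≡⟨ cong (λ v → v * v) (*-identityʳ K) ⟩
          K * K
            ≤⟨ orientedSum-∁ cal B (nbr M B) (exchange-bipartite M B) (degrees β) ⟩
          orientedSum L B (nbr M B) * orientedSum L (∁ B) (nbr M B)
            ≤⟨ *-mono-≤
                 (Σᶜ-mono {n} L one (λ x → ≤-trans (∏localFactor≤ M B B x)
                   (≤-reflexive (sym (weight-2-0 M B (sorted x))))))
                 (Σᶜ-mono {n} L one (λ x → ≤-trans (∏localFactor≤ M (∁ B) B x)
                   (≤-reflexive (sym (weight-0-2 M B (sorted x)))))) ⟩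
          Σᶜ L one (λ x → weight M 2 0 (sorted x) B) * Σᶜ L one (λ x → weight M 0 2 (sorted x) B) ∎

        basisSum-inequality : basisSum 1 1 * basisSum 1 1 ≤ basisSum 2 0 * basisSum 0 2
        basisSum-inequality = *-cancelˡ-≤ (K * K) {{>-nonZero (*-mono-≤ 1≤K 1≤K)}} (begin
          K * K * (basisSum 1 1 * basisSum 1 1)
            ≡⟨ interchange K K (basisSum 1 1) (basisSum 1 1) ⟩
          K * basisSum 1 1 * (K * basisSum 1 1)
            ≡⟨ cong (λ v → v * v) (sum-* K indicator (allSubsets n)) ⟨
          sum (map (λ B → K * indicator B) (allSubsets n)) * sum (map (λ B → K * indicator B) (allSubsets n))
            ≤⟨ cauchySchwarz (averaged L 2 0) (averaged L 0 2) (λ B → K * indicator B) local (allSubsets n) ⟩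
          sum (map (averaged L 2 0) (allSubsets n)) * sum (map (averaged L 0 2) (allSubsets n))
            ≡⟨ cong₂ _*_ (averaged-sum L 2 0) (averaged-sum L 0 2) ⟨
          K * basisSum 2 0 * (K * basisSum 0 2)
            ≡⟨ interchange K K (basisSum 2 0) (basisSum 0 2) ⟨
          K * K * (basisSum 2 0 * basisSum 0 2) ∎)
          where
          1≤K : 1 ≤ K
          1≤K = 1≤^ 1≤L n
          interchange : ∀ a b c d → a * b * (c * d) ≡ a * c * (b * d)
          interchange = solve-∀

      merinoWelsh : tutte M (+ 1) (+ 1) ℤ.^ 2 ℤ.≤ tutte M (+ 2) (+ 0) ℤ.* tutte M (+ 0) (+ 2)
      merinoWelsh = subst₂ ℤ._≤_
        (sym (trans (cong (ℤ._^ 2) (tutte≡basisSum 1 1))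
          (trans (cong (λ v → + basisSum 1 1 ℤ.* v) (ℤ.*-identityʳ (+ basisSum 1 1)))
            (sym (ℤ.pos-* (basisSum 1 1) (basisSum 1 1))))))
        (sym (trans (cong₂ ℤ._*_ (tutte≡basisSum 2 0) (tutte≡basisSum 0 2))
          (sym (ℤ.pos-* (basisSum 2 0) (basisSum 0 2)))))
        (+≤+ basisSum-inequality)

    Bounded : ℤ → ℕ → Set
    Bounded ℓ c = ℓ ℤ.≤ + c × + c ℤ.≤ (ℓ ℤ.- + 2) ℤ.^ 2 ℤ.* (ℓ ℤ.^ 2 ℤ.- + 4 ℤ.* ℓ ℤ.+ + 2)

    degree-bounded : ∀ ℓ →
      (∀ C → IsCircuit C → Bounded ℓ ∣ C ∣) →
      (∀ C → Matroid.IsCircuit (dual M) C → Bounded ℓ ∣ C ∣) →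
      ∀ {B} → IsBasis B → ∀ i → Bounded ℓ (suc ∣ nbr M B i ∣)
    degree-bounded ℓ circuits cocircuits {B} β i =
      subst (Bounded ℓ) (∣nbr+self∣ M B i) (either (i ∈? B))
      where
      either : Dec (i ∈ B) → Bounded ℓ ∣ nbr M B i ∪ ⁅ i ⁆ ∣
      either (yes i∈B) = cocircuits _ (fundamentalCocircuit M β i∈B)
      either (no  i∉B) = circuits _ (fundamentalCircuit M β i∉B)

    bounded-4 : ∀ {d} → Bounded (+ 4) (suc d) → d List.∈ ShortCircuits.shortDegrees
    -- The upper bound evaluates to 2² · 2 = 8, and the degree is one less than the circuit length.
    bounded-4 (+≤+ (s≤s 3≤d) , +≤+ (s≤s d≤7)) = enumerate 3≤d d≤7
      where
      enumerate : ∀ {d} → 3 ≤ d → d ≤ 7 → d List.∈ ShortCircuits.shortDegrees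
      enumerate {3} _ _ = here refl
      enumerate {4} _ _ = there (here refl)
      enumerate {5} _ _ = there (there (here refl))
      enumerate {6} _ _ = there (there (there (here refl)))
      enumerate {7} _ _ = there (there (there (there (here refl))))
      enumerate {suc (suc (suc (suc (suc (suc (suc (suc d)))))))} _
        (s≤s (s≤s (s≤s (s≤s (s≤s (s≤s (s≤s ())))))))
      enumerate {0} () _
      enumerate {1} (s≤s ()) _
      enumerate {2} (s≤s (s≤s ())) _

    -- The bound (ℓ-2)²(ℓ²-4ℓ+2) equals ((ℓ-2)²-1)² - 1, so being at most this bound is being
    -- strictly below the square of `side`. The identity is stated with a leading -1 because
    -- `ℤ.pred` unfolds to that form.
    bounded-5+ : ∀ e {d} → Bounded (+ (5 + e)) (suc d) → LongCircuits.Admissible e d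
    bounded-5+ e {d} (+≤+ (s≤s 4+e≤d) , upper) = 4+e≤d , ℤ.drop‿+<+ (ℤ.i≤pred[j]⇒i<j
      (subst (+ suc d ℤ.≤_) bound≡ upper))
      where
      side : ℕ
      side = 8 + 6 * e + e * e
      side≡ : + side ≡ + 8 ℤ.+ + 6 ℤ.* + e ℤ.+ + e ℤ.* + e
      side≡ = trans (ℤ.pos-+ (8 + 6 * e) (e * e)) (cong₂ ℤ._+_
        (trans (ℤ.pos-+ 8 (6 * e)) (cong (λ v → + 8 ℤ.+ v) (ℤ.pos-* 6 e))) (ℤ.pos-* e e))
      polynomial : ∀ ε → ((+ 5 ℤ.+ ε) ℤ.- + 2) ℤ.^ 2 ℤ.*
                         ((+ 5 ℤ.+ ε) ℤ.^ 2 ℤ.- + 4 ℤ.* (+ 5 ℤ.+ ε) ℤ.+ + 2) ≡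
        ℤ.- + 1 ℤ.+ (+ 8 ℤ.+ + 6 ℤ.* ε ℤ.+ ε ℤ.* ε) ℤ.* (+ 8 ℤ.+ + 6 ℤ.* ε ℤ.+ ε ℤ.* ε)
      polynomial = solve 1 (λ ε →
        ((con (+ 5) :+ ε) :- con (+ 2)) :^ 2 :*
        ((con (+ 5) :+ ε) :^ 2 :- con (+ 4) :* (con (+ 5) :+ ε) :+ con (+ 2)) :=
        :- con (+ 1) :+ (con (+ 8) :+ con (+ 6) :* ε :+ ε :* ε) :* (con (+ 8) :+ con (+ 6) :* ε :+ ε :* ε)) refl
        where open ℤ-Solver.+-*-Solver
      bound≡ : (+ (5 + e) ℤ.- + 2) ℤ.^ 2 ℤ.* ((+ (5 + e)) ℤ.^ 2 ℤ.- + 4 ℤ.* + (5 + e) ℤ.+ + 2) ≡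
               ℤ.pred (+ (side * side))
      bound≡ = trans (polynomial (+ e)) (cong (λ v → ℤ.- + 1 ℤ.+ v)
        (sym (trans (ℤ.pos-* side side) (cong₂ ℤ._*_ side≡ side≡))))

    merinoWelsh-bounded : ∀ ℓ → + 4 ℤ.≤ ℓ →
      (∀ C → IsCircuit C → Bounded ℓ ∣ C ∣) →
      (∀ C → Matroid.IsCircuit (dual M) C → Bounded ℓ ∣ C ∣) →
      tutte M (+ 1) (+ 1) ℤ.^ 2 ℤ.≤ tutte M (+ 2) (+ 0) ℤ.* tutte M (+ 0) (+ 2)
    merinoWelsh-bounded (+ 4) _ circuits cocircuits =
      merinoWelsh ShortCircuits.calibration
        (λ β i → bounded-4 (degree-bounded (+ 4) circuits cocircuits β i))
    merinoWelsh-bounded (+ suc (suc (suc (suc (suc e))))) _ circuits cocircuits =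
      merinoWelsh (LongCircuits.calibration e)
        (λ β i → bounded-5+ e (degree-bounded (+ (5 + e)) circuits cocircuits β i))
    merinoWelsh-bounded (+ 0) (+≤+ ())
    merinoWelsh-bounded (+ 1) (+≤+ (s≤s ()))
    merinoWelsh-bounded (+ 2) (+≤+ (s≤s (s≤s ())))
    merinoWelsh-bounded (+ 3) (+≤+ (s≤s (s≤s (s≤s ()))))
    merinoWelsh-bounded -[1+ _ ] ()

open import Data.Nat.Base using (ℕ)
open import Data.Integer.Base using (ℤ; +_; _+_; _-_; _*_; _^_; _≤_; _≥_)
open import Data.Fin.Subset using (Subset; ∣_∣)
open import Data.Product.Base using (∃-syntax; _×_; _,_)

theorem1p4 : ∀ {n : ℕ} (M : Matroid n) →
    (∃[ ℓ ] ℓ ≥ + 4 ×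
    (∀ (C : Subset n) → Matroid.IsCircuit M C →
    ℓ ≤ + ∣ C ∣ × + ∣ C ∣ ≤ (ℓ - + 2) ^ 2 * (ℓ ^ 2 - + 4 * ℓ + + 2)) ×
    (∀ (C : Subset n) → Matroid.IsCircuit (dual M) C →
    ℓ ≤ + ∣ C ∣ × + ∣ C ∣ ≤ (ℓ - + 2) ^ 2 * (ℓ ^ 2 - + 4 * ℓ + + 2))) →
    tutte M (+ 2) (+ 0) * tutte M (+ 0) (+ 2) ≥ tutte M (+ 1) (+ 1) ^ 2
theorem1p4 M (ℓ , 4≤ℓ , circuits , cocircuits) =
  MerinoWelsh.merinoWelsh-bounded M ℓ 4≤ℓ circuits cocircuits
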